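{- Let $\boldsymbol{X}_W\in\mathbb{R}^{(d_x+1)\times N}$ and $\boldsymbol{Y}_W\in\mathbb{R}^{(d_y+1)\times N}$ be the sliding window matrices of a stream in which $1\le\|\boldsymbol{x}\|_2^2,\ \|\boldsymbol{y}\|_2^2\le R+1$ for all columns $\boldsymbol{x}$ of $\boldsymbol{X}_W$ and $\boldsymbol{y}$ of $\boldsymbol{Y}_W$. A deterministic algorithm that returns $(\boldsymbol{A}_W,\boldsymbol{B}_W)$ such that $$\left\|\boldsymbol{X}_W\boldsymbol{Y}_W^\top-\boldsymbol{A}_W\boldsymbol{B}_W^\top\right\|_2\le\frac{\epsilon}{3}\,\|\boldsymbol{X}_W\|_F\,\|\boldsymbol{Y}_W\|_F ,$$ where $\epsilon=1/l$ and $N\ge\frac{1}{2\epsilon}\log\frac{R}{\epsilon}$, must use $\Omega\left(\frac{d_x+d_y}{\epsilon}\log R\right)$ space.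
   Context: Sliding window streaming model: pairs $(\boldsymbol{x}_t,\boldsymbol{y}_t)\in\mathbb{R}^{d_x+1}\times\mathbb{R}^{d_y+1}$ arrive one at a time, $t=1,2,\dots$. For the fixed window size $N$ and each time $T\ge N$, $\boldsymbol{X}_W=[\boldsymbol{x}_{T-N+1},\dots,\boldsymbol{x}_T]$ and $\boldsymbol{Y}_W=[\boldsymbol{y}_{T-N+1},\dots,\boldsymbol{y}_T]$. The algorithm processes the stream and must return, at every time $T\ge N$, matrices $\boldsymbol{A}_W$ and $\boldsymbol{B}_W$ (with $d_x+1$ and $d_y+1$ rows respectively and a common number of columns) satisfying the stated error bound for the current window, for every such stream. Here $l$ is a positive integer. Space is measured in bits, assuming a constant number of bits per word. Logarithms are base 2. $\|\cdot\|_2$ is the Euclidean norm for vectors and the spectral norm for matrices; $\|\cdot\|_F$ is the Frobenius norm. -}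

module Defs where

open import Data.Bool.Base using (Bool)
open import Data.Fin.Base using (Fin; toℕ)
open import Data.Integer.Base as Int using (+_)
import Data.Integer.Properties as ℤₚ
open import Data.Nat.Base as Nat using (ℕ; zero; suc; NonZero; s≤s; z≤n)
import Data.Nat.DivMod as ℕDM
open import Data.Nat.Induction using (<-rec)
open import Data.Nat.Logarithm using (⌊log₂_⌋; ⌊log₂⌋-mono-≤; ⌊log₂[2^n]⌋≡n; ⌊log₂⌊n/2⌋⌋≡⌊log₂n⌋∸1)
import Data.Nat.Properties as ℕₚ
import Data.Nat.Solver as ℕSolver
open import Data.Product using (Σ; Σ-syntax; ∃-syntax; _×_; _,_; proj₁; proj₂)
open import Data.Rational.Base as Rat using (ℚ; 0ℚ; 1ℚ; ½; ↥_; ↧ₙ_; mkℚ)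
import Data.Rational.Properties as ℚₚ
import Data.Rational.Unnormalised.Base as ℚᵘ
import Data.Rational.Unnormalised.Properties as ℚᵘₚ
import Data.Rational.Solver as ℚSolver
open import Data.Sum.Base using (inj₁; inj₂)
open import Data.Vec.Base using (Vec)
open import Data.Vec.Functional using (Vector; foldr; transpose)
open import Relation.Binary.PropositionalEquality
open import Relation.Nullary using (yes; no)

------------------------------------------------------------------------
-- Naturals

module Natural where

  open Nat
  open ℕₚ
  open ≤-Reasoning
  open ℕSolver.+-*-Solver

  ⌊√_⌋ : ℕ → ℕ
  ⌊√ zero ⌋  = zero
  ⌊√ suc n ⌋ with suc ⌊√ n ⌋ * suc ⌊√ n ⌋ ≤? suc n
  ... | yes _ = suc ⌊√ n ⌋
  ... | no  _ = ⌊√ n ⌋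

  ⌊√n⌋²≤n : ∀ n → ⌊√ n ⌋ * ⌊√ n ⌋ ≤ n
  ⌊√n⌋²≤n zero = z≤n
  ⌊√n⌋²≤n (suc n) with suc ⌊√ n ⌋ * suc ⌊√ n ⌋ ≤? suc n
  ... | yes p = p
  ... | no  _ = m≤n⇒m≤1+n (⌊√n⌋²≤n n)

  n<[1+⌊√n⌋]² : ∀ n → n < suc ⌊√ n ⌋ * suc ⌊√ n ⌋
  n<[1+⌊√n⌋]² zero = s≤s z≤n
  n<[1+⌊√n⌋]² (suc n) with suc ⌊√ n ⌋ * suc ⌊√ n ⌋ ≤? suc n
  ... | no  p = ≰⇒> p
  ... | yes _ = begin-strict
    suc n                        ≤⟨ n<[1+⌊√n⌋]² n ⟩
    suc r * suc r                <⟨ *-mono-< (n<1+n (suc r)) (n<1+n (suc r)) ⟩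
    suc (suc r) * suc (suc r)    ∎
    where r = ⌊√ n ⌋

  n<2^[1+⌊log₂n⌋] : ∀ n → n < 2 ^ suc ⌊log₂ n ⌋
  n<2^[1+⌊log₂n⌋] n = ≰⇒> λ le → 1+n≰n (begin
    suc ⌊log₂ n ⌋               ≡⟨ sym (⌊log₂[2^n]⌋≡n (suc ⌊log₂ n ⌋)) ⟩
    ⌊log₂ 2 ^ suc ⌊log₂ n ⌋ ⌋   ≤⟨ ⌊log₂⌋-mono-≤ le ⟩
    ⌊log₂ n ⌋                   ∎)

  2^⌊log₂n⌋≤n : ∀ n .{{_ : NonZero n}} → 2 ^ ⌊log₂ n ⌋ ≤ n
  2^⌊log₂n⌋≤n = <-rec (λ n → .{{_ : NonZero n}} → 2 ^ ⌊log₂ n ⌋ ≤ n) step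
    where
    step : ∀ n → (∀ {m} → m < n → .{{_ : NonZero m}} → 2 ^ ⌊log₂ m ⌋ ≤ m) →
           .{{_ : NonZero n}} → 2 ^ ⌊log₂ n ⌋ ≤ n
    step 1 _ = s≤s z≤n
    step n@(suc (suc n′)) rec = begin
      2 ^ ⌊log₂ n ⌋                ≤⟨ ^-monoʳ-≤ 2 (m≤n+m∸n ⌊log₂ n ⌋ 1) ⟩
      2 * 2 ^ (⌊log₂ n ⌋ ∸ 1)      ≡⟨ cong (λ e → 2 * 2 ^ e) (sym (⌊log₂⌊n/2⌋⌋≡⌊log₂n⌋∸1 n)) ⟩
      2 * 2 ^ ⌊log₂ ⌊ n /2⌋ ⌋      ≤⟨ *-monoʳ-≤ 2 (rec (⌊n/2⌋<n (suc n′))) ⟩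
      2 * ⌊ n /2⌋                  ≡⟨ cong (λ e → ⌊ n /2⌋ + e) (+-identityʳ _) ⟩
      ⌊ n /2⌋ + ⌊ n /2⌋            ≤⟨ +-monoʳ-≤ ⌊ n /2⌋ (⌊n/2⌋≤⌈n/2⌉ n) ⟩
      ⌊ n /2⌋ + ⌈ n /2⌉            ≡⟨ ⌊n/2⌋+⌈n/2⌉≡n n ⟩
      n                            ∎

  ^-distrib-* : ∀ a b k → (a * b) ^ k ≡ a ^ k * b ^ k
  ^-distrib-* a b zero    = refl
  ^-distrib-* a b (suc k) = trans (cong (a * b *_) (^-distrib-* a b k))
    (solve 4 (λ a b x y → (a :* b) :* (x :* y) := (a :* x) :* (b :* y)) refl a b (a ^ k) (b ^ k))

  [1+r+t]^r*t≤[r+t]^[1+r] : ∀ r t → suc (r + t) ^ r * t ≤ (r + t) ^ suc r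
  [1+r+t]^r*t≤[r+t]^[1+r] r t = go r t (r + t) refl
    where
    go : ∀ r t n → r + t ≡ n → suc n ^ r * t ≤ n ^ suc r
    go zero    t n refl = ≤-reflexive (trans (+-identityʳ t) (sym (*-identityʳ t)))
    go (suc r) t n refl = begin
      suc n * suc n ^ r * t        ≡⟨ solve 3 (λ a b c → a :* b :* c := b :* (a :* c)) refl (suc n) (suc n ^ r) t ⟩
      suc n ^ r * (suc n * t)      ≤⟨ *-monoʳ-≤ (suc n ^ r) bound ⟩
      suc n ^ r * (suc t * n)      ≡⟨ sym (*-assoc (suc n ^ r) (suc t) n) ⟩
      suc n ^ r * suc t * n        ≤⟨ *-monoˡ-≤ n (go r (suc t) n (+-suc r t)) ⟩
      n ^ suc r * n                ≡⟨ *-comm (n ^ suc r) n ⟩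
      n ^ suc (suc r)              ∎
      where
      bound : suc n * t ≤ suc t * n
      bound = begin
        t + n * t   ≤⟨ +-mono-≤ (m≤n+m t (suc r)) (≤-reflexive (*-comm n t)) ⟩
        n + t * n   ∎

  [1+1/2p]^p≤2 : ∀ p .{{_ : NonZero p}} → suc (p + p) ^ p ≤ 2 * (p + p) ^ p
  [1+1/2p]^p≤2 p = *-cancelʳ-≤ _ _ p (begin
    suc (p + p) ^ p * p       ≤⟨ [1+r+t]^r*t≤[r+t]^[1+r] p p ⟩
    (p + p) * (p + p) ^ p     ≡⟨ solve 2 (λ p x → (p :+ p) :* x := con 2 :* x :* p) refl p ((p + p) ^ p) ⟩
    2 * (p + p) ^ p * p       ∎)

  -- With A = ⌊log₂ aᵏ⌋, B = ⌊log₂ bᵏ⌋, C = ⌊log₂ cᵐ⌋, D = ⌊log₂ dᵐ⌋: if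
  -- a/b ≤ (1 + 1/2p) (c/d) then (A - B)/k ≤ (C - D)/m + 1/p + 1/k + 1/m.
  log-compare : ∀ a b c d p k m →
    .{{_ : NonZero a}} .{{_ : NonZero b}} .{{_ : NonZero c}} .{{_ : NonZero d}} .{{_ : NonZero p}} →
    (p + p) * (a * d) ≤ suc (p + p) * (b * c) →
    ⌊log₂ a ^ k ⌋ * (p * m) + ⌊log₂ d ^ m ⌋ * (p * k) ≤
      k * m + (suc ⌊log₂ b ^ k ⌋ * (p * m) + suc ⌊log₂ c ^ m ⌋ * (p * k))
  log-compare a b c d p k m h = 2^-cancel (begin
    2 ^ (A * (p * m) + D * (p * k))
      ≡⟨ ^-distribˡ-+-* 2 (A * (p * m)) (D * (p * k)) ⟩
    2 ^ (A * (p * m)) * 2 ^ (D * (p * k))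
      ≡⟨ cong₂ _*_ (sym (^-*-assoc 2 A (p * m))) (sym (^-*-assoc 2 D (p * k))) ⟩
    (2 ^ A) ^ (p * m) * (2 ^ D) ^ (p * k)
      ≤⟨ *-mono-≤ (^-monoˡ-≤ (p * m) (2^⌊log₂n⌋≤n (a ^ k) {{m^n≢0 a k}}))
                  (^-monoˡ-≤ (p * k) (2^⌊log₂n⌋≤n (d ^ m) {{m^n≢0 d m}})) ⟩
    (a ^ k) ^ (p * m) * (d ^ m) ^ (p * k)
      ≡⟨ regroup a d ⟩
    ((a * d) ^ p) ^ (k * m)
      ≤⟨ ^-monoˡ-≤ (k * m) ratio ⟩
    (2 * (b * c) ^ p) ^ (k * m)
      ≡⟨ ^-distrib-* 2 ((b * c) ^ p) (k * m) ⟩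
    2 ^ (k * m) * ((b * c) ^ p) ^ (k * m)
      ≡⟨ cong (2 ^ (k * m) *_) (sym (regroup b c)) ⟩
    2 ^ (k * m) * ((b ^ k) ^ (p * m) * (c ^ m) ^ (p * k))
      ≤⟨ *-monoʳ-≤ (2 ^ (k * m))
           (*-mono-≤ (^-monoˡ-≤ (p * m) (<⇒≤ (n<2^[1+⌊log₂n⌋] (b ^ k))))
                     (^-monoˡ-≤ (p * k) (<⇒≤ (n<2^[1+⌊log₂n⌋] (c ^ m))))) ⟩
    2 ^ (k * m) * ((2 ^ suc B) ^ (p * m) * (2 ^ suc C) ^ (p * k))
      ≡⟨ cong (2 ^ (k * m) *_) (cong₂ _*_ (^-*-assoc 2 (suc B) (p * m)) (^-*-assoc 2 (suc C) (p * k))) ⟩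
    2 ^ (k * m) * (2 ^ (suc B * (p * m)) * 2 ^ (suc C * (p * k)))
      ≡⟨ cong (2 ^ (k * m) *_) (sym (^-distribˡ-+-* 2 (suc B * (p * m)) (suc C * (p * k)))) ⟩
    2 ^ (k * m) * 2 ^ (suc B * (p * m) + suc C * (p * k))
      ≡⟨ sym (^-distribˡ-+-* 2 (k * m) (suc B * (p * m) + suc C * (p * k))) ⟩
    2 ^ (k * m + (suc B * (p * m) + suc C * (p * k))) ∎)
    where
    A = ⌊log₂ a ^ k ⌋
    B = ⌊log₂ b ^ k ⌋
    C = ⌊log₂ c ^ m ⌋
    D = ⌊log₂ d ^ m ⌋

    2^-cancel : ∀ {x y} → 2 ^ x ≤ 2 ^ y → x ≤ y
    2^-cancel {x} {y} le =
      subst₂ _≤_ (⌊log₂[2^n]⌋≡n x) (⌊log₂[2^n]⌋≡n y) (⌊log₂⌋-mono-≤ le)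

    regroup : ∀ x y → (x ^ k) ^ (p * m) * (y ^ m) ^ (p * k) ≡ ((x * y) ^ p) ^ (k * m)
    regroup x y = begin-equality
      (x ^ k) ^ (p * m) * (y ^ m) ^ (p * k)
        ≡⟨ cong₂ _*_ (^-*-assoc x k (p * m)) (^-*-assoc y m (p * k)) ⟩
      x ^ (k * (p * m)) * y ^ (m * (p * k))
        ≡⟨ cong₂ (λ s t → x ^ s * y ^ t)
             (solve 3 (λ k p m → k :* (p :* m) := p :* (k :* m)) refl k p m)
             (solve 3 (λ k p m → m :* (p :* k) := p :* (k :* m)) refl k p m) ⟩
      x ^ (p * (k * m)) * y ^ (p * (k * m))
        ≡⟨ sym (^-distrib-* x y (p * (k * m))) ⟩
      (x * y) ^ (p * (k * m))
        ≡⟨ sym (^-*-assoc (x * y) p (k * m)) ⟩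
      ((x * y) ^ p) ^ (k * m) ∎

    instance
      p+p≢0 : NonZero (p + p)
      p+p≢0 = >-nonZero (≤-trans (>-nonZero⁻¹ p) (m≤m+n p p))

    ratio : (a * d) ^ p ≤ 2 * (b * c) ^ p
    ratio = *-cancelˡ-≤ ((p + p) ^ p) {{m^n≢0 (p + p) p}} (begin
      (p + p) ^ p * (a * d) ^ p          ≡⟨ sym (^-distrib-* (p + p) (a * d) p) ⟩
      ((p + p) * (a * d)) ^ p            ≤⟨ ^-monoˡ-≤ p h ⟩
      (suc (p + p) * (b * c)) ^ p        ≡⟨ ^-distrib-* (suc (p + p)) (b * c) p ⟩
      suc (p + p) ^ p * (b * c) ^ p      ≤⟨ *-monoˡ-≤ ((b * c) ^ p) ([1+1/2p]^p≤2 p) ⟩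
      2 * (p + p) ^ p * (b * c) ^ p
        ≡⟨ solve 2 (λ x y → con 2 :* x :* y := x :* (con 2 :* y)) refl ((p + p) ^ p) ((b * c) ^ p) ⟩
      (p + p) ^ p * (2 * (b * c) ^ p)    ∎)

open Natural using (⌊√_⌋)

------------------------------------------------------------------------
-- Rationals

module Embedding where

  open Rat
  open ℚₚ
  open ℚᵘₚ.≤-Reasoning

  ι : ℕ → ℚ
  ι n = + n / 1

  toℚᵘ-/ : ∀ n k → toℚᵘ (+ n / suc k) ℚᵘ.≃ ℚᵘ.mkℚᵘ (+ n) k
  toℚᵘ-/ n k = toℚᵘ-fromℚᵘ (ℚᵘ.mkℚᵘ (+ n) k)

  ι-+ : ∀ m n → ι (m Nat.+ n) ≡ ι m + ι n
  ι-+ m n = toℚᵘ-injective (begin-equality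
    toℚᵘ (ι (m Nat.+ n))          ≃⟨ toℚᵘ-/ (m Nat.+ n) 0 ⟩
    ℚᵘ.mkℚᵘ (+ (m Nat.+ n)) 0     ≃⟨ ℚᵘ.*≡* (cong (λ z → z Int.* + 1) (cong₂ Int._+_ (sym (ℤₚ.*-identityʳ (+ m))) (sym (ℤₚ.*-identityʳ (+ n))))) ⟩
    ℚᵘ.mkℚᵘ (+ m) 0 ℚᵘ.+ ℚᵘ.mkℚᵘ (+ n) 0 ≃⟨ ℚᵘₚ.+-cong (ℚᵘₚ.≃-sym (toℚᵘ-/ m 0)) (ℚᵘₚ.≃-sym (toℚᵘ-/ n 0)) ⟩
    toℚᵘ (ι m) ℚᵘ.+ toℚᵘ (ι n)    ≃⟨ ℚᵘₚ.≃-sym (toℚᵘ-homo-+ (ι m) (ι n)) ⟩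
    toℚᵘ (ι m + ι n)              ∎)

  /-*-ι : ∀ n k → (+ n / suc k) * ι (suc k) ≡ ι n
  /-*-ι n k = toℚᵘ-injective (begin-equality
    toℚᵘ ((+ n / suc k) * ι (suc k))             ≃⟨ toℚᵘ-homo-* (+ n / suc k) (ι (suc k)) ⟩
    toℚᵘ (+ n / suc k) ℚᵘ.* toℚᵘ (ι (suc k))     ≃⟨ ℚᵘₚ.*-cong (toℚᵘ-/ n k) (toℚᵘ-/ (suc k) 0) ⟩
    ℚᵘ.mkℚᵘ (+ n) k ℚᵘ.* ℚᵘ.mkℚᵘ (+ suc k) 0     ≃⟨ ℚᵘ.*≡* (trans (ℤₚ.*-identityʳ _) (cong (λ d → + n Int.* + d) (sym (ℕₚ.*-identityʳ (suc k))))) ⟩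
    ℚᵘ.mkℚᵘ (+ n) 0                              ≃⟨ ℚᵘₚ.≃-sym (toℚᵘ-/ n 0) ⟩
    toℚᵘ (ι n)                                   ∎)

  ι-* : ∀ m n → ι (m Nat.* n) ≡ ι m * ι n
  ι-* m n = toℚᵘ-injective (begin-equality
    toℚᵘ (ι (m Nat.* n))                   ≃⟨ toℚᵘ-/ (m Nat.* n) 0 ⟩
    ℚᵘ.mkℚᵘ (+ (m Nat.* n)) 0              ≃⟨ ℚᵘ.*≡* (cong (λ z → z Int.* + 1) (ℤₚ.pos-* m n)) ⟩
    ℚᵘ.mkℚᵘ (+ m) 0 ℚᵘ.* ℚᵘ.mkℚᵘ (+ n) 0   ≃⟨ ℚᵘₚ.*-cong (ℚᵘₚ.≃-sym (toℚᵘ-/ m 0)) (ℚᵘₚ.≃-sym (toℚᵘ-/ n 0)) ⟩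
    toℚᵘ (ι m) ℚᵘ.* toℚᵘ (ι n)             ≃⟨ ℚᵘₚ.≃-sym (toℚᵘ-homo-* (ι m) (ι n)) ⟩
    toℚᵘ (ι m * ι n)                       ∎)

module Rational where

  open Rat
  open ℚₚ
  open ≤-Reasoning
  open ℚSolver.+-*-Solver
  open Embedding public

  0≤ι : ∀ n → 0ℚ ≤ ι n
  0≤ι n = nonNegative⁻¹ (ι n) {{normalize-nonNeg n 1}}

  opaque

    0<ι : ∀ n .{{_ : Nat.NonZero n}} → 0ℚ < ι n
    0<ι n = positive⁻¹ (ι n) {{normalize-pos n 1}}

  ι-mono-≤ : ∀ {m n} → m Nat.≤ n → ι m ≤ ι n
  ι-mono-≤ {m} {n} m≤n = begin
    ι m                     ≡⟨ sym (+-identityʳ (ι m)) ⟩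
    ι m + 0ℚ                ≤⟨ +-monoʳ-≤ (ι m) (0≤ι (n Nat.∸ m)) ⟩
    ι m + ι (n Nat.∸ m)     ≡⟨ sym (ι-+ m (n Nat.∸ m)) ⟩
    ι (m Nat.+ (n Nat.∸ m)) ≡⟨ cong ι (ℕₚ.m+[n∸m]≡n m≤n) ⟩
    ι n                     ∎

  ι-mono-< : ∀ {m n} → m Nat.< n → ι m < ι n
  ι-mono-< {m} {n} m<n = begin-strict
    ι m           ≡⟨ sym (+-identityʳ (ι m)) ⟩
    ι m + 0ℚ      <⟨ +-monoʳ-< (ι m) (0<ι 1) ⟩
    ι m + ι 1     ≡⟨ trans (sym (ι-+ m 1)) (cong ι (ℕₚ.+-comm m 1)) ⟩
    ι (suc m)     ≤⟨ ι-mono-≤ m<n ⟩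
    ι n           ∎

  ι-cancel-≤ : ∀ {m n} → ι m ≤ ι n → m Nat.≤ n
  ι-cancel-≤ le = ℕₚ.≮⇒≥ λ lt → <-irrefl refl (<-≤-trans (ι-mono-< lt) le)

  num : ℚ → ℕ
  num q = Int.∣ ↥ q ∣

  num/den : ∀ q → 0ℚ ≤ q → q * ι (↧ₙ q) ≡ ι (num q)
  num/den q 0≤q with nonNegative 0≤q
  num/den q@(mkℚ (+ n) d _) 0≤q | _ =
    trans (cong (_* ι (suc d)) (sym (↥p/↧p≡p q))) (/-*-ι n d)

  num≢0 : ∀ q → 0ℚ < q → Nat.NonZero (num q)
  num≢0 q 0<q with positive 0<q
  num≢0 (mkℚ (+ suc n) d _) 0<q | _ = _

  *-monoˡ : ∀ {r p q} → 0ℚ ≤ r → p ≤ q → r * p ≤ r * q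
  *-monoˡ {r} 0≤r = *-monoˡ-≤-nonNeg r {{nonNegative 0≤r}}

  *-monoʳ : ∀ {r p q} → 0ℚ ≤ r → p ≤ q → p * r ≤ q * r
  *-monoʳ {r} 0≤r = *-monoʳ-≤-nonNeg r {{nonNegative 0≤r}}

  *-mono : ∀ {p q r s} → 0ℚ ≤ p → 0ℚ ≤ s → p ≤ q → r ≤ s → p * r ≤ q * s
  *-mono 0≤p 0≤s p≤q r≤s = ≤-trans (*-monoˡ 0≤p r≤s) (*-monoʳ 0≤s p≤q)

  *-cancelʳ : ∀ {r p q} → 0ℚ < r → p * r ≤ q * r → p ≤ q
  *-cancelʳ {r} 0<r = *-cancelʳ-≤-pos r {{positive 0<r}}

  opaque

    *-pos : ∀ {p q} → 0ℚ < p → 0ℚ < q → 0ℚ < p * q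
    *-pos {p} {q} 0<p 0<q = positive⁻¹ (p * q) {{pos*pos⇒pos p {{positive 0<p}} q {{positive 0<q}}}}

  opaque

    *-nonNeg : ∀ {p q} → 0ℚ ≤ p → 0ℚ ≤ q → 0ℚ ≤ p * q
    *-nonNeg {p} {q} 0≤p 0≤q =
      nonNegative⁻¹ (p * q) {{nonNeg*nonNeg⇒nonNeg p {{nonNegative 0≤p}} q {{nonNegative 0≤q}}}}

  opaque

    +-nonNeg : ∀ {p q} → 0ℚ ≤ p → 0ℚ ≤ q → 0ℚ ≤ p + q
    +-nonNeg = +-mono-≤

  opaque

    +-pos : ∀ {p q} → 0ℚ < p → 0ℚ < q → 0ℚ < p + q
    +-pos = +-mono-<

  opaque

    divide : ∀ {p e} → 0ℚ < p → 0ℚ < e → Σ[ d ∈ ℚ ] 0ℚ < d × d * p ≡ e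
    divide {p} {e} 0<p 0<e = e * 1/ p , *-pos 0<e (positive⁻¹ (1/ p) {{1/pos⇒pos p}}) , (begin-equality
      e * 1/ p * p     ≡⟨ *-assoc e (1/ p) p ⟩
      e * (1/ p * p)   ≡⟨ cong (e *_) (*-inverseˡ p) ⟩
      e * 1ℚ           ≡⟨ *-identityʳ e ⟩
      e                ∎)
      where
      instance
        p>0 : Rat.Positive p
        p>0 = positive 0<p
        p≢0 : Rat.NonZero p
        p≢0 = pos⇒nonZero p

  opaque

    half : ∀ {e} → 0ℚ < e → Σ[ d ∈ ℚ ] 0ℚ < d × d + d ≡ e
    half {e} 0<e = e * ½ , *-pos 0<e (positive⁻¹ ½) ,
      solve 1 (λ e → e :* con ½ :+ e :* con ½ := e) refl e

  opaque

    third : ∀ {e} → 0ℚ < e → Σ[ d ∈ ℚ ] 0ℚ < d × d + d + d ≡ e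
    third {e} 0<e = e * ⅓ , *-pos 0<e (positive⁻¹ ⅓) ,
      solve 1 (λ e → e :* con ⅓ :+ e :* con ⅓ :+ e :* con ⅓ := e) refl e
      where
      ⅓ : ℚ
      ⅓ = + 1 / 3

  opaque

    archimedean : ∀ {e} → 0ℚ < e → ∃[ p ] (∀ k → p Nat.≤ k → + 1 / suc k ≤ e)
    archimedean {e@(mkℚ _ d _)} 0<e = d , λ k d≤k → *-cancelʳ (0<ι (suc k)) (begin
      (+ 1 / suc k) * ι (suc k)   ≡⟨ /-*-ι 1 k ⟩
      ι 1                         ≤⟨ ι-mono-≤ (Nat.>-nonZero⁻¹ (num e) {{num≢0 e 0<e}}) ⟩
      ι (num e)                   ≡⟨ sym (num/den e (<⇒≤ 0<e)) ⟩
      e * ι (suc d)               ≤⟨ *-monoˡ (<⇒≤ 0<e) (ι-mono-≤ (s≤s d≤k)) ⟩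
      e * ι (suc k)               ∎)

  ∣_∣≤ : ∀ p {e} → p ≤ e → - p ≤ e → ∣ p ∣ ≤ e
  ∣ p ∣≤ h h′ with ∣p∣≡p∨∣p∣≡-p p
  ... | inj₁ eq = subst (_≤ _) (sym eq) h
  ... | inj₂ eq = subst (_≤ _) (sym eq) h′

  p≤∣p∣ : ∀ p → p ≤ ∣ p ∣
  p≤∣p∣ p with ≤-total 0ℚ p
  ... | inj₁ 0≤p = ≤-reflexive (sym (0≤p⇒∣p∣≡p 0≤p))
  ... | inj₂ p≤0 = ≤-trans p≤0 (0≤∣p∣ p)

  -- p ≤ q + e and q ≤ p + e together say that p and q are within e.
  within : ∀ {p q e} → p ≤ q + e → q ≤ p + e → ∣ p - q ∣ ≤ e
  within {p} {q} {e} h h′ = ∣ p - q ∣≤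
    (begin
      p - q           ≤⟨ +-monoˡ-≤ (- q) h ⟩
      q + e - q       ≡⟨ solve 2 (λ q e → q :+ e :- q := e) refl q e ⟩
      e               ∎)
    (begin
      - (p - q)       ≡⟨ solve 2 (λ p q → :- (p :- q) := q :- p) refl p q ⟩
      q - p           ≤⟨ +-monoˡ-≤ (- p) h′ ⟩
      p + e - p       ≡⟨ solve 2 (λ p e → p :+ e :- p := e) refl p e ⟩
      e               ∎)

  square-cancel-≤ : ∀ {p q} → 0ℚ ≤ q → p * p ≤ q * q → p ≤ q
  square-cancel-≤ {p} {q} 0≤q h = ≮⇒≥ λ q<p → <-irrefl refl (begin-strict
    q * q   ≤⟨ *-monoˡ 0≤q (<⇒≤ q<p) ⟩
    q * p   <⟨ *-monoˡ-<-pos p {{positive (≤-<-trans 0≤q q<p)}} q<p ⟩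
    p * p   ≤⟨ h ⟩
    q * q   ∎)

  -- ⌊√(q (k+1)²)⌋ / (k+1) for q ≥ 0
  opaque

    √-approx : ℕ → ℚ → ℚ
    √-approx k q = + ⌊√ num q Nat.* (suc k Nat.* suc k) Nat./ ↧ₙ q ⌋ / suc k

    √-approx-* : ∀ k q →
      √-approx k q * ι (suc k) ≡ ι ⌊√ num q Nat.* (suc k Nat.* suc k) Nat./ ↧ₙ q ⌋
    √-approx-* k q = /-*-ι ⌊√ num q Nat.* (suc k Nat.* suc k) Nat./ ↧ₙ q ⌋ k

    √-approx≥0 : ∀ k q → 0ℚ ≤ √-approx k q
    √-approx≥0 k q = nonNegative⁻¹ (√-approx k q)
      {{normalize-nonNeg ⌊√ num q Nat.* (suc k Nat.* suc k) Nat./ ↧ₙ q ⌋ (suc k)}}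

  module √-Approx (k : ℕ) (q : ℚ) (0≤q : 0ℚ ≤ q) where

    private
      K = ι (suc k)
      b = ↧ₙ q
      m = num q Nat.* (suc k Nat.* suc k) Nat./ b
      s = ⌊√ m ⌋
      r = √-approx k q
      u = + 1 / suc k

      0<KKb : 0ℚ < K * K * ι b
      0<KKb = *-pos (*-pos (0<ι (suc k)) (0<ι (suc k))) (0<ι b)

      qKKb : ι (num q Nat.* (suc k Nat.* suc k)) ≡ q * (K * K * ι b)
      qKKb = begin-equality
        ι (num q Nat.* (suc k Nat.* suc k))   ≡⟨ ι-* (num q) (suc k Nat.* suc k) ⟩
        ι (num q) * ι (suc k Nat.* suc k)     ≡⟨ cong₂ _*_ (sym (num/den q 0≤q)) (ι-* (suc k) (suc k)) ⟩
        q * ι b * (K * K)                     ≡⟨ solve 3 (λ q b K → q :* b :* (K :* K) := q :* (K :* K :* b)) refl q (ι b) K ⟩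
        q * (K * K * ι b)                     ∎

      square : ∀ x n → x * K ≡ ι n → ι (n Nat.* n Nat.* b) ≡ x * x * (K * K * ι b)
      square x n eq = begin-equality
        ι (n Nat.* n Nat.* b)       ≡⟨ trans (ι-* (n Nat.* n) b) (cong (_* ι b) (ι-* n n)) ⟩
        ι n * ι n * ι b             ≡⟨ cong (λ z → z * z * ι b) (sym eq) ⟩
        x * K * (x * K) * ι b       ≡⟨ solve 3 (λ x b K → x :* K :* (x :* K) :* b := x :* x :* (K :* K :* b)) refl x (ι b) K ⟩
        x * x * (K * K * ι b)       ∎

      1+s : (r + u) * K ≡ ι (suc s)
      1+s = begin-equality
        (r + u) * K     ≡⟨ *-distribʳ-+ K r u ⟩
        r * K + u * K   ≡⟨ cong₂ _+_ (√-approx-* k q) (/-*-ι 1 k) ⟩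
        ι s + ι 1       ≡⟨ trans (sym (ι-+ s 1)) (cong ι (ℕₚ.+-comm s 1)) ⟩
        ι (suc s)       ∎

    lower : r * r ≤ q
    lower = *-cancelʳ 0<KKb (begin
      r * r * (K * K * ι b)                  ≡⟨ sym (square r s (√-approx-* k q)) ⟩
      ι (s Nat.* s Nat.* b)                  ≤⟨ ι-mono-≤ (ℕₚ.≤-trans (ℕₚ.*-monoˡ-≤ b (Natural.⌊√n⌋²≤n m)) (ℕDM.m/n*n≤m (num q Nat.* (suc k Nat.* suc k)) b)) ⟩
      ι (num q Nat.* (suc k Nat.* suc k))    ≡⟨ qKKb ⟩
      q * (K * K * ι b)                      ∎)

    upper : q ≤ (r + u) * (r + u)
    upper = *-cancelʳ 0<KKb (begin
      q * (K * K * ι b)                      ≡⟨ sym qKKb ⟩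
      ι (num q Nat.* (suc k Nat.* suc k))    ≤⟨ ι-mono-≤ nat ⟩
      ι (suc s Nat.* suc s Nat.* b)          ≡⟨ square (r + u) (suc s) 1+s ⟩
      (r + u) * (r + u) * (K * K * ι b)      ∎)
      where
      M = num q Nat.* (suc k Nat.* suc k)
      nat : M Nat.≤ suc s Nat.* suc s Nat.* b
      nat = ℕₚ.<⇒≤ (ℕₚ.<-≤-trans
        (subst (Nat._< suc m Nat.* b) (sym (ℕDM.m≡m%n+[m/n]*n M b))
          (ℕₚ.+-monoˡ-< (m Nat.* b) (ℕDM.m%n<n M b)))
        (ℕₚ.*-monoˡ-≤ b (Natural.n<[1+⌊√n⌋]² m)))

  √-compare : ∀ {a b u d ε p q} → 0ℚ ≤ b → 0ℚ ≤ u → 0ℚ < d → d + d ≡ ε →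
    a * a ≤ p → p ≤ q + d * d → q ≤ (b + u) * (b + u) → u ≤ d → a ≤ b + ε
  √-compare {a} {b} {u} {d} {ε} {p} {q} 0≤b 0≤u 0<d refl aa≤p p≤q+dd q≤bb u≤d =
    square-cancel-≤ (+-nonNeg 0≤b (+-nonNeg 0≤d 0≤d)) (begin
      a * a                               ≤⟨ aa≤p ⟩
      p                                   ≤⟨ p≤q+dd ⟩
      q + d * d                           ≤⟨ +-monoˡ-≤ (d * d) q≤bb ⟩
      (b + u) * (b + u) + d * d           ≤⟨ +-monoˡ-≤ (d * d) (*-mono (+-nonNeg 0≤b 0≤u) (+-nonNeg 0≤b 0≤d)
                                               (+-monoʳ-≤ b u≤d) (+-monoʳ-≤ b u≤d)) ⟩
      (b + d) * (b + d) + d * d           ≡⟨ sym (+-identityʳ _) ⟩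
      (b + d) * (b + d) + d * d + 0ℚ      ≤⟨ +-monoʳ-≤ ((b + d) * (b + d) + d * d)
                                               (*-nonNeg (+-nonNeg 0≤d 0≤d) (+-nonNeg 0≤b 0≤d)) ⟩
      (b + d) * (b + d) + d * d + (d + d) * (b + d)
                                          ≡⟨ solve 2 (λ b d → (b :+ d) :* (b :+ d) :+ d :* d :+ (d :+ d) :* (b :+ d)
                                                           := (b :+ (d :+ d)) :* (b :+ (d :+ d))) refl b d ⟩
      (b + (d + d)) * (b + (d + d))       ∎)
    where 0≤d = <⇒≤ 0<d

  -- The floors of log₂ for numerator and denominator of q^(k+1) are each off by
  -- less than 1, so for q > 0 this is within 1/(k+1) of log₂ q.
  opaque

    log₂-approx : ℕ → ℚ → ℚ
    log₂-approx k q =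
      (+ ⌊log₂ num q Nat.^ suc k ⌋ / suc k) - (+ ⌊log₂ ↧ₙ q Nat.^ suc k ⌋ / suc k)

    log₂-approx-def : ∀ k q → log₂-approx k q ≡
      (+ ⌊log₂ num q Nat.^ suc k ⌋ / suc k) - (+ ⌊log₂ ↧ₙ q Nat.^ suc k ⌋ / suc k)
    log₂-approx-def k q = refl

  log₂-compare : ∀ {x y δ e} p k m → 0ℚ < x → 0ℚ < y → δ ≤ y → e * ι (suc p Nat.+ suc p) ≤ δ →
    x ≤ y + e →
    log₂-approx k x ≤ log₂-approx m y + ((+ 1 / suc p) + (+ 1 / suc k) + (+ 1 / suc m))
  log₂-compare {x} {y} {δ} {e} p k m 0<x 0<y δ≤y eP≤δ x≤y+e = *-cancelʳ 0<PKM (begin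
    log₂-approx k x * (P * K * M)
      ≡⟨ cong (_* (P * K * M)) (log₂-approx-def k x) ⟩
    (α - β) * (P * K * M)
      ≡⟨ solve 5 (λ α β P K M → (α :- β) :* (P :* K :* M) := α :* K :* (P :* M) :- β :* K :* (P :* M)) refl α β P K M ⟩
    α * K * (P * M) - β * K * (P * M)
      ≡⟨ cong₂ (λ s t → s * (P * M) - t * (P * M)) (/-*-ι A k) (/-*-ι B k) ⟩
    ι A * (P * M) - ι B * (P * M)
      ≡⟨ solve 3 (λ a b d → a :- b := a :+ d :- (b :+ d)) refl (ι A * (P * M)) (ι B * (P * M)) (ι D * (P * K)) ⟩
    ι A * (P * M) + ι D * (P * K) - (ι B * (P * M) + ι D * (P * K))
      ≤⟨ +-monoˡ-≤ (- (ι B * (P * M) + ι D * (P * K))) main ⟩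
    K * M + ((1ℚ + ι B) * (P * M) + (1ℚ + ι C) * (P * K)) - (ι B * (P * M) + ι D * (P * K))
      ≡⟨ solve 6 (λ P K M b c d →
           K :* M :+ ((con 1ℚ :+ b) :* (P :* M) :+ (con 1ℚ :+ c) :* (P :* K)) :- (b :* (P :* M) :+ d :* (P :* K))
           := c :* (P :* K) :- d :* (P :* K) :+ (con 1ℚ :* (K :* M) :+ con 1ℚ :* (P :* M) :+ con 1ℚ :* (P :* K)))
           refl P K M (ι B) (ι C) (ι D) ⟩
    ι C * (P * K) - ι D * (P * K) + (1ℚ * (K * M) + 1ℚ * (P * M) + 1ℚ * (P * K))
      ≡⟨ cong₂ _+_ (cong₂ (λ s t → s * (P * K) - t * (P * K)) (sym (/-*-ι C m)) (sym (/-*-ι D m)))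
           (cong₂ _+_ (cong₂ (λ s t → s * (K * M) + t * (P * M)) (sym (/-*-ι 1 p)) (sym (/-*-ι 1 k)))
             (cong (_* (P * K)) (sym (/-*-ι 1 m)))) ⟩
    γ * M * (P * K) - ε * M * (P * K) + (u * P * (K * M) + v * K * (P * M) + w * M * (P * K))
      ≡⟨ solve 8 (λ γ ε u v w P K M →
           γ :* M :* (P :* K) :- ε :* M :* (P :* K) :+ (u :* P :* (K :* M) :+ v :* K :* (P :* M) :+ w :* M :* (P :* K))
           := (γ :- ε :+ (u :+ v :+ w)) :* (P :* K :* M)) refl γ ε u v w P K M ⟩
    (γ - ε + (u + v + w)) * (P * K * M)
      ≡⟨ cong (λ z → (z + (u + v + w)) * (P * K * M)) (sym (log₂-approx-def m y)) ⟩
    (log₂-approx m y + (u + v + w)) * (P * K * M) ∎)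
    where
    P = ι (suc p)
    K = ι (suc k)
    M = ι (suc m)
    a = num x
    b = ↧ₙ x
    c = num y
    d = ↧ₙ y
    A = ⌊log₂ a Nat.^ suc k ⌋
    B = ⌊log₂ b Nat.^ suc k ⌋
    C = ⌊log₂ c Nat.^ suc m ⌋
    D = ⌊log₂ d Nat.^ suc m ⌋
    α = + A / suc k
    β = + B / suc k
    γ = + C / suc m
    ε = + D / suc m
    u = + 1 / suc p
    v = + 1 / suc k
    w = + 1 / suc m
    n = suc p Nat.+ suc p

    0<PKM : 0ℚ < P * K * M
    0<PKM = *-pos (*-pos (0<ι (suc p)) (0<ι (suc k))) (0<ι (suc m))

    ratio : n Nat.* (a Nat.* d) Nat.≤ suc n Nat.* (b Nat.* c)
    ratio = ι-cancel-≤ (begin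
      ι (n Nat.* (a Nat.* d))        ≡⟨ trans (ι-* n (a Nat.* d)) (cong (ι n *_) (ι-* a d)) ⟩
      ι n * (ι a * ι d)              ≡⟨ cong (λ z → ι n * (z * ι d)) (sym (num/den x (<⇒≤ 0<x))) ⟩
      ι n * (x * ι b * ι d)          ≡⟨ solve 4 (λ n x b d → n :* (x :* b :* d) := n :* x :* (b :* d)) refl (ι n) x (ι b) (ι d) ⟩
      ι n * x * (ι b * ι d)          ≤⟨ *-monoʳ (*-nonNeg (0≤ι b) (0≤ι d)) scaled ⟩
      ι (suc n) * y * (ι b * ι d)    ≡⟨ solve 4 (λ n y b d → n :* y :* (b :* d) := n :* (b :* (y :* d))) refl (ι (suc n)) y (ι b) (ι d) ⟩
      ι (suc n) * (ι b * (y * ι d))  ≡⟨ cong (λ z → ι (suc n) * (ι b * z)) (num/den y (<⇒≤ 0<y)) ⟩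
      ι (suc n) * (ι b * ι c)        ≡⟨ sym (trans (ι-* (suc n) (b Nat.* c)) (cong (ι (suc n) *_) (ι-* b c))) ⟩
      ι (suc n Nat.* (b Nat.* c))    ∎)
      where
      scaled : ι n * x ≤ ι (suc n) * y
      scaled = begin
        ι n * x             ≤⟨ *-monoˡ (0≤ι n) x≤y+e ⟩
        ι n * (y + e)       ≡⟨ solve 3 (λ n y e → n :* (y :+ e) := n :* y :+ e :* n) refl (ι n) y e ⟩
        ι n * y + e * ι n   ≤⟨ +-monoʳ-≤ (ι n * y) (≤-trans eP≤δ δ≤y) ⟩
        ι n * y + y         ≡⟨ solve 2 (λ n y → n :* y :+ y := (con 1ℚ :+ n) :* y) refl (ι n) y ⟩
        (1ℚ + ι n) * y      ≡⟨ cong (_* y) (sym (ι-+ 1 n)) ⟩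
        ι (suc n) * y       ∎

    main : ι A * (P * M) + ι D * (P * K) ≤ K * M + ((1ℚ + ι B) * (P * M) + (1ℚ + ι C) * (P * K))
    main = subst₂ _≤_
      (trans (ι-+ (A Nat.* (suc p Nat.* suc m)) (D Nat.* (suc p Nat.* suc k)))
        (cong₂ _+_ (term A m) (term D k)))
      (trans (ι-+ (suc k Nat.* suc m) (suc B Nat.* (suc p Nat.* suc m) Nat.+ suc C Nat.* (suc p Nat.* suc k)))
        (cong₂ _+_ (ι-* (suc k) (suc m))
          (trans (ι-+ (suc B Nat.* (suc p Nat.* suc m)) (suc C Nat.* (suc p Nat.* suc k)))
            (cong₂ _+_ (trans (term (suc B) m) (cong (_* (P * M)) (ι-+ 1 B)))
                       (trans (term (suc C) k) (cong (_* (P * K)) (ι-+ 1 C)))))))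
      (ι-mono-≤ (Natural.log-compare a b c d (suc p) (suc k) (suc m)
        {{num≢0 x 0<x}} {{_}} {{num≢0 y 0<y}} ratio))
      where
      term : ∀ N j → ι (N Nat.* (suc p Nat.* suc j)) ≡ ι N * (P * ι (suc j))
      term N j = trans (ι-* N (suc p Nat.* suc j)) (cong (ι N *_) (ι-* (suc p) (suc j)))

------------------------------------------------------------------------
-- Real numbers: Cauchy sequences of rationals.  Equality of reals is
-- mutual _≤_, not _≡_.

IsCauchy : (ℕ → ℚ) → Set
IsCauchy x = ∀ ε → 0ℚ Rat.< ε →
  ∃[ n ] (∀ i j → n Nat.≤ i → n Nat.≤ j → x i Rat.≤ x j Rat.+ ε)

record ℝ : Set where
  constructor real
  field
    seq      : ℕ → ℚ
    isCauchy : IsCauchy seq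

open ℝ public

infix  4 _≤_
infixl 6 _+_ _-_
infixl 7 _*_
infix  8 -_
infixl 9 _²

_≤_ : ℝ → ℝ → Set
x ≤ y = ∀ ε → 0ℚ Rat.< ε → ∃[ n ] (∀ i → n Nat.≤ i → seq x i Rat.≤ seq y i Rat.+ ε)

record Positive (x : ℝ) : Set where
  constructor positive
  field
    bound   : ℚ
    0<bound : 0ℚ Rat.< bound
    from    : ℕ
    bound≤  : ∀ i → from Nat.≤ i → bound Rat.≤ seq x i

module RealLemmas where

  open Rat using () renaming (_+_ to _⊕_; _*_ to _⊛_; -_ to ⊖_; _-_ to _⊝_; _≤_ to _≼_; _<_ to _≺_)
  open Rat using (_⊔_; ∣_∣)
  open ℚₚ
  open ≤-Reasoning
  open ℚSolver.+-*-Solver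
  open Rational

  _⊔ⁿ_ : ℕ → ℕ → ℕ
  _⊔ⁿ_ = Nat._⊔_

  ≤ˡ : ∀ m {n i} → m ⊔ⁿ n Nat.≤ i → m Nat.≤ i
  ≤ˡ m {n} = ℕₚ.m⊔n≤o⇒m≤o m n

  ≤ʳ : ∀ m {n i} → m ⊔ⁿ n Nat.≤ i → n Nat.≤ i
  ≤ʳ m {n} = ℕₚ.m⊔n≤o⇒n≤o m n

  opaque

    constant : ∀ q → IsCauchy (λ _ → q)
    constant q ε 0<ε = 0 , λ _ _ _ _ → begin
      q         ≡⟨ sym (+-identityʳ q) ⟩
      q ⊕ 0ℚ    ≤⟨ +-monoʳ-≤ q (<⇒≤ 0<ε) ⟩
      q ⊕ ε     ∎

  opaque

    sum : ∀ {x y} → IsCauchy x → IsCauchy y → IsCauchy (λ i → x i ⊕ y i)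
    sum {x} {y} cx cy ε 0<ε with half 0<ε
    ... | d , 0<d , d+d≡ε with cx d 0<d | cy d 0<d
    ... | m , hx | n , hy = m ⊔ⁿ n , λ i j p q → begin
      x i ⊕ y i               ≤⟨ +-mono-≤ (hx i j (≤ˡ m p) (≤ˡ m q)) (hy i j (≤ʳ m p) (≤ʳ m q)) ⟩
      x j ⊕ d ⊕ (y j ⊕ d)     ≡⟨ solve 3 (λ x y d → x :+ d :+ (y :+ d) := x :+ y :+ (d :+ d)) refl (x j) (y j) d ⟩
      x j ⊕ y j ⊕ (d ⊕ d)     ≡⟨ cong (x j ⊕ y j ⊕_) d+d≡ε ⟩
      x j ⊕ y j ⊕ ε           ∎

  opaque

    negation : ∀ {x} → IsCauchy x → IsCauchy (λ i → ⊖ x i)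
    negation {x} cx ε 0<ε with cx ε 0<ε
    ... | n , h = n , λ i j p q → begin
      ⊖ x i                       ≡⟨ solve 2 (λ a b → :- a := b :- a :- b) refl (x i) (x j) ⟩
      x j ⊝ x i ⊝ x j             ≤⟨ +-monoˡ-≤ (⊖ x j) (+-monoˡ-≤ (⊖ x i) (h j i q p)) ⟩
      x i ⊕ ε ⊝ x i ⊝ x j         ≡⟨ solve 3 (λ a b e → a :+ e :- a :- b := :- b :+ e) refl (x i) (x j) ε ⟩
      ⊖ x j ⊕ ε                   ∎

  opaque

    bounded : ∀ {x} → IsCauchy x → Σ[ B ∈ ℚ ] 0ℚ ≺ B × ∃[ n ] (∀ i → n Nat.≤ i → ∣ x i ∣ ≼ B)
    bounded {x} cx with cx 1ℚ (positive⁻¹ 1ℚ)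
    ... | n , h = ∣ x n ∣ ⊕ 1ℚ , +-mono-≤-< (0≤∣p∣ (x n)) (positive⁻¹ 1ℚ) , n , λ i p → begin
      ∣ x i ∣                   ≡⟨ cong ∣_∣ (solve 2 (λ a b → a := b :+ (a :- b)) refl (x i) (x n)) ⟩
      ∣ x n ⊕ (x i ⊝ x n) ∣     ≤⟨ ∣p+q∣≤∣p∣+∣q∣ (x n) (x i ⊝ x n) ⟩
      ∣ x n ∣ ⊕ ∣ x i ⊝ x n ∣   ≤⟨ +-monoʳ-≤ ∣ x n ∣ (within (h i n p ℕₚ.≤-refl) (h n i ℕₚ.≤-refl p)) ⟩
      ∣ x n ∣ ⊕ 1ℚ              ∎

  opaque

    product : ∀ {x y} → IsCauchy x → IsCauchy y → IsCauchy (λ i → x i ⊛ y i)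
    product {x} {y} cx cy ε 0<ε with bounded cx | bounded cy
    ... | B , 0<B , n₁ , hB | C , 0<C , n₂ , hC with divide (+-pos 0<B 0<C) 0<ε
    ... | d , 0<d , d[B+C]≡ε with cx d 0<d | cy d 0<d
    ... | n₃ , hx | n₄ , hy = (n₁ ⊔ⁿ n₂) ⊔ⁿ (n₃ ⊔ⁿ n₄) , λ i j p q → begin
      x i ⊛ y i
        ≡⟨ solve 4 (λ a b c d → a :* b := c :* d :+ (a :* (b :- d) :+ (a :- c) :* d)) refl (x i) (y i) (x j) (y j) ⟩
      x j ⊛ y j ⊕ (x i ⊛ (y i ⊝ y j) ⊕ (x i ⊝ x j) ⊛ y j)
        ≤⟨ +-monoʳ-≤ (x j ⊛ y j) (+-mono-≤
             (estimate (x i) (y i ⊝ y j) (hB i (≤ˡ n₁ (≤ˡ (n₁ ⊔ⁿ n₂) p)))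
               (within (hy i j (≤ʳ n₃ (≤ʳ (n₁ ⊔ⁿ n₂) p)) (≤ʳ n₃ (≤ʳ (n₁ ⊔ⁿ n₂) q)))
                       (hy j i (≤ʳ n₃ (≤ʳ (n₁ ⊔ⁿ n₂) q)) (≤ʳ n₃ (≤ʳ (n₁ ⊔ⁿ n₂) p)))))
             (estimate (x i ⊝ x j) (y j)
               (within (hx i j (≤ˡ n₃ (≤ʳ (n₁ ⊔ⁿ n₂) p)) (≤ˡ n₃ (≤ʳ (n₁ ⊔ⁿ n₂) q)))
                       (hx j i (≤ˡ n₃ (≤ʳ (n₁ ⊔ⁿ n₂) q)) (≤ˡ n₃ (≤ʳ (n₁ ⊔ⁿ n₂) p))))
               (hC j (≤ʳ n₁ (≤ˡ (n₁ ⊔ⁿ n₂) q))))) ⟩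
      x j ⊛ y j ⊕ (B ⊛ d ⊕ d ⊛ C)
        ≡⟨ cong (x j ⊛ y j ⊕_) (trans (solve 3 (λ B C d → B :* d :+ d :* C := d :* (B :+ C)) refl B C d) d[B+C]≡ε) ⟩
      x j ⊛ y j ⊕ ε ∎
      where
      estimate : ∀ a b {A B} → ∣ a ∣ ≼ A → ∣ b ∣ ≼ B → a ⊛ b ≼ A ⊛ B
      estimate a b {A} {B} ha hb = begin
        a ⊛ b           ≤⟨ p≤∣p∣ (a ⊛ b) ⟩
        ∣ a ⊛ b ∣       ≡⟨ ∣p*q∣≡∣p∣*∣q∣ a b ⟩
        ∣ a ∣ ⊛ ∣ b ∣   ≤⟨ *-mono (0≤∣p∣ a) (≤-trans (0≤∣p∣ b) hb) ha hb ⟩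
        A ⊛ B           ∎

  opaque

    squareRoot : ∀ {x} → IsCauchy x → IsCauchy (λ i → √-approx i (x i ⊔ 0ℚ))
    squareRoot {x} cx ε 0<ε with half 0<ε
    ... | d , 0<d , d+d≡ε with cx (d ⊛ d) (*-pos 0<d 0<d) | archimedean 0<d
    ... | m , h | n , small = m ⊔ⁿ n , λ i j p q →
      √-compare {√-approx i (x i ⊔ 0ℚ)} {√-approx j (x j ⊔ 0ℚ)} {+ 1 Rat./ suc j} {d} {ε} {x i ⊔ 0ℚ} {x j ⊔ 0ℚ}
        (√-approx≥0 j (x j ⊔ 0ℚ)) (nonNegative⁻¹ (+ 1 Rat./ suc j) {{normalize-nonNeg 1 (suc j)}}) 0<d d+d≡ε
        (√-Approx.lower i (x i ⊔ 0ℚ) (p≤q⊔p (x i) 0ℚ))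
        (⊔-lub (≤-trans (h i j (≤ˡ m p) (≤ˡ m q)) (+-monoˡ-≤ (d ⊛ d) (p≤p⊔q (x j) 0ℚ)))
               (+-nonNeg (p≤q⊔p (x j) 0ℚ) (<⇒≤ (*-pos 0<d 0<d))))
        (√-Approx.upper j (x j ⊔ 0ℚ) (p≤q⊔p (x j) 0ℚ))
        (small j (≤ʳ m q))

  opaque

    logarithm : ∀ (x : ℝ) → Positive x → IsCauchy (λ i → log₂-approx i (seq x i))
    logarithm (real x cx) (positive δ 0<δ n₀ δ≤) ε 0<ε with third 0<ε
    ... | d , 0<d , 3d≡ε with archimedean 0<d
    ... | p , small with divide (0<ι (suc p Nat.+ suc p)) 0<δ
    ... | e , 0<e , eP≡δ with cx e 0<e
    ... | m , h = (n₀ ⊔ⁿ m) ⊔ⁿ p , λ i j s t → begin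
      log₂-approx i (x i)
        ≤⟨ log₂-compare p i j
             (<-≤-trans 0<δ (δ≤ i (≤ˡ n₀ (≤ˡ (n₀ ⊔ⁿ m) s))))
             (<-≤-trans 0<δ (δ≤ j (≤ˡ n₀ (≤ˡ (n₀ ⊔ⁿ m) t))))
             (δ≤ j (≤ˡ n₀ (≤ˡ (n₀ ⊔ⁿ m) t))) (≤-reflexive eP≡δ)
             (h i j (≤ʳ n₀ (≤ˡ (n₀ ⊔ⁿ m) s)) (≤ʳ n₀ (≤ˡ (n₀ ⊔ⁿ m) t))) ⟩
      log₂-approx j (x j) ⊕ ((+ 1 Rat./ suc p) ⊕ (+ 1 Rat./ suc i) ⊕ (+ 1 Rat./ suc j))
        ≤⟨ +-monoʳ-≤ (log₂-approx j (x j))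
             (+-mono-≤ (+-mono-≤ (small p ℕₚ.≤-refl) (small i (≤ʳ (n₀ ⊔ⁿ m) s))) (small j (≤ʳ (n₀ ⊔ⁿ m) t))) ⟩
      log₂-approx j (x j) ⊕ (d ⊕ d ⊕ d)
        ≡⟨ cong (log₂-approx j (x j) ⊕_) 3d≡ε ⟩
      log₂-approx j (x j) ⊕ ε ∎

fromℚ : ℚ → ℝ
fromℚ q = real (λ _ → q) (RealLemmas.constant q)

fromℕ : ℕ → ℝ
fromℕ n = fromℚ (+ n Rat./ 1)

_+_ : ℝ → ℝ → ℝ
x + y = real (λ i → seq x i Rat.+ seq y i) (RealLemmas.sum (isCauchy x) (isCauchy y))

-_ : ℝ → ℝ
- x = real (λ i → Rat.- seq x i) (RealLemmas.negation (isCauchy x))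

_-_ : ℝ → ℝ → ℝ
x - y = x + - y

_*_ : ℝ → ℝ → ℝ
x * y = real (λ i → seq x i Rat.* seq y i) (RealLemmas.product (isCauchy x) (isCauchy y))

_² : ℝ → ℝ
x ² = x * x

-- Negative arguments are sent to 0.
√ : ℝ → ℝ
√ x = real (λ i → Rational.√-approx i (seq x i Rat.⊔ 0ℚ)) (RealLemmas.squareRoot (isCauchy x))

log₂ : (x : ℝ) → Positive x → ℝ
log₂ x x>0 = real (λ i → Rational.log₂-approx i (seq x i)) (RealLemmas.logarithm x x>0)

fromℕ-positive : ∀ n {{_ : NonZero n}} → Positive (fromℕ n)
fromℕ-positive n = positive (+ n Rat./ 1) (Rational.0<ι n) 0 λ _ _ → ℚₚ.≤-refl

*-positive : ∀ {x y} → Positive x → Positive y → Positive (x * y)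
*-positive (positive b 0<b m b≤) (positive c 0<c n c≤) =
  positive (b Rat.* c) (Rational.*-pos 0<b 0<c) (m Nat.⊔ n) λ i p →
    Rational.*-mono (ℚₚ.<⇒≤ 0<b)
      (ℚₚ.≤-trans (ℚₚ.<⇒≤ 0<c) (c≤ i (RealLemmas.≤ʳ m p)))
      (b≤ i (RealLemmas.≤ˡ m p)) (c≤ i (RealLemmas.≤ʳ m p))

-- Suprema of indexed families, as least upper bounds.
IsSupremum : {I : Set} → (I → ℝ) → ℝ → Set
IsSupremum f s = (∀ i → f i ≤ s) × (∀ b → (∀ i → f i ≤ b) → s ≤ b)

------------------------------------------------------------------------
-- Vectors and matrices

∑ : ∀ {n} → Vector ℝ n → ℝ
∑ = foldr _+_ (fromℕ 0)

-- m rows, n columns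
Matrix : ℕ → ℕ → Set
Matrix m n = Vector (Vector ℝ n) m

infixl 7 _·_ _·ᵛ_
infixl 6 _∸ᴹ_

_·_ : ∀ {m n p} → Matrix m n → Matrix n p → Matrix m p
(A · B) i k = ∑ λ j → A i j * B j k

_·ᵛ_ : ∀ {m n} → Matrix m n → Vector ℝ n → Vector ℝ m
(A ·ᵛ v) i = ∑ λ j → A i j * v j

_∸ᴹ_ : ∀ {m n} → Matrix m n → Matrix m n → Matrix m n
(A ∸ᴹ B) i j = A i j - B i j

‖_‖ : ∀ {n} → Vector ℝ n → ℝ
‖ v ‖ = √ (∑ λ i → v i ²)

‖_‖F : ∀ {m n} → Matrix m n → ℝ
‖ A ‖F = √ (∑ λ i → ∑ λ j → A i j ²)

IsSpectralNorm : ∀ {m n} → Matrix m n → ℝ → Set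
IsSpectralNorm {n = n} A =
  IsSupremum {I = Σ[ v ∈ Vector ℝ n ] ‖ v ‖ ≤ fromℕ 1} λ (v , _) → ‖ A ·ᵛ v ‖

------------------------------------------------------------------------
-- Streaming algorithms

-- stream t is the pair arriving at time t + 1.
Stream : ℕ → ℕ → Set
Stream dx dy = ℕ → Vector ℝ (suc dx) × Vector ℝ (suc dy)

-- A deterministic algorithm whose entire memory between arrivals is a
-- string of S bits.  Neither update nor output need respect equality of
-- reals, or be computable: this only enlarges the class of algorithms.
record Algorithm (S dx dy : ℕ) : Set where
  field
    initial : Vec Bool S
    update  : Vec Bool S → Vector ℝ (suc dx) → Vector ℝ (suc dy) → Vec Bool S
    output  : Vec Bool S → Σ[ m ∈ ℕ ] Matrix (suc dx) m × Matrix (suc dy) m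

  memory : Stream dx dy → ℕ → Vec Bool S
  memory stream zero    = initial
  memory stream (suc t) = update (memory stream t) (proj₁ (stream t)) (proj₂ (stream t))

-- The columns of the window at time T ≥ N are the last N vectors to arrive.
X-window : ∀ {dx dy} → Stream dx dy → (N T : ℕ) → Matrix (suc dx) N
X-window stream N T i j = proj₁ (stream (T Nat.∸ N Nat.+ toℕ j)) i

Y-window : ∀ {dx dy} → Stream dx dy → (N T : ℕ) → Matrix (suc dy) N
Y-window stream N T i j = proj₂ (stream (T Nat.∸ N Nat.+ toℕ j)) i

AdmissibleStream : ∀ {dx dy} → ℕ → ℝ → Stream dx dy → Set
AdmissibleStream N R stream = ∀ T → N Nat.≤ T → (j : Fin N) →
  InRange (‖ transpose (X-window stream N T) j ‖ ²) ×
  InRange (‖ transpose (Y-window stream N T) j ‖ ²)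
  where
  InRange : ℝ → Set
  InRange r = fromℕ 1 ≤ r × r ≤ R + fromℕ 1

IsApproximation : ∀ {m n N k} → ℚ → Matrix m N → Matrix n N → Matrix m k → Matrix n k → Set
IsApproximation ε X Y A B =
  ∃[ s ] IsSpectralNorm (X · transpose Y ∸ᴹ A · transpose B) s ×
         s ≤ fromℚ (ε Rat.* (+ 1 Rat./ 3)) * ‖ X ‖F * ‖ Y ‖F

SolvesSlidingWindowAMM : ∀ {S dx dy} → ℕ → ℝ → ℚ → Algorithm S dx dy → Set
SolvesSlidingWindowAMM {dx = dx} {dy} N R ε alg =
  ∀ (stream : Stream dx dy) → AdmissibleStream N R stream →
  ∀ T → N Nat.≤ T →
    let (_ , A , B) = output (memory stream T) in
    IsApproximation ε (X-window stream N T) (Y-window stream N T) A B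
  where open Algorithm alg

{-# OPTIONS --safe #-}

-- A maximal binary code gives 2ᵏ pairs of unit vectors (x_c, y_c), k = Ω(dx + dy), with
-- ⟨x_c, x_c′⟩⟨y_c, y_c′⟩ < 1/4 for c ≠ c′.  The hard streams consist of blocks of equal columns
-- 8ᵉ x_c, 8ᵉ y_c with decreasing e, followed by filler of norm 1.  Two such streams that leave the
-- same memory behind receive the same output ABᵀ ever after.  Suppose they last differ in a block of
-- mass μ, with codewords c and c′, and let everything before that block expire.  Then
--   x_cᵀ (XYᵀ - X′Y′ᵀ) y_c = μ (1 - ⟨x_c, x_c′⟩⟨y_c, y_c′⟩) > 3/4 μ,
-- whereas both products are within M / 3l of ABᵀ, M being the mass of the window.  So if each block
-- satisfies 8 M ≤ 9 l μ, the memory determines all the codewords.  There is room for about l/2 such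
-- blocks of each exponent e up to log₆₄ R, since a block of mass μ needs only μ / 64ᵉ columns.

module Submission where

open import Algebra.Bundles using (CommutativeRing)
open import Data.Bool.Base using (Bool; true; false)
open import Data.Fin.Base using (Fin; zero; suc; toℕ; fromℕ<; inject≤; combine; finToFun; funToFin)
import Data.Fin.Properties as Finₚ
open import Data.Integer.Base as Int using (1ℤ)
open import Data.List.Base using (List; []; _∷_; _++_; map; length; foldr; replicate)
open import Data.List.Membership.Propositional.Properties using (∈-lookup)
open import Data.List.Properties using (map-++; map-∘; length-++; length-map; length-replicate; ++-assoc)
open import Data.List.Relation.Unary.All as All using (All; []; _∷_)
import Data.List.Relation.Unary.All.Properties as Allₚ
open import Data.List.Relation.Unary.AllPairs using (AllPairs; []; _∷_)
open import Data.List.Relation.Unary.Any as Any using (Any; here; there)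
open import Data.Nat.Base as Nat using (ℕ; zero; suc; NonZero; s≤s; z≤n; ⌊_/2⌋; ⌈_/2⌉)
open import Data.Nat.DivMod using (m/n*n≤m; m%n<n; m≡m%n+[m/n]*n; /-monoˡ-≤; m≥n⇒m/n>0)
open import Data.Nat.Logarithm using (⌊log₂_⌋)
import Data.Nat.Properties as ℕₚ
import Data.Nat.Solver as ℕSolver
open import Data.Product using (Σ-syntax; ∃-syntax; _×_; _,_; proj₁; proj₂)
open import Data.Rational.Base as Rat using (ℚ; 0ℚ; 1ℚ; ½; ↧ₙ_)
import Data.Rational.Properties as ℚₚ
import Data.Rational.Solver as ℚSolver
open import Data.Sum.Base using (_⊎_; inj₁; inj₂; [_,_]′)
open import Data.Vec.Base using (Vec; []; _∷_)
open import Data.Vec.Functional using (Vector; transpose)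
import Data.Vec.Properties as Vecₚ
open import Function.Base using (_∘_)
open import Function.Definitions using (Injective)
open import Level using (0ℓ)
open import Relation.Binary.Core using (Rel)
open import Relation.Binary.Definitions using (Decidable; Symmetric)
open import Relation.Binary.PropositionalEquality
open import Relation.Nullary using (¬_; yes; no; contradiction)
open import Relation.Nullary.Decidable using (decidable-stable; from-yes)
open import Defs using (module Natural; module Rational)

-- Codes

-- Everything on the side of the hard streams is exactly rational. Codewords become vectors with
-- entries ±1/s, so the code length has to be a square s², and the squared norms are powers of 64 =
-- 8², so that the norms `8 ^ e` are rational too. Only the side of larger dimension carries the
-- code; the other side is one fixed unit vector. This costs a factor 2 in k and avoids any
-- interplay between the two inner products. The real numbers of the statement are Cauchy sequences,
-- whose order cannot be decided. Hence the choice of the number of levels, and every case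
-- distinction on R, is made on a rational within 1/4 of R, and the constants leave room for this
-- error. Square roots and logarithms enter only through rational approximants, whose direction of
-- rounding matters in several places. The base 64 also has to beat the decrease in the number of
-- columns from level to level: a block may have about 4 times fewer columns than one of the level
-- below, yet must be at least 9 times heavier.

module Codes where

  open Nat
  open import Data.List.Base using (lookup)
  open import Data.Nat.ListAction using (sum)
  open import Data.Nat.ListAction.Properties using (sum-++)
  open ℕₚ
  open ≤-Reasoning
  open ℕSolver.+-*-Solver

  -- Greedy choice: x is added exactly when it is far from all elements chosen so far. A rejected x
  -- is near one of them, and an added x is near itself by irreflexivity.
  separatedNet : ∀ {A : Set} {Far : Rel A 0ℓ} → Decidable Far → (∀ x → ¬ Far x x) → (xs : List A) →
    ∃[ C ] AllPairs Far C × All (λ x → Any (λ c → ¬ Far x c) C) xs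
  separatedNet far? irrefl []       = [] , [] , []
  separatedNet far? irrefl (x ∷ xs) with separatedNet far? irrefl xs
  ... | C , sep , cover with All.all? (far? x) C
  ...   | yes far = x ∷ C , far ∷ sep , here (irrefl x) ∷ All.map there cover
  ...   | no ¬far = C , sep , Allₚ.¬All⇒Any¬ (far? x) C ¬far ∷ cover

  AllPairs-lookup : ∀ {A : Set} {R : Rel A 0ℓ} {xs : List A} → Symmetric R → AllPairs R xs →
    ∀ i j → i ≢ j → R (lookup xs i) (lookup xs j)
  AllPairs-lookup R-sym (_  ∷ _) zero    zero    i≢j = contradiction refl i≢j
  AllPairs-lookup R-sym (rs ∷ _) zero    (suc j) _   = All.lookup rs (∈-lookup j)
  AllPairs-lookup R-sym (rs ∷ _) (suc i) zero    _   = R-sym (All.lookup rs (∈-lookup i))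
  AllPairs-lookup R-sym (_ ∷ ps) (suc i) (suc j) i≢j = AllPairs-lookup R-sym ps i j (i≢j ∘ cong suc)

  sum-map-+ : ∀ {A : Set} (f g : A → ℕ) xs →
    sum (map (λ x → f x + g x) xs) ≡ sum (map f xs) + sum (map g xs)
  sum-map-+ f g []       = refl
  sum-map-+ f g (x ∷ xs) = trans (cong (f x + g x +_) (sum-map-+ f g xs))
    (solve 4 (λ a b c d → a :+ b :+ (c :+ d) := a :+ c :+ (b :+ d)) refl (f x) (g x) (sum (map f xs)) (sum (map g xs)))

  sum-map-* : ∀ {A : Set} k (f : A → ℕ) xs → sum (map (λ x → k * f x) xs) ≡ k * sum (map f xs)
  sum-map-* k f []       = sym (*-zeroʳ k)
  sum-map-* k f (x ∷ xs) = trans (cong (k * f x +_) (sum-map-* k f xs)) (sym (*-distribˡ-+ k (f x) _))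

  sum-map-≥ : ∀ {A : Set} {m} (f : A → ℕ) {xs} → All (λ x → m ≤ f x) xs → length xs * m ≤ sum (map f xs)
  sum-map-≥ f []       = z≤n
  sum-map-≥ f (p ∷ ps) = +-mono-≤ p (sum-map-≥ f ps)

  Any⇒≤sum-map : ∀ {A : Set} {m} (f : A → ℕ) {xs} → Any (λ x → m ≤ f x) xs → m ≤ sum (map f xs)
  Any⇒≤sum-map f (here p)            = ≤-trans p (m≤m+n _ _)
  Any⇒≤sum-map f {x ∷ _} (there any) = ≤-trans (Any⇒≤sum-map f any) (m≤n+m _ (f x))

  private variable
    n : ℕ

  words : ∀ n → List (Vec Bool n)
  words zero    = [] ∷ []
  words (suc n) = map (true ∷_) (words n) ++ map (false ∷_) (words n)

  length-words : ∀ n → length (words n) ≡ 2 ^ n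
  length-words zero    = refl
  length-words (suc n) = trans (length-++ (map (true ∷_) (words n)))
    (cong₂ _+_ (trans (length-map (true ∷_) (words n)) (length-words n))
               (trans (length-map (false ∷_) (words n)) (trans (length-words n) (sym (+-identityʳ _)))))

  mismatch : Bool → Bool → ℕ
  mismatch true  true  = 0
  mismatch true  false = 1
  mismatch false true  = 1
  mismatch false false = 0

  dist : Vec Bool n → Vec Bool n → ℕ
  dist []       []       = 0
  dist (a ∷ v) (b ∷ w) = mismatch a b + dist v w

  dist-self : (v : Vec Bool n) → dist v v ≡ 0
  dist-self []          = refl
  dist-self (true ∷ v)  = dist-self v
  dist-self (false ∷ v) = dist-self v

  dist-comm : (v w : Vec Bool n) → dist v w ≡ dist w v
  dist-comm []          []          = refl
  dist-comm (true ∷ v)  (true ∷ w)  = dist-comm v w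
  dist-comm (true ∷ v)  (false ∷ w) = cong suc (dist-comm v w)
  dist-comm (false ∷ v) (true ∷ w)  = cong suc (dist-comm v w)
  dist-comm (false ∷ v) (false ∷ w) = dist-comm v w

  -- The weights 5 and 3 make length 24k and relative distance 3/8 admit 2ᵏ words: (5⁵ 3³ / 4⁸)³ > 2.
  factor : Bool → Bool → ℕ
  factor true  true  = 5
  factor true  false = 3
  factor false true  = 3
  factor false false = 5

  -- Equals 5^(n-d) 3^d for words at distance d. This exponential weight replaces the volume of a
  -- Hamming ball: its sum over all words factorises, so no binomial coefficients are needed.
  weight : Vec Bool n → Vec Bool n → ℕ
  weight []      []      = 1
  weight (a ∷ v) (b ∷ w) = factor a b * weight v w

  sum-weight : (v : Vec Bool n) → sum (map (weight v) (words n)) ≡ 8 ^ n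
  sum-weight []                = refl
  sum-weight {suc n} (a ∷ v) = begin-equality
    sum (map (weight (a ∷ v)) (map (true ∷_) (words n) ++ map (false ∷_) (words n)))
      ≡⟨ cong sum (map-++ (weight (a ∷ v)) (map (true ∷_) (words n)) _) ⟩
    sum (map (weight (a ∷ v)) (map (true ∷_) (words n)) ++ map (weight (a ∷ v)) (map (false ∷_) (words n)))
      ≡⟨ sum-++ (map (weight (a ∷ v)) (map (true ∷_) (words n))) _ ⟩
    sum (map (weight (a ∷ v)) (map (true ∷_) (words n))) + sum (map (weight (a ∷ v)) (map (false ∷_) (words n)))
      ≡⟨ cong₂ _+_ (half true) (half false) ⟩
    factor a true * 8 ^ n + factor a false * 8 ^ n
      ≡⟨ sym (*-distribʳ-+ (8 ^ n) (factor a true) (factor a false)) ⟩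
    (factor a true + factor a false) * 8 ^ n
      ≡⟨ cong (_* 8 ^ n) (8= a) ⟩
    8 * 8 ^ n ∎
    where
    8= : ∀ a → factor a true + factor a false ≡ 8
    8= true  = refl
    8= false = refl
    half : ∀ b → sum (map (weight (a ∷ v)) (map (b ∷_) (words n))) ≡ factor a b * 8 ^ n
    half b = begin-equality
      sum (map (weight (a ∷ v)) (map (b ∷_) (words n)))      ≡⟨ cong sum (sym (map-∘ (words n))) ⟩
      sum (map (λ w → factor a b * weight v w) (words n))    ≡⟨ sum-map-* (factor a b) (weight v) (words n) ⟩
      factor a b * sum (map (weight v) (words n))            ≡⟨ cong (factor a b *_) (sum-weight v) ⟩
      factor a b * 8 ^ n                                     ∎

  sum-sum-weight : (C : List (Vec Bool n)) →
    sum (map (λ w → sum (map (λ c → weight c w) C)) (words n)) ≡ length C * 8 ^ n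
  sum-sum-weight {n} []      = zeros (words n)
    where
    zeros : ∀ {A : Set} (xs : List A) → sum (map (λ _ → 0) xs) ≡ 0
    zeros []       = refl
    zeros (_ ∷ xs) = zeros xs
  sum-sum-weight {n} (c ∷ C) = trans
    (sum-map-+ (weight c) (λ w → sum (map (λ c → weight c w) C)) (words n))
    (cong₂ _+_ (sum-weight c) (sum-sum-weight C))

  weight-dist : (v w : Vec Bool n) → weight v w * 5 ^ dist v w ≡ 3 ^ dist v w * 5 ^ n
  weight-dist []      []      = refl
  weight-dist {suc n} (a ∷ v) (b ∷ w) = step a b
    where
    W = weight v w
    D = dist v w
    same : 5 * W * 5 ^ D ≡ 3 ^ D * (5 * 5 ^ n)
    same = trans (*-assoc 5 W (5 ^ D)) (trans (cong (5 *_) (weight-dist v w))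
      (solve 2 (λ x y → con 5 :* (x :* y) := x :* (con 5 :* y)) refl (3 ^ D) (5 ^ n)))
    differ : 3 * W * (5 * 5 ^ D) ≡ 3 * 3 ^ D * (5 * 5 ^ n)
    differ = trans (solve 2 (λ x y → con 3 :* x :* (con 5 :* y) := con 15 :* (x :* y)) refl W (5 ^ D))
      (trans (cong (15 *_) (weight-dist v w))
        (solve 2 (λ x y → con 15 :* (x :* y) := con 3 :* x :* (con 5 :* y)) refl (3 ^ D) (5 ^ n)))
    step : ∀ a b → factor a b * W * 5 ^ (mismatch a b + D) ≡ 3 ^ (mismatch a b + D) * (5 * 5 ^ n)
    step true  true  = same
    step true  false = differ
    step false true  = differ
    step false false = same

  -- Each mismatch trades a factor 5 for a factor 3, so among words within distance r the weight is
  -- least at distance exactly r.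
  weight-≥ : ∀ (v w : Vec Bool n) {r t} → dist v w ≤ r → r + t ≡ n → 3 ^ r * 5 ^ t ≤ weight v w
  weight-≥ v w {r} {t} d≤r refl = *-cancelʳ-≤ _ _ (5 ^ d) {{m^n≢0 5 d}} (begin
    3 ^ r * 5 ^ t * 5 ^ d              ≡⟨ cong (λ z → 3 ^ z * 5 ^ t * 5 ^ d) (sym r≡) ⟩
    3 ^ (d + e) * 5 ^ t * 5 ^ d        ≡⟨ cong (λ z → z * 5 ^ t * 5 ^ d) (^-distribˡ-+-* 3 d e) ⟩
    3 ^ d * 3 ^ e * 5 ^ t * 5 ^ d
      ≤⟨ *-monoˡ-≤ (5 ^ d) (*-monoˡ-≤ (5 ^ t) (*-monoʳ-≤ (3 ^ d) (^-monoˡ-≤ e {3} {5} (s≤s (s≤s (s≤s z≤n)))))) ⟩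
    3 ^ d * 5 ^ e * 5 ^ t * 5 ^ d
      ≡⟨ solve 4 (λ a b c d → a :* b :* c :* d := a :* (d :* b :* c)) refl (3 ^ d) (5 ^ e) (5 ^ t) (5 ^ d) ⟩
    3 ^ d * (5 ^ d * 5 ^ e * 5 ^ t)
      ≡⟨ cong (3 ^ d *_) (sym (trans (^-distribˡ-+-* 5 (d + e) t) (cong (_* 5 ^ t) (^-distribˡ-+-* 5 d e)))) ⟩
    3 ^ d * 5 ^ (d + e + t)            ≡⟨ cong (λ z → 3 ^ d * 5 ^ (z + t)) r≡ ⟩
    3 ^ d * 5 ^ (r + t)                ≡⟨ sym (weight-dist v w) ⟩
    weight v w * 5 ^ d                 ∎)
    where
    d = dist v w
    e = r ∸ d
    r≡ : d + e ≡ r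
    r≡ = m+[n∸m]≡n d≤r

  -- Distance d between sign vectors of length n means normalised inner product 1 - 2d/n, which is
  -- below 1/4 exactly when d/n exceeds 3/8.
  Far : Rel (Vec Bool n) 0ℓ
  Far {n} v w = 3 * n < 8 * dist v w

  far? : Decidable (Far {n})
  far? {n} v w = 3 * n <? 8 * dist v w

  ¬far-self : (v : Vec Bool n) → ¬ Far v v
  ¬far-self {n} v h = n≮0 (subst (3 * n <_) (trans (cong (8 *_) (dist-self v)) (*-zeroʳ 8)) h)

  far-sym : Symmetric (Far {n})
  far-sym {n} {v} {w} = subst (λ d → 3 * n < 8 * d) (dist-comm v w)

  record Code (n m : ℕ) : Set where
    field
      word : Fin m → Vec Bool n
      far  : ∀ {i j} → i ≢ j → Far (word i) (word j)

  opaque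

    -- Eight coordinates multiply the guaranteed number of codewords by `α` / `β`, about 1.29. The
    -- third power is the first to exceed 2, whence 24 coordinates per bit.
    α β : ℕ
    α = 5 ^ 5 * 3 ^ 3
    β = 4 ^ 8

    α^ : ∀ q → α ^ q ≡ 5 ^ (5 * q) * 3 ^ (3 * q)
    α^ q = trans (Natural.^-distrib-* (5 ^ 5) (3 ^ 3) q) (cong₂ _*_ (^-*-assoc 5 5 q) (^-*-assoc 3 3 q))

    β^ : ∀ q → β ^ q ≡ 4 ^ (8 * q)
    β^ = ^-*-assoc 4 8

    β≢0 : NonZero β
    β≢0 = _

    2β³≤α³ : 2 * β ^ 3 ≤ α ^ 3
    2β³≤α³ = ≤ᵇ⇒≤ (2 * β ^ 3) (α ^ 3) _

  -- Each word is close to some word of a maximal code C, so the weights add up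
  -- to at least 2ⁿ 3ʳ 5ⁿ⁻ʳ over all pairs, while each word of C contributes 8ⁿ.
  net-size : ∀ q → ∃[ m ] Code (8 * q) m × α ^ q ≤ m * β ^ q
  net-size q with separatedNet (far? {8 * q}) ¬far-self (words (8 * q))
  ... | C , sep , cover = length C ,
    record { word = lookup C ; far = λ {i} {j} → AllPairs-lookup (λ {v} {w} → far-sym {x = v} {w}) sep i j } ,
    *-cancelˡ-≤ (2 ^ ν) {{m^n≢0 2 ν}} (begin
      2 ^ ν * α ^ q                        ≡⟨ cong (2 ^ ν *_) (α^ q) ⟩
      2 ^ ν * (5 ^ (5 * q) * 3 ^ (3 * q))  ≡⟨ cong₂ _*_ (sym (length-words ν)) (*-comm (5 ^ (5 * q)) _) ⟩
      length (words ν) * L                 ≤⟨ sum-map-≥ (λ w → sum (map (λ c → weight c w) C)) (All.map close cover) ⟩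
      sum (map (λ w → sum (map (λ c → weight c w) C)) (words ν))
                                           ≡⟨ sum-sum-weight C ⟩
      length C * 8 ^ ν                     ≡⟨ cong (length C *_) (Natural.^-distrib-* 2 4 ν) ⟩
      length C * (2 ^ ν * 4 ^ ν)           ≡⟨ cong (λ z → length C * (2 ^ ν * z)) (sym (β^ q)) ⟩
      length C * (2 ^ ν * β ^ q)     ≡⟨ solve 3 (λ a b c → a :* (b :* c) := b :* (a :* c)) refl (length C) (2 ^ ν) (β ^ q) ⟩
      2 ^ ν * (length C * β ^ q)     ∎)
    where
    ν = 8 * q
    L = 3 ^ (3 * q) * 5 ^ (5 * q)
    close : ∀ {w} → Any (λ c → ¬ Far w c) C → L ≤ sum (map (λ c → weight c w) C)
    close {w} any = Any⇒≤sum-map (λ c → weight c w) (Any.map (λ {c} ¬far →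
      weight-≥ c w {3 * q} {5 * q}
        (*-cancelˡ-≤ 8 (≤-trans (≤-reflexive (cong (8 *_) (dist-comm c w)))
          (≤-trans (≮⇒≥ ¬far) (≤-reflexive (solve 1 (λ q → con 3 :* (con 8 :* q) := con 8 :* (con 3 :* q)) refl q)))))
        (solve 1 (λ q → con 3 :* q :+ con 5 :* q := con 8 :* q) refl q)) any)

  restrict : ∀ {m m′} → m ≤ m′ → Code n m′ → Code n m
  restrict m≤m′ C = record
    { word = λ i → Code.word C (inject≤ i m≤m′)
    ; far  = λ i≢j → Code.far C (i≢j ∘ Finₚ.inject≤-injective m≤m′ m≤m′ _ _)
    }

  power-ratio : ∀ a b k m .{{_ : NonZero b}} → 2 * b ≤ a → a ^ k ≤ m * b ^ k → 2 ^ k ≤ m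
  power-ratio a b k m 2b≤a h = *-cancelʳ-≤ (2 ^ k) m (b ^ k) {{m^n≢0 b k}} (begin
    2 ^ k * b ^ k   ≡⟨ sym (Natural.^-distrib-* 2 b k) ⟩
    (2 * b) ^ k     ≤⟨ ^-monoˡ-≤ k 2b≤a ⟩
    a ^ k           ≤⟨ h ⟩
    m * b ^ k       ∎)

  code : ∀ k → Code (8 * (3 * k)) (2 ^ k)
  code k = let m , C , size = net-size (3 * k) in
    restrict (power-ratio (α ^ 3) (β ^ 3) k m {{m^n≢0 β 3 {{β≢0}}}} 2β³≤α³
      (subst₂ _≤_ (sym (^-*-assoc α 3 k)) (cong (m *_) (sym (^-*-assoc β 3 k))) size)) C

  -- Serves the dimensions up to 144, where a single bit already meets the rate 1/144.
  twoWords : Code 1 2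
  twoWords = record { word = word ; far = far }
    where
    word : Fin 2 → Vec Bool 1
    word zero    = true ∷ []
    word (suc _) = false ∷ []
    far : ∀ {i j} → i ≢ j → Far (word i) (word j)
    far {zero}     {zero}     i≢j = contradiction refl i≢j
    far {zero}     {suc zero} _   = from-yes (3 <? 8)
    far {suc zero} {zero}     _   = from-yes (3 <? 8)
    far {suc zero} {suc zero} i≢j = contradiction refl i≢j

  -- Sides divisible by 12 make s² divisible by 24, the inverse rate of the code.
  largeSide : ∀ d → 144 ≤ d → ∃[ j ] NonZero j × 12 * j * (12 * j) ≤ d × d ≤ 144 * (6 * (j * j))
  largeSide d 144≤d = j , >-nonZero 1≤j ,
    ≤-trans (*-mono-≤ 12j≤r 12j≤r) (Natural.⌊√n⌋²≤n d) , <⇒≤ (begin-strict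
      d                      <⟨ Natural.n<[1+⌊√n⌋]² d ⟩
      suc r * suc r          ≤⟨ *-mono-≤ r<24j r<24j ⟩
      24 * j * (24 * j)      ≡⟨ solve 1 (λ j → con 24 :* j :* (con 24 :* j) := con 576 :* (j :* j)) refl j ⟩
      576 * (j * j)          ≤⟨ *-monoˡ-≤ (j * j) (m≤m+n 576 288) ⟩
      864 * (j * j)          ≡⟨ *-assoc 144 6 (j * j) ⟩
      144 * (6 * (j * j))    ∎)
    where
    r = Natural.⌊√ d ⌋
    j = r / 12
    12≤r : 12 ≤ r
    12≤r = ≮⇒≥ λ r<12 → <⇒≱ (Natural.n<[1+⌊√n⌋]² d) (≤-trans (*-mono-≤ r<12 r<12) 144≤d)
    1≤j : 1 ≤ j
    1≤j = /-monoˡ-≤ 12 12≤r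
    12j≤r : 12 * j ≤ r
    12j≤r = subst (_≤ r) (*-comm j 12) (m/n*n≤m r 12)
    r<24j : suc r ≤ 24 * j
    r<24j = begin
      suc r                     ≡⟨ cong suc (m≡m%n+[m/n]*n r 12) ⟩
      suc (r % 12) + j * 12     ≤⟨ +-monoˡ-≤ (j * 12) (m%n<n r 12) ⟩
      12 + j * 12               ≤⟨ +-monoˡ-≤ (j * 12) (*-monoˡ-≤ 12 1≤j) ⟩
      j * 12 + j * 12           ≡⟨ solve 1 (λ j → j :* con 12 :+ j :* con 12 := con 24 :* j) refl j ⟩
      24 * j                    ∎

  squareCode : ∀ d → 1 ≤ d →
    ∃[ s ] ∃[ k ] NonZero s × Code (s * s) (2 ^ k) × s * s ≤ d × d ≤ 144 * k
  squareCode d 1≤d with ≤-total 144 d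
  ... | inj₂ d≤144 = 1 , 1 , _ , twoWords , 1≤d , d≤144
  ... | inj₁ 144≤d =
    let j , j≢0 , s²≤d , d≤ = largeSide d 144≤d
        -- `code k` has length 24 k, and 24 · 6 j² = (12 j)².
        k = 6 * (j * j)
        8[3k]≡s² = solve 1 (λ j → con 8 :* (con 3 :* (con 6 :* (j :* j))) := con 12 :* j :* (con 12 :* j)) refl j
    in 12 * j , k , m*n≢0 12 j {{_}} {{j≢0}} , subst (λ n → Code n (2 ^ k)) 8[3k]≡s² (code k) , s²≤d , d≤

-- Pigeonhole principle for memory states

module Counting where

  open Nat
  open ℕₚ
  open import Data.Vec.Base using (lookup; tabulate)
  open Finₚ using (finToFun-funToFin; funToFin-finToFin; injective⇒≤)

  bit : Bool → Fin 2
  bit true  = zero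
  bit false = suc zero

  bit-injective : ∀ {a b} → bit a ≡ bit b → a ≡ b
  bit-injective {true}  {true}  _ = refl
  bit-injective {false} {false} _ = refl

  index : ∀ {S} → Vec Bool S → Fin (2 ^ S)
  index v = funToFin (bit ∘ lookup v)

  lookup-injective : ∀ {A : Set} {n} {v w : Vec A n} → (∀ i → lookup v i ≡ lookup w i) → v ≡ w
  lookup-injective {v = v} {w} h = trans (sym (Vecₚ.tabulate∘lookup v)) (trans (Vecₚ.tabulate-cong h) (Vecₚ.tabulate∘lookup w))

  index-injective : ∀ {S} → Injective _≡_ _≡_ (index {S})
  index-injective {S} {v} {w} eq = lookup-injective λ i → bit-injective
    (trans (sym (finToFun-funToFin (bit ∘ lookup v) i)) (trans (cong (λ z → finToFun z i) eq) (finToFun-funToFin (bit ∘ lookup w) i)))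

  -- Messages and memory strings are both numbered, by `Fin (2 ^ (k * m))` and `Fin (2 ^ S)`, so
  -- that the pigeonhole principle for `Fin` applies.
  injection⇒≤ : ∀ {k m S} (f : Vec (Fin (2 ^ k)) m → Vec Bool S) → Injective _≡_ _≡_ f → k * m ≤ S
  injection⇒≤ {k} {m} {S} f f-injective = 2^-cancel (injective⇒≤ {f = index ∘ f ∘ word} λ {i} {j} eq →
    word-injective (f-injective (index-injective eq)))
    where
    word : Fin (2 ^ (k * m)) → Vec (Fin (2 ^ k)) m
    word i = tabulate (finToFun (subst Fin (sym (^-*-assoc 2 k m)) i))
    funToFin-cong : ∀ {m n} {g h : Fin m → Fin n} → (∀ i → g i ≡ h i) → funToFin g ≡ funToFin h
    funToFin-cong {zero}  g≗h = refl
    funToFin-cong {suc m} g≗h = cong₂ combine (g≗h zero) (funToFin-cong (g≗h ∘ suc))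
    word-injective : ∀ {i j} → word i ≡ word j → i ≡ j
    word-injective {i} {j} eq = subst-injective (sym (^-*-assoc 2 k m))
      (trans (sym (funToFin-finToFin {m} _)) (trans (funToFin-cong λ p → trans (sym (Vecₚ.lookup∘tabulate _ p)) (trans (cong (λ v → lookup v p) eq) (Vecₚ.lookup∘tabulate _ p))) (funToFin-finToFin {m} _)))
    2^-cancel : ∀ {x y} → 2 ^ x ≤ 2 ^ y → x ≤ y
    2^-cancel {x} {y} le = ≮⇒≥ λ y<x → <⇒≱ (^-monoʳ-< 2 (s≤s (s≤s z≤n)) y<x) le

-- Separated unit vectors

module InnerProduct where

  open Rat
  open ℚₚ
  open ≡-Reasoning
  open ℚSolver.+-*-Solver
  open import Algebra.Properties.Semiring.Sum (CommutativeRing.semiring +-*-commutativeRing) public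
    using (sum; sum-cong-≗; ∑-distrib-+; ∑-comm; *-distribˡ-sum; *-distribʳ-sum)

  ⟨_,_⟩ : ∀ {n} → Vector ℚ n → Vector ℚ n → ℚ
  ⟨ u , v ⟩ = sum λ i → u i * v i

  ⟨,⟩-comm : ∀ {n} (u v : Vector ℚ n) → ⟨ u , v ⟩ ≡ ⟨ v , u ⟩
  ⟨,⟩-comm u v = sum-cong-≗ λ i → *-comm (u i) (v i)

  sum-0 : ∀ n → sum {n} (λ _ → 0ℚ) ≡ 0ℚ
  sum-0 zero    = refl
  sum-0 (suc n) = trans (+-identityˡ _) (sum-0 n)

  ⟨u,0⟩ : ∀ {n} (u : Vector ℚ n) → ⟨ u , (λ _ → 0ℚ) ⟩ ≡ 0ℚ
  ⟨u,0⟩ {n} u = trans (sum-cong-≗ λ i → *-zeroʳ (u i)) (sum-0 n)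

  e₀ : ∀ {n} → Vector ℚ (suc n)
  e₀ zero    = 1ℚ
  e₀ (suc _) = 0ℚ

  ⟨e₀,e₀⟩ : ∀ n → ⟨ e₀ {n} , e₀ ⟩ ≡ 1ℚ
  ⟨e₀,e₀⟩ n = trans (cong (1ℚ +_) (⟨u,0⟩ {n} (λ _ → 0ℚ))) (+-identityʳ 1ℚ)

open InnerProduct

module Families where

  open Rat
  open ℚₚ
  open ≤-Reasoning
  open ℚSolver.+-*-Solver
  open Rational
  open Codes using (Code; dist; dist-self)

  ¼ : ℚ
  ¼ = Int.+ 1 / 4

  record Family (K a b : ℕ) : Set where
    field
      x : Fin K → Vector ℚ a
      y : Fin K → Vector ℚ b
      x-unit : ∀ c → ⟨ x c , x c ⟩ ≡ 1ℚ
      y-unit : ∀ c → ⟨ y c , y c ⟩ ≡ 1ℚ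
      separated : ∀ {c c′} → c ≢ c′ → ⟨ x c , x c′ ⟩ * ⟨ y c , y c′ ⟩ < ¼

  -- Allows the code to be placed on whichever side has the larger dimension.
  swap : ∀ {K a b} → Family K a b → Family K b a
  swap F = record
    { x = y ; y = x ; x-unit = y-unit ; y-unit = x-unit
    ; separated = λ {c} {c′} c≢c′ → subst (_< ¼) (*-comm ⟨ x c , x c′ ⟩ ⟨ y c , y c′ ⟩) (separated c≢c′) }
    where open Family F

  signed : ℚ → Bool → ℚ
  signed α true  = α
  signed α false = - α

  -- The word as a vector of signs times α, padded with zeros, so that inner products do not depend
  -- on the ambient dimension once the word fits.
  embed : ∀ {n} → ℚ → Vec Bool n → ∀ {D} → Vector ℚ D
  embed α []      i       = 0ℚ
  embed α (b ∷ v) zero    = signed α b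
  embed α (b ∷ v) (suc i) = embed α v i

  -- Each of the n - d agreements contributes α² and each of the d mismatches -α².
  ⟨embed,embed⟩ : ∀ α {n D} (v w : Vec Bool n) → n Nat.≤ D →
    ⟨ embed α v {D} , embed α w ⟩ ≡ α * α * (ι n - ι 2 * ι (dist v w))
  ⟨embed,embed⟩ α {D = D} [] [] _ = trans (⟨u,0⟩ {D} (λ _ → 0ℚ)) (sym (*-zeroʳ (α * α)))
  ⟨embed,embed⟩ α {suc n} (a ∷ v) (b ∷ w) (s≤s n≤D) = trans (cong (signed α a * signed α b +_) (⟨embed,embed⟩ α v w n≤D)) (step a b)
    where
    d = dist v w
    same : α * α + α * α * (ι n - ι 2 * ι d) ≡ α * α * (ι (suc n) - ι 2 * ι d)
    same = trans (solve 3 (λ α n d → α :* α :+ α :* α :* (n :- con (ι 2) :* d) := α :* α :* (con (ι 1) :+ n :- con (ι 2) :* d)) refl α (ι n) (ι d))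
      (cong (λ z → α * α * (z - ι 2 * ι d)) (sym (ι-+ 1 n)))
    differ : - (α * α) + α * α * (ι n - ι 2 * ι d) ≡ α * α * (ι (suc n) - ι 2 * ι (suc d))
    differ = trans (solve 3 (λ α n d → :- (α :* α) :+ α :* α :* (n :- con (ι 2) :* d) := α :* α :* (con (ι 1) :+ n :- con (ι 2) :* (con (ι 1) :+ d))) refl α (ι n) (ι d))
      (cong₂ (λ z z′ → α * α * (z - ι 2 * z′)) (sym (ι-+ 1 n)) (sym (ι-+ 1 d)))
    step : ∀ a b → signed α a * signed α b + α * α * (ι n - ι 2 * ι d)
      ≡ α * α * (ι (suc n) - ι 2 * ι (Codes.mismatch a b Nat.+ d))
    step true  true  = same
    step true  false = trans (cong (_+ α * α * (ι n - ι 2 * ι d)) (sym (neg-distribʳ-* α α))) differ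
    step false true  = trans (cong (_+ α * α * (ι n - ι 2 * ι d)) (sym (neg-distribˡ-* α α))) differ
    step false false = trans (cong (_+ α * α * (ι n - ι 2 * ι d)) (solve 1 (λ α → :- α :* :- α := α :* α) refl α)) same

  -- The constant side contributes the factor 1, so the code alone must separate. With entries ±1/s
  -- on s² coordinates the vectors have norm 1.
  spherical : ∀ {K} s {dx dy} .{{_ : Nat.NonZero s}} → Code (s Nat.* s) K → s Nat.* s Nat.≤ dy → Family K (suc dx) (suc dy)
  spherical s@(suc s-1) {dx} {dy} C n≤dy = record
    { x         = λ _ → e₀
    ; y         = v
    ; x-unit    = λ _ → ⟨e₀,e₀⟩ dx
    ; y-unit    = λ c → trans (gram c c) (trans (cong (λ d → α * α * (N - ι 2 * ι d)) (dist-self (word c))) (trans (cong (α * α *_) (+-identityʳ N)) α²n))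
    ; separated = λ {c} {c′} c≢c′ → begin-strict
        ⟨ e₀ , e₀ {dx} ⟩ * ⟨ v c , v c′ ⟩                         ≡⟨ cong₂ _*_ (⟨e₀,e₀⟩ dx) (gram c c′) ⟩
        1ℚ * (α * α * (N - ι 2 * ι (dist (word c) (word c′))))  ≡⟨ *-identityˡ _ ⟩
        α * α * (N - ι 2 * ι (dist (word c) (word c′)))
          <⟨ *-monoʳ-<-pos (α * α) {{positive (*-pos 0<α 0<α)}} (small c c′ (far c≢c′)) ⟩
        α * α * (¼ * N)
          ≡⟨ solve 2 (λ a n → a :* (con ¼ :* n) := con ¼ :* (a :* n)) refl (α * α) N ⟩
        ¼ * (α * α * N)                                         ≡⟨ cong (¼ *_) α²n ⟩
        ¼ * 1ℚ                                                  ≡⟨⟩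
        ¼                                                       ∎
    }
    where
    open Code C
    α N : ℚ
    α = Int.+ 1 / s
    N = ι (s Nat.* s)
    0<α : 0ℚ < α
    0<α = positive⁻¹ α {{normalize-pos 1 s}}
    α²n : α * α * N ≡ 1ℚ
    α²n = begin-equality
      α * α * N            ≡⟨ cong (α * α *_) (ι-* s s) ⟩
      α * α * (ι s * ι s)  ≡⟨ solve 2 (λ a s → a :* a :* (s :* s) := (a :* s) :* (a :* s)) refl α (ι s) ⟩
      α * ι s * (α * ι s)  ≡⟨ cong (λ z → z * z) (/-*-ι 1 s-1) ⟩
      1ℚ                   ∎
    v : ∀ c → Vector ℚ (suc dy)
    v c = embed α (word c)
    gram : ∀ c c′ → ⟨ v c , v c′ ⟩ ≡ α * α * (N - ι 2 * ι (dist (word c) (word c′)))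
    gram c c′ = ⟨embed,embed⟩ α (word c) (word c′) (ℕₚ.m≤n⇒m≤1+n n≤dy)
    small : ∀ c c′ → Codes.Far (word c) (word c′) → N - ι 2 * ι (dist (word c) (word c′)) < ¼ * N
    small c c′ h = begin-strict
      N - ι 2 * d
        -- Splits N into a quarter and three quarters and writes 2 d as a quarter of 8 d, so that 3
        -- N < 8 d applies.
        ≡⟨ solve 2 (λ n d → n :- con (ι 2) :* d := con ¼ :* n :+ con ¼ :* (con (ι 3) :* n) :- con ¼ :* (con (ι 8) :* d)) refl N d ⟩
      ¼ * N + ¼ * (ι 3 * N) - ¼ * (ι 8 * d)
                                      <⟨ +-monoˡ-< (- (¼ * (ι 8 * d))) (+-monoʳ-< (¼ * N) (*-monoʳ-<-pos ¼ (subst₂ _<_ (ι-* 3 (s Nat.* s)) (ι-* 8 (dist (word c) (word c′))) (ι-mono-< h)))) ⟩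
      ¼ * N + ¼ * (ι 8 * d) - ¼ * (ι 8 * d)
                                      ≡⟨ solve 2 (λ n d → n :+ d :- d := n) refl (¼ * N) (¼ * (ι 8 * d)) ⟩
      ¼ * N                           ∎
      where d = ι (dist (word c) (word c′))

  -- The larger dimension is at least half of the sum, which turns 144 into 288.
  halfFamily : ∀ {dx dy} → dx Nat.≤ dy → 1 Nat.≤ dx Nat.+ dy →
    ∃[ k ] Family (2 Nat.^ k) (suc dx) (suc dy) × dx Nat.+ dy Nat.≤ 288 Nat.* k
  halfFamily {dx} {dy} dx≤dy 1≤d =
    let s , k , s≢0 , C , s²≤dy , dy≤ = Codes.squareCode dy
          (ℕₚ.n≢0⇒n>0 λ { refl → ℕₚ.<⇒≱ 1≤d (ℕₚ.+-monoˡ-≤ 0 dx≤dy) })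
    in k , spherical s {{s≢0}} C s²≤dy ,
       ℕₚ.≤-trans (ℕₚ.+-mono-≤ (ℕₚ.≤-trans dx≤dy dy≤) dy≤) (ℕₚ.≤-reflexive (sym (ℕₚ.*-distribʳ-+ k 144 144)))

  family : ∀ dx dy → 1 Nat.≤ dx Nat.+ dy →
    ∃[ k ] Family (2 Nat.^ k) (suc dx) (suc dy) × dx Nat.+ dy Nat.≤ 288 Nat.* k
  family dx dy 1≤d with ℕₚ.≤-total dx dy
  ... | inj₁ dx≤dy = halfFamily dx≤dy 1≤d
  ... | inj₂ dy≤dx =
    let k , F , d≤ = halfFamily dy≤dx (subst (1 Nat.≤_) (ℕₚ.+-comm dx dy) 1≤d)
    in k , swap F , subst (Nat._≤ 288 Nat.* k) (ℕₚ.+-comm dy dx) d≤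

-- Block designs

module Columns where

  open Rat
  open ℚₚ
  open ≡-Reasoning
  open ℚSolver.+-*-Solver
  open Rational
  open Families using (Family)

  private variable
    A : Set
    K a b N : ℕ

  -- An infinite sequence that is eventually constant: past its end the list continues with the
  -- default `z`, which will be the filler.
  at : A → List A → ℕ → A
  at z []       _       = z
  at z (x ∷ xs) zero    = x
  at z (x ∷ xs) (suc t) = at z xs t

  at-++ : ∀ z (xs ys : List A) t → at z (xs ++ ys) (length xs Nat.+ t) ≡ at z ys t
  at-++ z []       ys t = refl
  at-++ z (x ∷ xs) ys t = at-++ z xs ys t

  at-beyond : ∀ z (xs : List A) {t} → length xs Nat.≤ t → at z xs t ≡ z
  at-beyond z []       _         = refl
  at-beyond z (x ∷ xs) (s≤s h) = at-beyond z xs h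

  total : (A → ℚ) → List A → ℚ
  total f = foldr (λ x s → f x + s) 0ℚ

  total-++ : ∀ (f : A → ℚ) xs ys → total f (xs ++ ys) ≡ total f xs + total f ys
  total-++ f []       ys = sym (+-identityˡ _)
  total-++ f (x ∷ xs) ys = trans (cong (f x +_) (total-++ f xs ys)) (sym (+-assoc (f x) _ _))

  total-replicate : ∀ (f : A → ℚ) n x → total f (replicate n x) ≡ ι n * f x
  total-replicate f zero    x = sym (*-zeroˡ (f x))
  total-replicate f (suc n) x = begin
    f x + total f (replicate n x)   ≡⟨ cong (f x +_) (total-replicate f n x) ⟩
    f x + ι n * f x                 ≡⟨ solve 2 (λ y n → y :+ n :* y := (con 1ℚ :+ n) :* y) refl (f x) (ι n) ⟩
    (1ℚ + ι n) * f x                ≡⟨ cong (_* f x) (sym (ι-+ 1 n)) ⟩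
    ι (suc n) * f x                 ∎

  sum-at : ∀ (f : A → ℚ) z xs → length xs Nat.≤ N →
    sum {N} (λ t → f (at z xs (toℕ t))) ≡ total f xs + ι (N Nat.∸ length xs) * f z
  sum-at {N = N}     f z []       _       = begin
    sum {N} (λ t → f z)    ≡⟨ constant N ⟩
    ι N * f z              ≡⟨ sym (+-identityˡ _) ⟩
    0ℚ + ι N * f z         ∎
    where
    constant : ∀ n → sum {n} (λ t → f z) ≡ ι n * f z
    constant zero    = sym (*-zeroˡ (f z))
    constant (suc n) = begin
      f z + sum {n} (λ t → f z)    ≡⟨ cong (f z +_) (constant n) ⟩
      f z + ι n * f z              ≡⟨ solve 2 (λ y n → y :+ n :* y := (con 1ℚ :+ n) :* y) refl (f z) (ι n) ⟩
      (1ℚ + ι n) * f z             ≡⟨ cong (_* f z) (sym (ι-+ 1 n)) ⟩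
      ι (suc n) * f z              ∎
  sum-at {N = suc N} f z (x ∷ xs) (s≤s h) = trans (cong (f x +_) (sum-at f z xs h)) (sym (+-assoc (f x) _ _))

  -- The exponent of the norm, and the index of the codeword.
  Column : ℕ → Set
  Column K = ℕ × Fin K

  energy : Column K → ℚ
  energy (e , _) = ι (64 Nat.^ e)

  scale : Column K → ℚ
  scale (e , _) = ι (8 Nat.^ e)

  scale² : (c : Column K) → scale c * scale c ≡ energy c
  scale² (e , _) = trans (sym (ι-* (8 Nat.^ e) (8 Nat.^ e))) (cong ι (sym (Natural.^-distrib-* 8 8 e)))

  -- A block (b , e) stands for b equal columns of squared norm 64ᵉ.
  Blocks : Set
  Blocks = List (ℕ × ℕ)

  layout : (bs : Blocks) → Vec (Fin K) (length bs) → List (Column K)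
  layout []             []      = []
  layout ((b , e) ∷ bs) (c ∷ w) = replicate b (e , c) ++ layout bs w

  size : Blocks → ℕ
  size []             = 0
  size ((b , _) ∷ bs) = b Nat.+ size bs

  -- Mass in excess of 1 per column. A window of N columns then has mass N + `excess`, no matter how
  -- many of them are filler.
  excess : Blocks → ℕ
  excess []             = 0
  excess ((b , e) ∷ bs) = b Nat.* (64 Nat.^ e Nat.∸ 1) Nat.+ excess bs

  length-layout : ∀ bs (w : Vec (Fin K) (length bs)) → length (layout bs w) ≡ size bs
  length-layout []             []      = refl
  length-layout ((b , e) ∷ bs) (c ∷ w) = trans (length-++ (replicate b (e , c)))
    (cong₂ Nat._+_ (length-replicate b) (length-layout bs w))

  total-energy : ∀ bs (w : Vec (Fin K) (length bs)) → total energy (layout bs w) ≡ ι (size bs Nat.+ excess bs)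
  total-energy []             []      = refl
  total-energy ((b , e) ∷ bs) (c ∷ w) = begin
    total energy (replicate b (e , c) ++ layout bs w)
      ≡⟨ total-++ energy (replicate b (e , c)) (layout bs w) ⟩
    total energy (replicate b (e , c)) + total energy (layout bs w)
      ≡⟨ cong₂ _+_ (total-replicate energy b (e , c)) (total-energy bs w) ⟩
    ι b * ι (64 Nat.^ e) + ι (size bs Nat.+ excess bs)
      ≡⟨ trans (cong (_+ ι (size bs Nat.+ excess bs)) (sym (ι-* b (64 Nat.^ e)))) (sym (ι-+ (b Nat.* 64 Nat.^ e) (size bs Nat.+ excess bs))) ⟩
    ι (b Nat.* 64 Nat.^ e Nat.+ (size bs Nat.+ excess bs))
      ≡⟨ cong ι (trans (cong (λ z → b Nat.* z Nat.+ (size bs Nat.+ excess bs)) (sym (ℕₚ.m+[n∸m]≡n (ℕₚ.m^n>0 64 e))))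
           (regroup b (64 Nat.^ e Nat.∸ 1) (size bs) (excess bs))) ⟩
    ι (b Nat.+ size bs Nat.+ (b Nat.* (64 Nat.^ e Nat.∸ 1) Nat.+ excess bs)) ∎
    where
    open ℕSolver.+-*-Solver using () renaming (solve to solveℕ; _:+_ to _⊕_; _:*_ to _⊗_; con to conℕ; _:=_ to _⊜_)
    regroup : ∀ b x s y → b Nat.* (1 Nat.+ x) Nat.+ (s Nat.+ y) ≡ b Nat.+ s Nat.+ (b Nat.* x Nat.+ y)
    regroup = solveℕ 4 (λ b x s y → b ⊗ (conℕ 1 ⊕ x) ⊕ (s ⊕ y) ⊜ b ⊕ s ⊕ (b ⊗ x ⊕ y)) refl

  -- The result does not depend on the codewords `w`: windows with the same blocks have equal
  -- Frobenius norms.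
  sum-energy : ∀ bs (w : Vec (Fin K) (length bs)) c → size bs Nat.≤ N →
    sum {N} (λ t → energy (at (0 , c) (layout bs w) (toℕ t))) ≡ ι (N Nat.+ excess bs)
  sum-energy {N = N} bs w c size≤N = begin
    sum {N} (λ t → energy (at (0 , c) (layout bs w) (toℕ t)))
      ≡⟨ sum-at energy (0 , c) (layout bs w) (subst (Nat._≤ N) (sym (length-layout bs w)) size≤N) ⟩
    total energy (layout bs w) + ι (N Nat.∸ length (layout bs w)) * 1ℚ
      ≡⟨ cong₂ _+_ (total-energy bs w) (trans (*-identityʳ _) (cong (λ n → ι (N Nat.∸ n)) (length-layout bs w))) ⟩
    ι (size bs Nat.+ excess bs) + ι (N Nat.∸ size bs)
      ≡⟨ sym (ι-+ (size bs Nat.+ excess bs) (N Nat.∸ size bs)) ⟩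
    ι (size bs Nat.+ excess bs Nat.+ (N Nat.∸ size bs))
      ≡⟨ cong ι (trans (regroup (size bs) (excess bs) (N Nat.∸ size bs)) (cong (Nat._+ excess bs) (ℕₚ.m+[n∸m]≡n size≤N))) ⟩
    ι (N Nat.+ excess bs) ∎
    where
    open ℕSolver.+-*-Solver using () renaming (solve to solveℕ; _:+_ to _⊕_; _:=_ to _⊜_)
    regroup : ∀ s x r → s Nat.+ x Nat.+ r ≡ s Nat.+ r Nat.+ x
    regroup = solveℕ 3 (λ s x r → s ⊕ x ⊕ r ⊜ s ⊕ r ⊕ x) refl

  -- `G d` will be ⟨u, x_d⟩⟨v, y_d⟩ for test vectors u and v, so that `f` is the contribution of one
  -- column to uᵀXYᵀv.
  module Difference (G : Fin K → ℚ) where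

    f : Column K → ℚ
    f c = energy c * G (proj₂ c)

    sum-first : ∀ {b e c₁ c₂} bs (w : Vec (Fin K) (length bs)) c → b Nat.+ size bs Nat.≤ N →
      sum {N} (λ t → f (at (0 , c) (layout ((b , e) ∷ bs) (c₁ ∷ w)) (toℕ t)))
      - sum {N} (λ t → f (at (0 , c) (layout ((b , e) ∷ bs) (c₂ ∷ w)) (toℕ t)))
      ≡ ι (b Nat.* 64 Nat.^ e) * (G c₁ - G c₂)
    sum-first {N = N} {b} {e} {c₁} {c₂} bs w c size≤N = begin
      S c₁ - S c₂
        ≡⟨ cong₂ _-_ (S≡ c₁) (S≡ c₂) ⟩
      (ι b * (E * G c₁) + T + R) - (ι b * (E * G c₂) + T + R)
        ≡⟨ solve 6 (λ b e g h t r → (b :* (e :* g) :+ t :+ r) :- (b :* (e :* h) :+ t :+ r) := b :* e :* (g :- h)) refl (ι b) E (G c₁) (G c₂) T R ⟩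
      ι b * E * (G c₁ - G c₂)
        ≡⟨ cong (_* (G c₁ - G c₂)) (sym (ι-* b (64 Nat.^ e))) ⟩
      ι (b Nat.* 64 Nat.^ e) * (G c₁ - G c₂) ∎
      where
      E = ι (64 Nat.^ e)
      T = total f (layout bs w)
      R = ι (N Nat.∸ (b Nat.+ size bs)) * f (0 , c)
      L : Fin K → List (Column K)
      L c₀ = layout ((b , e) ∷ bs) (c₀ ∷ w)
      S : Fin K → ℚ
      S c₀ = sum {N} (λ t → f (at (0 , c) (L c₀) (toℕ t)))
      S≡ : ∀ c₀ → S c₀ ≡ ι b * (E * G c₀) + T + R
      S≡ c₀ = begin
        S c₀
          ≡⟨ sum-at f (0 , c) (L c₀) (subst (Nat._≤ N) (sym (length-layout ((b , e) ∷ bs) (c₀ ∷ w))) size≤N) ⟩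
        total f (L c₀) + ι (N Nat.∸ length (L c₀)) * f (0 , c)
          ≡⟨ cong₂ _+_ (trans (total-++ f (replicate b (e , c₀)) (layout bs w)) (cong (_+ T) (total-replicate f b (e , c₀))))
               (cong (λ n → ι (N Nat.∸ n) * f (0 , c)) (length-layout ((b , e) ∷ bs) (c₀ ∷ w))) ⟩
        ι b * (E * G c₀) + T + R ∎

-- Oldest block first.  At the time it becomes the oldest column of the window, a block shares the
-- window with the later blocks and with filler of norm 1, whose total mass is N + excess.
data Feasible (N l ρ : ℕ) : Columns.Blocks → Set where
  []  : Feasible N l ρ []
  add : ∀ {b e bs} → NonZero b → e Nat.≤ ρ →
        8 Nat.* (N Nat.+ Columns.excess ((b , e) ∷ bs)) Nat.≤ 9 Nat.* (l Nat.* (b Nat.* 64 Nat.^ e)) →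
        Feasible N l ρ bs → Feasible N l ρ ((b , e) ∷ bs)

module Designs where

  open Nat
  open ℕₚ
  open ≤-Reasoning
  open ℕSolver.+-*-Solver
  open Columns using (Blocks; size; excess)

  size-++ : ∀ as bs → size (as ++ bs) ≡ size as + size bs
  size-++ []             bs = refl
  size-++ ((b , _) ∷ as) bs = trans (cong (b +_) (size-++ as bs)) (sym (+-assoc b (size as) (size bs)))

  size-replicate : ∀ q {b e} → size (replicate q (b , e)) ≡ q * b
  size-replicate zero        = refl
  size-replicate (suc q) {b} = cong (b +_) (size-replicate q)

  n<[1+n/d]*d : ∀ n d .{{_ : NonZero d}} → n < suc (n / d) * d
  n<[1+n/d]*d n d = begin-strict
    n                      ≡⟨ m≡m%n+[m/n]*n n d ⟩
    n % d + n / d * d      <⟨ +-monoˡ-< (n / d * d) (m%n<n n d) ⟩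
    suc (n / d) * d        ∎

  -- max(1, ⌊l/2⌋), the number of blocks on each level.
  multiplicity : ℕ → ℕ
  multiplicity (suc (suc m)) = suc ⌊ m /2⌋
  multiplicity _             = 1

  multiplicity≢0 : ∀ l → NonZero (multiplicity l)
  multiplicity≢0 zero          = _
  multiplicity≢0 (suc zero)    = _
  multiplicity≢0 (suc (suc l)) = _

  2*multiplicity≤ : ∀ l → 2 ≤ l → multiplicity l + multiplicity l ≤ l
  2*multiplicity≤ (suc (suc m)) _ = begin
    suc ⌊ m /2⌋ + suc ⌊ m /2⌋     ≡⟨ cong suc (+-suc ⌊ m /2⌋ ⌊ m /2⌋) ⟩
    suc (suc (⌊ m /2⌋ + ⌊ m /2⌋)) ≤⟨ s≤s (s≤s (+-monoʳ-≤ ⌊ m /2⌋ (⌊n/2⌋≤⌈n/2⌉ m))) ⟩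
    suc (suc (⌊ m /2⌋ + ⌈ m /2⌉)) ≡⟨ cong (λ n → suc (suc n)) (⌊n/2⌋+⌈n/2⌉≡n m) ⟩
    suc (suc m)                   ∎
  2*multiplicity≤ (suc zero) (s≤s ())

  multiplicity≤ : ∀ l .{{_ : NonZero l}} → multiplicity l ≤ l
  multiplicity≤ (suc zero)    = ≤-refl
  multiplicity≤ (suc (suc m)) = s≤s (m≤n⇒m≤1+n (⌊n/2⌋≤n m))

  -- The worst case is l = 3, where 3/2 is rounded down to 1.
  ≤3*multiplicity : ∀ l → l ≤ 3 * multiplicity l
  ≤3*multiplicity zero          = z≤n
  ≤3*multiplicity (suc zero)    = s≤s z≤n
  ≤3*multiplicity (suc (suc m)) = begin
    suc (suc m)                           ≡⟨ cong (λ n → suc (suc n)) (sym (⌊n/2⌋+⌈n/2⌉≡n m)) ⟩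
    suc (suc (⌊ m /2⌋ + ⌈ m /2⌉))         ≤⟨ s≤s (s≤s (+-monoʳ-≤ ⌊ m /2⌋ (⌈/2⌉≤ m))) ⟩
    suc (suc (⌊ m /2⌋ + suc ⌊ m /2⌋))     ≤⟨ m≤m+n _ ⌊ m /2⌋ ⟩
    suc (suc (⌊ m /2⌋ + suc ⌊ m /2⌋)) + ⌊ m /2⌋
                                          ≡⟨ solve 1 (λ h → con 2 :+ (h :+ (con 1 :+ h)) :+ h := con 3 :* (con 1 :+ h)) refl ⌊ m /2⌋ ⟩
    3 * suc ⌊ m /2⌋                       ∎
    where
    ⌈/2⌉≤ : ∀ m → ⌈ m /2⌉ ≤ suc ⌊ m /2⌋
    ⌈/2⌉≤ zero          = z≤n
    ⌈/2⌉≤ (suc zero)    = s≤s z≤n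
    ⌈/2⌉≤ (suc (suc m)) = s≤s (⌈/2⌉≤ m)

  module _ (N l : ℕ) {{l≢0 : NonZero l}} where

    p : ℕ
    p = multiplicity l

    private instance
      p≢0 : NonZero p
      p≢0 = multiplicity≢0 l

    p≤l : p ≤ l
    p≤l = multiplicity≤ l

    -- The design for bounded R, when exponent 0 must suffice: the window is cut into `p` blocks of
    -- unit columns, and there is no excess.
    flat : Blocks
    flat = replicate p (N / p , 0)

    size-flat : size flat ≤ N
    size-flat = subst (_≤ N) (sym (trans (size-replicate p) (*-comm p (N / p)))) (m/n*n≤m N p)

    flat-feasible : p ≤ N → Feasible N l 0 flat
    flat-feasible p≤N = go p
      where
      -- For l ≥ 2, rounding down loses less than a factor 2 because the quotient is at least 1, and
      -- 2 p ≤ l absorbs it. For l = 1 the divisor is 1.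
      N≤l[N/p] : ∀ l .{{_ : NonZero l}} .{{_ : NonZero (multiplicity l)}} → multiplicity l ≤ N → N ≤ l * (N / multiplicity l)
      N≤l[N/p] (suc zero) _ = begin
        N                       ≤⟨ ≤-pred (subst (N <_) (*-identityʳ (suc (N / 1))) (n<[1+n/d]*d N 1)) ⟩
        N / 1                   ≡⟨ sym (+-identityʳ (N / 1)) ⟩
        N / 1 + 0               ∎
      N≤l[N/p] l@(suc (suc m)) q≤N = begin
        N                       ≤⟨ <⇒≤ (n<[1+n/d]*d N q) ⟩
        suc (N / q) * q         ≤⟨ *-monoˡ-≤ q (+-monoˡ-≤ (N / q) (m≥n⇒m/n>0 {N} {q} q≤N)) ⟩
        (N / q + N / q) * q     ≡⟨ solve 2 (λ b q → (b :+ b) :* q := (q :+ q) :* b) refl (N / q) q ⟩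
        (q + q) * (N / q)       ≤⟨ *-monoˡ-≤ (N / q) (2*multiplicity≤ l (s≤s (s≤s z≤n))) ⟩
        l * (N / q)             ∎
        where q = multiplicity l
      no-excess : ∀ q → excess (replicate q (N / p , 0)) ≡ 0
      no-excess zero    = refl
      no-excess (suc q) = cong₂ _+_ (*-zeroʳ (N / p)) (no-excess q)
      go : ∀ q → Feasible N l 0 (replicate q (N / p , 0))
      go zero    = []
      go (suc q) = add (>-nonZero (m≥n⇒m/n>0 {N} {p} p≤N)) z≤n (begin
        8 * (N + excess (replicate (suc q) (N / p , 0)))   ≡⟨ cong (λ x → 8 * (N + x)) (no-excess (suc q)) ⟩
        8 * (N + 0)                                        ≡⟨ cong (8 *_) (+-identityʳ N) ⟩
        8 * N                                              ≤⟨ *-monoˡ-≤ N (n≤1+n 8) ⟩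
        9 * N                                              ≤⟨ *-monoʳ-≤ 9 (N≤l[N/p] l p≤N) ⟩
        9 * (l * (N / p))                                  ≡⟨ cong (λ b → 9 * (l * b)) (sym (*-identityʳ (N / p))) ⟩
        9 * (l * (N / p * 1))                              ∎) (go q)

    -- N / (4ⁱ p), rounded down.
    share : ℕ → ℕ
    share zero    = N / p
    share (suc i) = share i / 4

    -- The extra column keeps blocks nonempty when `share i` is 0, and rounding up makes masses
    -- large enough for any N. Its price is one column per block.
    columns : ℕ → ℕ
    columns i = suc (share i)

    mass : ℕ → ℕ
    mass i = columns i * 64 ^ i

    -- Heaviest level first: by the time a block is the oldest, all heavier levels have expired.
    -- Exponent 0 is left to the filler.
    levels : ℕ → Blocks
    levels zero    = []
    levels (suc i) = replicate p (columns (suc i) , suc i) ++ levels i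

    length-levels : ∀ i → length (levels i) ≡ p * i
    length-levels zero    = sym (*-zeroʳ p)
    length-levels (suc i) = trans (length-++ (replicate p (columns (suc i) , suc i)))
      (trans (cong₂ _+_ (length-replicate p) (length-levels i)) (sym (*-suc p i)))

    columns≤4* : ∀ i → columns i ≤ 4 * columns (suc i)
    columns≤4* i = subst (columns i ≤_) (*-comm (columns (suc i)) 4) (n<[1+n/d]*d (share i) 4)

    -- Energy grows by 64 while the number of columns shrinks by at most 4, and 64 / 4 = 16 ≥ 9.
    mass-grows : ∀ i → 9 * mass i ≤ mass (suc i)
    mass-grows i = begin
      9 * (columns i * 64 ^ i)                    ≤⟨ *-monoʳ-≤ 9 (*-monoˡ-≤ (64 ^ i) (columns≤4* i)) ⟩
      9 * (4 * columns (suc i) * 64 ^ i)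
        ≡⟨ solve 2 (λ b z → con 9 :* (con 4 :* b :* z) := con 36 :* (b :* z)) refl (columns (suc i)) (64 ^ i) ⟩
      36 * (columns (suc i) * 64 ^ i)             ≤⟨ *-monoˡ-≤ (columns (suc i) * 64 ^ i) (m≤m+n 36 28) ⟩
      64 * (columns (suc i) * 64 ^ i)
        ≡⟨ solve 2 (λ b z → con 64 :* (b :* z) := b :* (con 64 :* z)) refl (columns (suc i)) (64 ^ i) ⟩
      mass (suc i)                                ∎

    excess-replicate : ∀ q i bs → excess (replicate q (columns i , i) ++ bs) ≤ q * mass i + excess bs
    excess-replicate zero    i bs = ≤-refl
    excess-replicate (suc q) i bs = begin
      columns i * (64 ^ i ∸ 1) + excess (replicate q (columns i , i) ++ bs)
        ≤⟨ +-mono-≤ (*-monoʳ-≤ (columns i) (m∸n≤m (64 ^ i) 1)) (excess-replicate q i bs) ⟩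
      mass i + (q * mass i + excess bs)
        ≡⟨ sym (+-assoc (mass i) (q * mass i) (excess bs)) ⟩
      suc q * mass i + excess bs ∎

    -- The budget of 9 units of l μ: eight pay for the at most l blocks of the level itself, the
    -- ninth for N and everything below, which is the hypothesis.
    add-level : ∀ {i q} bs → q ≤ p → 8 * (N + excess bs) ≤ l * mass i →
      8 * (N + excess (replicate q (columns i , i) ++ bs)) ≤ 9 * (l * mass i)
    add-level {i} {q} bs q≤p h = begin
      8 * (N + excess (replicate q (columns i , i) ++ bs))   ≤⟨ *-monoʳ-≤ 8 (+-monoʳ-≤ N (excess-replicate q i bs)) ⟩
      8 * (N + (q * mass i + excess bs))
        ≡⟨ solve 3 (λ n x e → con 8 :* (n :+ (x :+ e)) := con 8 :* (n :+ e) :+ con 8 :* x) refl N (q * mass i) (excess bs) ⟩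
      8 * (N + excess bs) + 8 * (q * mass i)                 ≤⟨ +-mono-≤ h (*-monoʳ-≤ 8 (*-monoˡ-≤ (mass i) (≤-trans q≤p p≤l))) ⟩
      l * mass i + 8 * (l * mass i)                          ∎

    -- By `add-level`, level i together with all below it costs at most nine units of its own mass,
    -- and the ninefold growth turns these into one unit of the next level. At the bottom 32 is
    -- needed and 64 available.
    below : ∀ i → 8 * (N + excess (levels i)) ≤ l * mass (suc i)
    below zero = begin
      8 * (N + 0)                       ≡⟨ cong (8 *_) (+-identityʳ N) ⟩
      8 * N                             ≤⟨ *-monoʳ-≤ 8 (<⇒≤ (n<[1+n/d]*d N p)) ⟩
      8 * (columns 0 * p)               ≤⟨ *-monoʳ-≤ 8 (*-mono-≤ (columns≤4* 0) p≤l) ⟩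
      8 * (4 * columns 1 * l)           ≡⟨ solve 2 (λ b l → con 8 :* (con 4 :* b :* l) := l :* (b :* con 32)) refl (columns 1) l ⟩
      l * (columns 1 * 32)              ≤⟨ *-monoʳ-≤ l (*-monoʳ-≤ (columns 1) (m≤m+n 32 32)) ⟩
      l * (columns 1 * 64)              ∎
    below (suc i) = begin
      8 * (N + excess (levels (suc i)))    ≤⟨ add-level (levels i) ≤-refl (below i) ⟩
      9 * (l * mass (suc i))               ≡⟨ solve 2 (λ l m → con 9 :* (l :* m) := l :* (con 9 :* m)) refl l (mass (suc i)) ⟩
      l * (9 * mass (suc i))               ≤⟨ *-monoʳ-≤ l (mass-grows (suc i)) ⟩
      l * mass (suc (suc i))               ∎

    levels-feasible : ∀ ρ → Feasible N l ρ (levels ρ)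
    levels-feasible ρ = go ρ ≤-refl
      where
      go : ∀ i → i ≤ ρ → Feasible N l ρ (levels i)
      go zero    _   = []
      go (suc i) i<ρ = copies p ≤-refl
        where
        copies : ∀ q → q ≤ p → Feasible N l ρ (replicate q (columns (suc i) , suc i) ++ levels i)
        copies zero    _   = go i (<⇒≤ i<ρ)
        copies (suc q) q<p = add _ i<ρ (add-level {suc i} {suc q} (levels i) q<p (below i)) (copies q (<⇒≤ q<p))

    -- A geometric series in telescoped form. Level i + 1 takes p columns for rounding and p ·
    -- `share (suc i)` others; as 4 · `share (suc i)` ≤ `share i`, three times the latter is covered
    -- by the drop in the second summand.
    size-levels : ∀ i → 3 * size (levels i) + share i * p ≤ 3 * (p * i) + N
    size-levels zero = ≤-trans (m/n*n≤m N p) (m≤n+m N (3 * (p * 0)))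
    size-levels (suc i) = begin
      3 * size (levels (suc i)) + share (suc i) * p
        ≡⟨ cong (λ s → 3 * s + share (suc i) * p) (trans (size-++ (replicate p (columns (suc i) , suc i)) (levels i)) (cong (_+ size (levels i)) (size-replicate p))) ⟩
      3 * (p * columns (suc i) + size (levels i)) + share (suc i) * p
        ≡⟨ solve 3 (λ p a s → con 3 :* (p :* (con 1 :+ a) :+ s) :+ a :* p := con 3 :* p :+ (con 3 :* s :+ a :* con 4 :* p)) refl p (share (suc i)) (size (levels i)) ⟩
      3 * p + (3 * size (levels i) + share (suc i) * 4 * p)
        ≤⟨ +-monoʳ-≤ (3 * p) (+-monoʳ-≤ (3 * size (levels i)) (*-monoˡ-≤ p (m/n*n≤m (share i) 4))) ⟩
      3 * p + (3 * size (levels i) + share i * p)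
        ≤⟨ +-monoʳ-≤ (3 * p) (size-levels i) ⟩
      3 * p + (3 * (p * i) + N)
        ≡⟨ solve 3 (λ p i n → con 3 :* p :+ (con 3 :* (p :* i) :+ n) := con 3 :* (p :* (con 1 :+ i)) :+ n) refl p i N ⟩
      3 * (p * suc i) + N ∎

    size-levels≤N : ∀ ρ → 3 * (p * ρ) ≤ 2 * N → size (levels ρ) ≤ N
    size-levels≤N ρ h = *-cancelˡ-≤ 3 (begin
      3 * size (levels ρ)                    ≤⟨ m≤m+n _ (share ρ * p) ⟩
      3 * size (levels ρ) + share ρ * p      ≤⟨ size-levels ρ ⟩
      3 * (p * ρ) + N                        ≤⟨ +-monoˡ-≤ N h ⟩
      2 * N + N                              ≡⟨ solve 1 (λ n → con 2 :* n :+ n := con 3 :* n) refl N ⟩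
      3 * N                                  ∎)

-- Bilinear forms over the rationals

module Bilinear where

  open Rat
  open ℚₚ
  open ℚSolver.+-*-Solver
  open Rational

  private variable
    a b N : ℕ

  -- ⟨u, r⟩ ≤ (ρ |u|² + |r|²/ρ) / 2
  ⟨unit,r⟩≤ : ∀ (u r : Vector ℚ a) ρ → 0ℚ < ρ → ⟨ u , u ⟩ ≡ 1ℚ → ⟨ r , r ⟩ ≤ ρ * ρ → ⟨ u , r ⟩ ≤ ρ
  ⟨unit,r⟩≤ {a} u r ρ 0<ρ unit r²≤ρ² = *-cancelʳ (*-pos (0<ι 2) 0<ρ) (begin
    ⟨ u , r ⟩ * (ι 2 * ρ)                 ≡⟨ *-distribʳ-sum (ι 2 * ρ) (λ i → u i * r i) ⟩
    sum (λ i → u i * r i * (ι 2 * ρ))     ≤⟨ sum-mono (λ i → amgm (u i) (r i)) ⟩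
    sum (λ i → u i * u i * (ρ * ρ) + r i * r i)
                                          ≡⟨ ∑-distrib-+ (λ i → u i * u i * (ρ * ρ)) (λ i → r i * r i) ⟩
    sum (λ i → u i * u i * (ρ * ρ)) + ⟨ r , r ⟩
                                          ≡⟨ cong (_+ ⟨ r , r ⟩) (sym (*-distribʳ-sum (ρ * ρ) (λ i → u i * u i))) ⟩
    ⟨ u , u ⟩ * (ρ * ρ) + ⟨ r , r ⟩       ≡⟨ cong (λ z → z * (ρ * ρ) + ⟨ r , r ⟩) unit ⟩
    1ℚ * (ρ * ρ) + ⟨ r , r ⟩              ≤⟨ +-monoʳ-≤ (1ℚ * (ρ * ρ)) r²≤ρ² ⟩
    1ℚ * (ρ * ρ) + ρ * ρ                  ≡⟨ solve 1 (λ ρ → con 1ℚ :* (ρ :* ρ) :+ ρ :* ρ := ρ :* (con (ι 2) :* ρ)) refl ρ ⟩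
    ρ * (ι 2 * ρ)                         ∎)
    where
    open ≤-Reasoning
    sum-mono : ∀ {n} {f g : Vector ℚ n} → (∀ i → f i ≤ g i) → sum f ≤ sum g
    sum-mono {zero}  h = ≤-refl
    sum-mono {suc n} h = +-mono-≤ (h zero) (sum-mono (h ∘ suc))
    square≥0 : ∀ p → 0ℚ ≤ p * p
    square≥0 p with ≤-total 0ℚ p
    ... | inj₁ 0≤p = *-nonNeg 0≤p 0≤p
    ... | inj₂ p≤0 = subst (0ℚ ≤_) (solve 1 (λ p → :- p :* :- p := p :* p) refl p) (*-nonNeg (neg-antimono-≤ p≤0) (neg-antimono-≤ p≤0))
    amgm : ∀ p q → p * q * (ι 2 * ρ) ≤ p * p * (ρ * ρ) + q * q
    amgm p q = begin
      p * q * (ι 2 * ρ)                                ≡⟨ sym (+-identityˡ _) ⟩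
      0ℚ + p * q * (ι 2 * ρ)                           ≤⟨ +-monoˡ-≤ (p * q * (ι 2 * ρ)) (square≥0 (p * ρ - q)) ⟩
      (p * ρ - q) * (p * ρ - q) + p * q * (ι 2 * ρ)
        ≡⟨ solve 3 (λ p q ρ → (p :* ρ :- q) :* (p :* ρ :- q) :+ p :* q :* (con (ι 2) :* ρ) := p :* p :* (ρ :* ρ) :+ q :* q) refl p q ρ ⟩
      p * p * (ρ * ρ) + q * q                          ∎

  module _ (u : Vector ℚ a) (v : Vector ℚ b) where

    open ≡-Reasoning

    -- The value uᵀPv.
    form : (Fin a → Fin b → ℚ) → ℚ
    form P = sum λ j → u j * sum λ k → P j k * v k

    form-cong : ∀ {P Q} → (∀ j k → P j k ≡ Q j k) → form P ≡ form Q
    form-cong P≗Q = sum-cong-≗ λ j → cong (u j *_) (sum-cong-≗ λ k → cong (_* v k) (P≗Q j k))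

    form-+ : ∀ P Q → form (λ j k → P j k + Q j k) ≡ form P + form Q
    form-+ P Q = begin
      form (λ j k → P j k + Q j k)
        ≡⟨ sum-cong-≗ (λ j → trans (cong (u j *_) (trans (sum-cong-≗ λ k → *-distribʳ-+ (v k) (P j k) (Q j k)) (∑-distrib-+ (λ k → P j k * v k) (λ k → Q j k * v k)))) (*-distribˡ-+ (u j) _ _)) ⟩
      sum (λ j → u j * sum (λ k → P j k * v k) + u j * sum (λ k → Q j k * v k))
        ≡⟨ ∑-distrib-+ (λ j → u j * sum (λ k → P j k * v k)) (λ j → u j * sum (λ k → Q j k * v k)) ⟩
      form P + form Q ∎

    form-product : ∀ (X : Fin a → Fin N → ℚ) (Y : Fin b → Fin N → ℚ) →
      form (λ j k → sum λ t → X j t * Y k t) ≡ sum λ t → ⟨ u , (λ j → X j t) ⟩ * ⟨ v , (λ k → Y k t) ⟩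
    form-product X Y = begin
      sum (λ j → u j * sum (λ k → sum (λ t → X j t * Y k t) * v k))
        ≡⟨ sum-cong-≗ (λ j → trans (cong (u j *_) (trans (sum-cong-≗ λ k → *-distribʳ-sum (v k) (λ t → X j t * Y k t)) (∑-comm (λ k t → X j t * Y k t * v k))))
             (*-distribˡ-sum (u j) (λ t → sum (λ k → X j t * Y k t * v k)))) ⟩
      sum (λ j → sum (λ t → u j * sum (λ k → X j t * Y k t * v k)))
        ≡⟨ ∑-comm (λ j t → u j * sum (λ k → X j t * Y k t * v k)) ⟩
      sum (λ t → sum (λ j → u j * sum (λ k → X j t * Y k t * v k)))
        ≡⟨ sum-cong-≗ (λ t → trans (sum-cong-≗ λ j → inner t j) (sym (*-distribʳ-sum ⟨ v , (λ k → Y k t) ⟩ (λ j → u j * X j t)))) ⟩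
      sum (λ t → ⟨ u , (λ j → X j t) ⟩ * ⟨ v , (λ k → Y k t) ⟩) ∎
      where
      inner : ∀ t j → u j * sum (λ k → X j t * Y k t * v k) ≡ u j * X j t * ⟨ v , (λ k → Y k t) ⟩
      inner t j = trans (cong (u j *_) (trans (sum-cong-≗ λ k → solve 3 (λ x y v → x :* y :* v := x :* (v :* y)) refl (X j t) (Y k t) (v k)) (sym (*-distribˡ-sum (X j t) (λ k → v k * Y k t)))))
        (sym (*-assoc (u j) (X j t) _))

-- Real matrices and streams

open import Defs

module Approximations where

  open Rat using () renaming (_+_ to _⊕_; _*_ to _⊛_; -_ to ⊖_; _-_ to _⊝_; _≤_ to _≼_; _<_ to _≺_)
  open ℚₚ
  open ℚSolver.+-*-Solver using (solve; _:=_; _:+_; _:*_; _:-_; :-_; con)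
  open Rational
  open RealLemmas using (≤ˡ; ≤ʳ)
  open Bilinear

  private variable
    a b m n N : ℕ

  -- Inequalities between reals yield rational ones only up to slack; this removes it once both
  -- sides are free of the index.
  ≤-by-slack : ∀ {p q} → (∀ η → 0ℚ ≺ η → p ≼ q ⊕ η) → p ≼ q
  ≤-by-slack {p} {q} h = ≮⇒≥ λ q<p →
    let d , 0<d , d+d≡ = half (subst (_≺ p ⊝ q) (+-inverseʳ q) (+-monoˡ-< (⊖ q) q<p))
    in <-irrefl refl (begin-strict
      p             ≤⟨ h d 0<d ⟩
      q ⊕ d         ≡⟨ sym (+-identityʳ (q ⊕ d)) ⟩
      q ⊕ d ⊕ 0ℚ    <⟨ +-monoʳ-< (q ⊕ d) 0<d ⟩
      q ⊕ d ⊕ d     ≡⟨ +-assoc q d d ⟩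
      q ⊕ (d ⊕ d)   ≡⟨ cong (q ⊕_) d+d≡ ⟩
      q ⊕ (p ⊝ q)   ≡⟨ solve 2 (λ p q → q :+ (p :- q) := p) refl p q ⟩
      p             ∎)
    where open ≤-Reasoning

  seq-∑ : ∀ (f : Vector ℝ n) i → seq (∑ f) i ≡ sum (λ j → seq (f j) i)
  seq-∑ {zero}  f i = refl
  seq-∑ {suc n} f i = cong (seq (f zero) i ⊕_) (seq-∑ (f ∘ suc) i)

  ⟦_⟧ : Vector ℚ n → Vector ℝ n
  ⟦ v ⟧ j = fromℚ (v j)

  ⟦_⟧ᴹ : (Fin m → Fin n → ℚ) → Matrix m n
  ⟦ P ⟧ᴹ j = ⟦ P j ⟧

  -- The approximants of √ round down, so the bound holds at every index and without slack.
  √²≤ : ∀ i {q M} → q ≡ M → 0ℚ ≼ M → √-approx i (q Rat.⊔ 0ℚ) ⊛ √-approx i (q Rat.⊔ 0ℚ) ≼ M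
  √²≤ i {q} {M} q≡M 0≤M = begin
    √-approx i (q Rat.⊔ 0ℚ) ⊛ √-approx i (q Rat.⊔ 0ℚ)   ≤⟨ √-Approx.lower i (q Rat.⊔ 0ℚ) (p≤q⊔p q 0ℚ) ⟩
    q Rat.⊔ 0ℚ                                          ≡⟨ cong (Rat._⊔ 0ℚ) q≡M ⟩
    M Rat.⊔ 0ℚ                                          ≡⟨ p≥q⇒p⊔q≡p 0≤M ⟩
    M                                                   ∎
    where open ≤-Reasoning

  norm²-seq : ∀ (v : Vector ℝ n) i → seq (∑ λ j → v j ²) i ≡ ⟨ (λ j → seq (v j) i) , (λ j → seq (v j) i) ⟩
  norm²-seq v i = seq-∑ (λ j → v j ²) i

  ‖unit‖≤1 : ∀ (v : Vector ℚ n) → ⟨ v , v ⟩ ≡ 1ℚ → ‖ ⟦ v ⟧ ‖ ≤ fromℕ 1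
  ‖unit‖≤1 v unit ε 0<ε = 0 , λ i _ → begin
    seq ‖ ⟦ v ⟧ ‖ i   ≤⟨ square-cancel-≤ (0≤ι 1) (√²≤ i (trans (norm²-seq ⟦ v ⟧ i) unit) (0≤ι 1)) ⟩
    1ℚ                ≡⟨ sym (+-identityʳ 1ℚ) ⟩
    1ℚ ⊕ 0ℚ           ≤⟨ +-monoʳ-≤ 1ℚ (<⇒≤ 0<ε) ⟩
    1ℚ ⊕ ε            ∎
    where open ≤-Reasoning

  -- Cauchy-Schwarz: uᵀDv ≤ |Dv|, with v among the vectors of the supremum. Adding `τ i` makes up
  -- for the rounding down of the norm `ρ i` and gives the positive bound that `⟨unit,r⟩≤` asks for.
  form-≤-spectralNorm : ∀ {D : Matrix a b} {s} → IsSpectralNorm D s → ∀ u v → ⟨ u , u ⟩ ≡ 1ℚ → ⟨ v , v ⟩ ≡ 1ℚ →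
    ∀ η → 0ℚ ≺ η → ∃[ n ] (∀ i → n Nat.≤ i → form u v (λ j k → seq (D j k) i) ≼ seq s i ⊕ η)
  form-≤-spectralNorm {D = D} {s} (upper , _) u v u-unit v-unit η 0<η =
    let d , 0<d , d+d≡η = half 0<η
        n₁ , ‖Dv‖≤      = upper (⟦ v ⟧ , ‖unit‖≤1 v v-unit) d 0<d
        n₂ , small      = archimedean 0<d
    in n₁ Nat.⊔ n₂ , λ i p → begin
      form u v (λ j k → seq (D j k) i)   ≡⟨ sum-cong-≗ (λ j → cong (u j ⊛_) (sym (seq-∑ (λ k → D j k * ⟦ v ⟧ k) i))) ⟩
      ⟨ u , r i ⟩                        ≤⟨ ⟨unit,r⟩≤ u (r i) (ρ i ⊕ τ i) (0<ρ+τ i) u-unit (r²≤ i) ⟩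
      ρ i ⊕ τ i                          ≤⟨ +-mono-≤ (‖Dv‖≤ i (≤ˡ n₁ p)) (small i (≤ʳ n₁ p)) ⟩
      seq s i ⊕ d ⊕ d                    ≡⟨ trans (+-assoc (seq s i) d d) (cong (seq s i ⊕_) d+d≡η) ⟩
      seq s i ⊕ η                        ∎
    where
    open ≤-Reasoning
    r : ∀ i → Vector ℚ _
    r i j = seq ((D ·ᵛ ⟦ v ⟧) j) i
    ρ τ Q : ℕ → ℚ
    ρ i = seq ‖ D ·ᵛ ⟦ v ⟧ ‖ i
    τ i = Int.+ 1 Rat./ suc i
    Q i = seq (∑ λ j → (D ·ᵛ ⟦ v ⟧) j ²) i
    0<ρ+τ : ∀ i → 0ℚ ≺ ρ i ⊕ τ i
    0<ρ+τ i = +-mono-≤-< (√-approx≥0 i (Q i Rat.⊔ 0ℚ)) (positive⁻¹ (τ i) {{normalize-pos 1 (suc i)}})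
    r²≤ : ∀ i → ⟨ r i , r i ⟩ ≼ (ρ i ⊕ τ i) ⊛ (ρ i ⊕ τ i)
    r²≤ i = begin
      ⟨ r i , r i ⟩                  ≡⟨ sym (norm²-seq (D ·ᵛ ⟦ v ⟧) i) ⟩
      Q i                            ≤⟨ p≤p⊔q (Q i) 0ℚ ⟩
      Q i Rat.⊔ 0ℚ                   ≤⟨ √-Approx.upper i (Q i Rat.⊔ 0ℚ) (p≤q⊔p (Q i) 0ℚ) ⟩
      (ρ i ⊕ τ i) ⊛ (ρ i ⊕ τ i)      ∎

  ‖_‖²F : (Fin m → Fin n → ℚ) → ℚ
  ‖ P ‖²F = sum λ j → ⟨ P j , P j ⟩

  module _ (X : Fin a → Fin N → ℚ) (Y : Fin b → Fin N → ℚ) {M : ℚ} (‖X‖² : ‖ X ‖²F ≡ M) (‖Y‖² : ‖ Y ‖²F ≡ M) where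

    product : Fin a → Fin b → ℚ
    product j k = sum λ t → X j t ⊛ Y k t

    module _ (ε : ℚ) (0≤ε : 0ℚ ≼ ε) (0≤M : 0ℚ ≼ M) {A : Matrix a m} {B : Matrix b m}
             (approx : IsApproximation ε ⟦ X ⟧ᴹ ⟦ Y ⟧ᴹ A B) where

      -- The entries of ABᵀ are real, so its form is evaluated at an index i. It stays a separate
      -- summand, to be cancelled between two windows.
      approximation-bound : ∀ u v → ⟨ u , u ⟩ ≡ 1ℚ → ⟨ v , v ⟩ ≡ 1ℚ → ∀ η → 0ℚ ≺ η →
        ∃[ n ] (∀ i → n Nat.≤ i →
          form u v product ⊕ form u v (λ j k → ⊖ seq ((A · transpose B) j k) i) ≼ ε ⊛ (Int.+ 1 Rat./ 3) ⊛ M ⊕ η)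
      approximation-bound u v u-unit v-unit η 0<η =
        let s , isNorm , s≤ = approx
            d , 0<d , d+d≡η = half 0<η
            n₁ , form≤      = form-≤-spectralNorm {s = s} isNorm u v u-unit v-unit d 0<d
            n₂ , s≤′        = s≤ d 0<d
        in n₁ Nat.⊔ n₂ , λ i p → begin
          form u v product ⊕ form u v (λ j k → ⊖ seq ((A · transpose B) j k) i)
            ≡⟨ sym (form-+ u v product (λ j k → ⊖ seq ((A · transpose B) j k) i)) ⟩
          form u v (λ j k → product j k ⊝ seq ((A · transpose B) j k) i)
            ≡⟨ form-cong u v (λ j k → cong (_⊝ seq ((A · transpose B) j k) i) (sym (seq-∑ (λ t → ⟦ X ⟧ᴹ j t * ⟦ Y ⟧ᴹ k t) i))) ⟩
          form u v (λ j k → seq ((⟦ X ⟧ᴹ · transpose ⟦ Y ⟧ᴹ ∸ᴹ A · transpose B) j k) i)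
            ≤⟨ form≤ i (≤ˡ n₁ p) ⟩
          seq s i ⊕ d
            ≤⟨ +-monoˡ-≤ d (s≤′ i (≤ʳ n₁ p)) ⟩
          ε ⊛ ⅓ ⊛ seq ‖ ⟦ X ⟧ᴹ ‖F i ⊛ seq ‖ ⟦ Y ⟧ᴹ ‖F i ⊕ d ⊕ d
            ≤⟨ +-monoˡ-≤ d (+-monoˡ-≤ d (subst (_≼ ε ⊛ ⅓ ⊛ M) (sym (*-assoc (ε ⊛ ⅓) _ _)) (*-monoˡ (*-nonNeg 0≤ε 0≤⅓) (product≤ i)))) ⟩
          ε ⊛ ⅓ ⊛ M ⊕ d ⊕ d
            ≡⟨ trans (+-assoc (ε ⊛ ⅓ ⊛ M) d d) (cong (ε ⊛ ⅓ ⊛ M ⊕_) d+d≡η) ⟩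
          ε ⊛ ⅓ ⊛ M ⊕ η ∎
        where
        open ≤-Reasoning
        ⅓ = Int.+ 1 Rat./ 3
        0≤⅓ : 0ℚ ≼ ⅓
        0≤⅓ = nonNegative⁻¹ ⅓
        ‖‖²F-seq : ∀ {m n} (P : Fin m → Fin n → ℚ) i → seq (∑ λ j → ∑ λ k → ⟦ P ⟧ᴹ j k ²) i ≡ ‖ P ‖²F
        ‖‖²F-seq P i = trans (seq-∑ (λ j → ∑ λ k → ⟦ P ⟧ᴹ j k ²) i) (sum-cong-≗ λ j → norm²-seq ⟦ P j ⟧ i)
        product≤ : ∀ i → seq ‖ ⟦ X ⟧ᴹ ‖F i ⊛ seq ‖ ⟦ Y ⟧ᴹ ‖F i ≼ M
        -- Both squared norms are `M`, so the two factors are the same approximant of √M and their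
        -- product is a square.
        product≤ i = subst (λ q → √-approx i (seq (∑ λ j → ∑ λ k → ⟦ X ⟧ᴹ j k ²) i Rat.⊔ 0ℚ) ⊛ √-approx i (q Rat.⊔ 0ℚ) ≼ M)
          (trans (‖‖²F-seq X i) (trans ‖X‖² (sym (trans (‖‖²F-seq Y i) ‖Y‖²))))
          (√²≤ i (trans (‖‖²F-seq X i) ‖X‖²) 0≤M)

  form-neg : ∀ (u : Vector ℚ a) (v : Vector ℚ b) P → form (λ j → ⊖ u j) v P ≡ ⊖ form u v P
  form-neg u v P = begin
    sum (λ j → ⊖ u j ⊛ w j)
      ≡⟨ sum-cong-≗ (λ j → solve 2 (λ u w → :- u :* w := (:- con 1ℚ) :* (u :* w)) refl (u j) (w j)) ⟩
    sum (λ j → ⊖ 1ℚ ⊛ (u j ⊛ w j))    ≡⟨ sym (*-distribˡ-sum (⊖ 1ℚ) (λ j → u j ⊛ w j)) ⟩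
    ⊖ 1ℚ ⊛ form u v P                 ≡⟨ solve 1 (λ p → (:- con 1ℚ) :* p := :- p) refl (form u v P) ⟩
    ⊖ form u v P                      ∎
    where
    open ≡-Reasoning
    w : Vector ℚ _
    w j = sum λ k → P j k ⊛ v k

  neg-unit : ∀ (u : Vector ℚ a) → ⟨ u , u ⟩ ≡ 1ℚ → ⟨ (λ j → ⊖ u j) , (λ j → ⊖ u j) ⟩ ≡ 1ℚ
  neg-unit u unit = trans (sum-cong-≗ λ j → solve 1 (λ p → :- p :* :- p := p :* p) refl (u j)) unit

  -- A record, so that comparing two instances never unfolds the spectral norms.
  record Approximates (ε : ℚ) (X : Matrix a N) (Y : Matrix b N)
                      (out : Σ[ m ∈ ℕ ] Matrix a m × Matrix b m) : Set where
    constructor approximates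
    field isApproximation : IsApproximation ε X Y (proj₁ (proj₂ out)) (proj₂ (proj₂ out))

  -- The bound for the first window is taken at u and that for the second at -u. At a common index
  -- the two forms of ABᵀ cancel in the sum.
  common-approximation : ∀ {X X′ : Fin a → Fin N → ℚ} {Y Y′ : Fin b → Fin N → ℚ} {M : ℚ} →
    (‖X‖² : ‖ X ‖²F ≡ M) (‖Y‖² : ‖ Y ‖²F ≡ M) (‖X′‖² : ‖ X′ ‖²F ≡ M) (‖Y′‖² : ‖ Y′ ‖²F ≡ M) →
    ∀ ε → 0ℚ ≼ ε → 0ℚ ≼ M → (out : Σ[ m ∈ ℕ ] Matrix a m × Matrix b m) →
    Approximates ε ⟦ X ⟧ᴹ ⟦ Y ⟧ᴹ out → Approximates ε ⟦ X′ ⟧ᴹ ⟦ Y′ ⟧ᴹ out →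
    ∀ u v → ⟨ u , u ⟩ ≡ 1ℚ → ⟨ v , v ⟩ ≡ 1ℚ →
    form u v (λ j k → sum λ t → X j t ⊛ Y k t) ⊝ form u v (λ j k → sum λ t → X′ j t ⊛ Y′ k t)
      ≼ ε ⊛ (Int.+ 1 Rat./ 3) ⊛ M ⊕ ε ⊛ (Int.+ 1 Rat./ 3) ⊛ M
  common-approximation {X = X} {X′} {Y} {Y′} {M} ‖X‖² ‖Y‖² ‖X′‖² ‖Y′‖² ε 0≤ε 0≤M (_ , A , B) (approximates approx) (approximates approx′) u v u-unit v-unit =
    ≤-by-slack λ η 0<η →
      let d , 0<d , d+d≡η = half 0<η
          n₁ , h₁ = approximation-bound X Y ‖X‖² ‖Y‖² ε 0≤ε 0≤M {A = A} {B} approx u v u-unit v-unit d 0<d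
          n₂ , h₂ = approximation-bound X′ Y′ ‖X′‖² ‖Y′‖² ε 0≤ε 0≤M {A = A} {B} approx′ (λ j → ⊖ u j) v (neg-unit u u-unit) v-unit d 0<d
          i = n₁ Nat.⊔ n₂
          C = λ j k → ⊖ seq ((A · transpose B) j k) i
      in begin
        form u v P ⊝ form u v P′
          ≡⟨ solve 3 (λ p q c → p :- q := p :+ c :+ (:- q :- c)) refl (form u v P) (form u v P′) (form u v C) ⟩
        form u v P ⊕ form u v C ⊕ (⊖ form u v P′ ⊝ form u v C)
          ≡⟨ cong (form u v P ⊕ form u v C ⊕_) (sym (cong₂ _⊕_ (form-neg u v P′) (form-neg u v C))) ⟩
        form u v P ⊕ form u v C ⊕ (form (λ j → ⊖ u j) v P′ ⊕ form (λ j → ⊖ u j) v C)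
          ≤⟨ +-mono-≤ (h₁ i (ℕₚ.m≤m⊔n n₁ n₂)) (h₂ i (ℕₚ.m≤n⊔m n₁ n₂)) ⟩
        e ⊕ d ⊕ (e ⊕ d)
          ≡⟨ solve 2 (λ e d → e :+ d :+ (e :+ d) := e :+ e :+ (d :+ d)) refl e d ⟩
        e ⊕ e ⊕ (d ⊕ d)
          ≡⟨ cong (e ⊕ e ⊕_) d+d≡η ⟩
        e ⊕ e ⊕ η ∎
    where
    open ≤-Reasoning
    P = λ j k → sum λ t → X j t ⊛ Y k t
    P′ = λ j k → sum λ t → X′ j t ⊛ Y′ k t
    e = ε ⊛ (Int.+ 1 Rat./ 3) ⊛ M

-- Fooling streams: the memory determines the codewords

module Fooling {S dx dy K N ρ : ℕ} {R : ℝ} {l : ℕ} {{_ : NonZero l}}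
  (F : Families.Family K (suc dx) (suc dy)) (c₀ : Fin K)
  (64^ρ≤R+1 : fromℕ (64 Nat.^ ρ) ≤ R + fromℕ 1)
  (alg : Algorithm S dx dy) (solves : SolvesSlidingWindowAMM N R (Int.1ℤ Rat./ l) alg) where

  open Rat using () renaming (_+_ to _⊕_; _*_ to _⊛_; -_ to ⊖_; _-_ to _⊝_; _≤_ to _≼_; _<_ to _≺_)
  open ℚₚ
  open ℚSolver.+-*-Solver using (solve; _:=_; _:+_; _:*_; _:-_; :-_; con)
  open Rational
  open RealLemmas using (≤ˡ; ≤ʳ)
  open Columns
  open Bilinear
  open Approximations
  open Families using (¼)
  open Families.Family F
  open Algorithm alg

  scaled : ∀ {n} → (Fin K → Vector ℚ n) → Column K → Vector ℚ n
  scaled v c j = scale c ⊛ v (proj₂ c) j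

  ⟨u,scaled⟩ : ∀ {n} (u : Vector ℚ n) v c → ⟨ u , scaled v c ⟩ ≡ scale c ⊛ ⟨ u , v (proj₂ c) ⟩
  ⟨u,scaled⟩ u v c = trans
    (sum-cong-≗ λ j → solve 3 (λ u s v → u :* (s :* v) := s :* (u :* v)) refl (u j) (scale c) (v (proj₂ c) j))
    (sym (*-distribˡ-sum (scale c) (λ j → u j ⊛ v (proj₂ c) j)))

  ⟨scaled,scaled⟩ : ∀ {n} (v : Fin K → Vector ℚ n) → (∀ c → ⟨ v c , v c ⟩ ≡ 1ℚ) →
    ∀ c → ⟨ scaled v c , scaled v c ⟩ ≡ energy c
  ⟨scaled,scaled⟩ v unit c = begin
    ⟨ scaled v c , scaled v c ⟩                          ≡⟨ ⟨u,scaled⟩ (scaled v c) v c ⟩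
    scale c ⊛ ⟨ scaled v c , v (proj₂ c) ⟩
      ≡⟨ cong (scale c ⊛_) (trans (⟨,⟩-comm (scaled v c) (v (proj₂ c))) (⟨u,scaled⟩ (v (proj₂ c)) v c)) ⟩
    scale c ⊛ (scale c ⊛ ⟨ v (proj₂ c) , v (proj₂ c) ⟩)  ≡⟨ cong (λ z → scale c ⊛ (scale c ⊛ z)) (unit (proj₂ c)) ⟩
    scale c ⊛ (scale c ⊛ 1ℚ)                             ≡⟨ trans (cong (scale c ⊛_) (*-identityʳ (scale c))) (scale² c) ⟩
    energy c                                             ∎
    where open ≡-Reasoning

  ⅓ ¾ 1/12 : ℚ
  ⅓ = Int.+ 1 Rat./ 3
  ¾ = Int.+ 3 Rat./ 4
  1/12 = Int.+ 1 Rat./ 12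

  toPair : Column K → Vector ℝ (suc dx) × Vector ℝ (suc dy)
  toPair c = ⟦ scaled x c ⟧ , ⟦ scaled y c ⟧

  filler : Column K
  filler = 0 , c₀

  toStream : List (Column K) → Stream dx dy
  toStream L t = toPair (at filler L t)

  Low : Column K → Set
  Low (e , _) = e Nat.≤ ρ

  -- The upper bound is exact because roots round down. Below, r + τ ≥ 1 gives r² ≥ (1 - τ)² ≥ 1 -
  -- 2τ.
  norm-inRange : ∀ {n} e (v : Vector ℚ n) → e Nat.≤ ρ → ⟨ v , v ⟩ ≡ ι (64 Nat.^ e) →
    fromℕ 1 ≤ ‖ ⟦ v ⟧ ‖ ² × ‖ ⟦ v ⟧ ‖ ² ≤ R + fromℕ 1
  norm-inRange e v e≤ρ ⟨v,v⟩≡ = lower , upper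
    where
    open ≤-Reasoning
    E = ι (64 Nat.^ e)
    q τ : ℕ → ℚ
    q i = seq (∑ λ j → ⟦ v ⟧ j ²) i
    τ i = Int.+ 1 Rat./ suc i
    q≡E : ∀ i → q i ≡ E
    q≡E i = trans (norm²-seq ⟦ v ⟧ i) ⟨v,v⟩≡
    1≤r+τ : ∀ i → 1ℚ ≼ seq ‖ ⟦ v ⟧ ‖ i ⊕ τ i
    1≤r+τ i = square-cancel-≤ (+-nonNeg (√-approx≥0 i (q i Rat.⊔ 0ℚ)) (nonNegative⁻¹ (τ i) {{normalize-nonNeg 1 (suc i)}})) (begin
      1ℚ                                                      ≤⟨ ι-mono-≤ (ℕₚ.m^n>0 64 e) ⟩
      E                                                       ≡⟨ sym (q≡E i) ⟩
      q i                                                     ≤⟨ p≤p⊔q (q i) 0ℚ ⟩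
      q i Rat.⊔ 0ℚ                                            ≤⟨ √-Approx.upper i (q i Rat.⊔ 0ℚ) (p≤q⊔p (q i) 0ℚ) ⟩
      (seq ‖ ⟦ v ⟧ ‖ i ⊕ τ i) ⊛ (seq ‖ ⟦ v ⟧ ‖ i ⊕ τ i)       ∎)
    lower : fromℕ 1 ≤ ‖ ⟦ v ⟧ ‖ ²
    lower ε 0<ε =
      let d , 0<d , d+d≡ε = half 0<ε
          n₁ , small₁ = archimedean 0<d
          -- Ensures τ ≤ 1, so that 1 - τ ≤ r may be squared.
          n₂ , small₂ = archimedean (0<ι 1)
      in n₁ Nat.⊔ n₂ , λ i p →
        let r = seq ‖ ⟦ v ⟧ ‖ i
            1-τ≤r : 1ℚ ⊝ τ i ≼ r
            1-τ≤r = begin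
              1ℚ ⊝ τ i           ≤⟨ +-monoˡ-≤ (⊖ τ i) (1≤r+τ i) ⟩
              r ⊕ τ i ⊝ τ i      ≡⟨ solve 2 (λ r τ → r :+ τ :- τ := r) refl r (τ i) ⟩
              r                  ∎
            0≤1-τ : 0ℚ ≼ 1ℚ ⊝ τ i
            0≤1-τ = subst (_≼ 1ℚ ⊝ τ i) (+-inverseʳ (τ i)) (+-monoˡ-≤ (⊖ τ i) (small₂ i (≤ʳ n₁ p)))
        in begin
        1ℚ
          ≡⟨ solve 1 (λ τ → con 1ℚ := (con 1ℚ :- τ) :* (con 1ℚ :- τ) :+ (τ :+ τ) :- τ :* τ) refl (τ i) ⟩
        (1ℚ ⊝ τ i) ⊛ (1ℚ ⊝ τ i) ⊕ (τ i ⊕ τ i) ⊝ τ i ⊛ τ i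
                                                      ≤⟨ +-monoʳ-≤ ((1ℚ ⊝ τ i) ⊛ (1ℚ ⊝ τ i) ⊕ (τ i ⊕ τ i)) (neg-antimono-≤ (*-nonNeg (0≤τ i) (0≤τ i))) ⟩
        (1ℚ ⊝ τ i) ⊛ (1ℚ ⊝ τ i) ⊕ (τ i ⊕ τ i) ⊕ 0ℚ    ≡⟨ +-identityʳ _ ⟩
        (1ℚ ⊝ τ i) ⊛ (1ℚ ⊝ τ i) ⊕ (τ i ⊕ τ i)
          ≤⟨ +-mono-≤ (*-mono 0≤1-τ (√-approx≥0 i (q i Rat.⊔ 0ℚ)) 1-τ≤r 1-τ≤r) (+-mono-≤ (small₁ i (≤ˡ n₁ p)) (small₁ i (≤ˡ n₁ p))) ⟩
        r ⊛ r ⊕ (d ⊕ d)                               ≡⟨ cong (r ⊛ r ⊕_) d+d≡ε ⟩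
        r ⊛ r ⊕ ε                                     ∎
      where
      0≤τ : ∀ i → 0ℚ ≼ τ i
      0≤τ i = nonNegative⁻¹ (τ i) {{normalize-nonNeg 1 (suc i)}}
    upper : ‖ ⟦ v ⟧ ‖ ² ≤ R + fromℕ 1
    upper ε 0<ε = let n , h = 64^ρ≤R+1 ε 0<ε in n , λ i p → begin
      seq (‖ ⟦ v ⟧ ‖ ²) i      ≤⟨ √²≤ i (q≡E i) (0≤ι (64 Nat.^ e)) ⟩
      E                        ≤⟨ ι-mono-≤ (ℕₚ.^-monoʳ-≤ 64 e≤ρ) ⟩
      ι (64 Nat.^ ρ)           ≤⟨ h i p ⟩
      seq (R + fromℕ 1) i ⊕ ε  ∎

  toStream-admissible : ∀ L → All Low L → AdmissibleStream N R (toStream L)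
  toStream-admissible L low T _ j =
    norm-inRange (proj₁ c) (scaled x c) c-low (⟨scaled,scaled⟩ x x-unit c) ,
    norm-inRange (proj₁ c) (scaled y c) c-low (⟨scaled,scaled⟩ y y-unit c)
    where
    c = at filler L (T Nat.∸ N Nat.+ toℕ j)
    at-low : ∀ {L} → All Low L → ∀ t → Low (at filler L t)
    at-low []       _       = z≤n
    at-low (p ∷ ps) zero    = p
    at-low (p ∷ ps) (suc t) = at-low ps t
    c-low : Low c
    c-low = at-low low (T Nat.∸ N Nat.+ toℕ j)

  memory-agree : ∀ (s s′ : Stream dx dy) {t₀} → (∀ n → s (n Nat.+ t₀) ≡ s′ (n Nat.+ t₀)) →
    memory s t₀ ≡ memory s′ t₀ → ∀ n → memory s (n Nat.+ t₀) ≡ memory s′ (n Nat.+ t₀)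
  memory-agree s s′ agree eq zero    = eq
  memory-agree s s′ agree eq (suc n) =
    cong₂ (λ m p → update m (proj₁ p) (proj₂ p)) (memory-agree s s′ agree eq n) (agree n)

  approximates-window : ∀ stream → AdmissibleStream N R stream → ∀ T → N Nat.≤ T →
    Approximates (Int.1ℤ Rat./ l) (X-window stream N T) (Y-window stream N T) (output (memory stream T))
  approximates-window stream admissible T N≤T = approximates (solves stream admissible T N≤T)

  -- `L′` is what remains of `L` at time T after the columns older than the window are dropped.
  module Window (L : List (Column K)) (T : ℕ) {L′ : List (Column K)}
    (shift : ∀ t → at filler L (T Nat.∸ N Nat.+ t) ≡ at filler L′ t) where

    col : Fin N → Column K
    col t = at filler L (T Nat.∸ N Nat.+ toℕ t)

    X : Fin (suc dx) → Fin N → ℚ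
    X j t = scaled x (col t) j

    Y : Fin (suc dy) → Fin N → ℚ
    Y j t = scaled y (col t) j

    ‖scaled‖² : ∀ {n} (v : Fin K → Vector ℚ n) → (∀ c → ⟨ v c , v c ⟩ ≡ 1ℚ) →
      ‖ (λ j t → scaled v (col t) j) ‖²F ≡ sum {N} (λ t → energy (at filler L′ (toℕ t)))
    ‖scaled‖² v unit = begin
      ‖ (λ j t → scaled v (col t) j) ‖²F                  ≡⟨ ∑-comm {n = N} (λ j t → scaled v (col t) j ⊛ scaled v (col t) j) ⟩
      sum {N} (λ t → ⟨ scaled v (col t) , scaled v (col t) ⟩)
        ≡⟨ sum-cong-≗ (λ t → trans (⟨scaled,scaled⟩ v unit (col t)) (cong energy (shift (toℕ t)))) ⟩
      sum {N} (λ t → energy (at filler L′ (toℕ t)))           ∎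
      where open ≡-Reasoning

    form-window : ∀ u v → form u v (λ j k → sum λ t → X j t ⊛ Y k t) ≡
      sum {N} (λ t → Difference.f (λ c → ⟨ u , x c ⟩ ⊛ ⟨ v , y c ⟩) (at filler L′ (toℕ t)))
    form-window u v = trans (form-product u v X Y) (sum-cong-≗ λ t → trans (step (col t)) (cong f (shift (toℕ t))))
      where
      open ≡-Reasoning
      open Difference (λ c → ⟨ u , x c ⟩ ⊛ ⟨ v , y c ⟩) using (f)
      step : ∀ c → ⟨ u , scaled x c ⟩ ⊛ ⟨ v , scaled y c ⟩ ≡ f c
      step c = begin
        ⟨ u , scaled x c ⟩ ⊛ ⟨ v , scaled y c ⟩
          ≡⟨ cong₂ _⊛_ (⟨u,scaled⟩ u x c) (⟨u,scaled⟩ v y c) ⟩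
        scale c ⊛ ⟨ u , x (proj₂ c) ⟩ ⊛ (scale c ⊛ ⟨ v , y (proj₂ c) ⟩)
          ≡⟨ solve 3 (λ s g h → s :* g :* (s :* h) := s :* s :* (g :* h)) refl (scale c) ⟨ u , x (proj₂ c) ⟩ ⟨ v , y (proj₂ c) ⟩ ⟩
        scale c ⊛ scale c ⊛ (⟨ u , x (proj₂ c) ⟩ ⊛ ⟨ v , y (proj₂ c) ⟩)
          ≡⟨ cong (_⊛ (⟨ u , x (proj₂ c) ⟩ ⊛ ⟨ v , y (proj₂ c) ⟩)) (scale² c) ⟩
        f c ∎

  -- Once everything before the block has expired, the two windows differ in this block only.
  module FirstBlock (n b e : ℕ) (bs : Blocks) (w : Vec (Fin K) (length bs)) (size≤N : b Nat.+ size bs Nat.≤ N) where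

    s T μ M : ℕ
    s = b Nat.+ size bs
    T = n Nat.+ N
    μ = b Nat.* 64 Nat.^ e
    M = N Nat.+ excess ((b , e) ∷ bs)

    Λ : Fin K → List (Column K)
    Λ c = layout ((b , e) ∷ bs) (c ∷ w)

    ε : ℚ
    ε = Int.1ℤ Rat./ l

    0≤ε : 0ℚ ≼ ε
    0≤ε = nonNegative⁻¹ ε {{normalize-nonNeg 1 l}}

    εl≡1 : ε ⊛ ι l ≡ 1ℚ
    εl≡1 = go l
      where
      go : ∀ l .{{_ : NonZero l}} → (Int.1ℤ Rat./ l) ⊛ ι l ≡ 1ℚ
      go (suc l) = /-*-ι 1 l

    shift : ∀ P c → length P ≡ n → ∀ t → at filler (P ++ Λ c) (T Nat.∸ N Nat.+ t) ≡ at filler (Λ c) t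
    shift P c P≡n t = trans
      (cong (λ k → at filler (P ++ Λ c) (k Nat.+ t)) (trans (ℕₚ.m+n∸n≡m n N) (sym P≡n)))
      (at-++ filler P (Λ c) t)

    beyond : ∀ P c → length P ≡ n → ∀ k → at filler (P ++ Λ c) (k Nat.+ (n Nat.+ s)) ≡ filler
    beyond P c P≡n k = at-beyond filler (P ++ Λ c) (subst (Nat._≤ k Nat.+ (n Nat.+ s))
      (sym (trans (length-++ P) (cong₂ Nat._+_ P≡n (length-layout ((b , e) ∷ bs) (c ∷ w))))) (ℕₚ.m≤n+m (n Nat.+ s) k))

    -- After their blocks both streams continue with the same `N ∸ s` filler columns, so the
    -- memories stay equal until the prefixes `P` and `P′` have left the window.
    same-later : ∀ P P′ c c′ → length P ≡ n → length P′ ≡ n →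
      memory (toStream (P ++ Λ c)) (n Nat.+ s) ≡ memory (toStream (P′ ++ Λ c′)) (n Nat.+ s) →
      memory (toStream (P ++ Λ c)) T ≡ memory (toStream (P′ ++ Λ c′)) T
    same-later P P′ c c′ P≡n P′≡n same =
      subst (λ t → memory (toStream (P ++ Λ c)) t ≡ memory (toStream (P′ ++ Λ c′)) t) later
        (memory-agree (toStream (P ++ Λ c)) (toStream (P′ ++ Λ c′))
          (λ k → cong toPair (trans (beyond P c P≡n k) (sym (beyond P′ c′ P′≡n k)))) same (N Nat.∸ s))
      where
      later : N Nat.∸ s Nat.+ (n Nat.+ s) ≡ T
      later = trans (ℕₚ.+-comm (N Nat.∸ s) (n Nat.+ s))
        (trans (ℕₚ.+-assoc n s (N Nat.∸ s)) (cong (n Nat.+_) (ℕₚ.m+[n∸m]≡n size≤N)))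

    -- The origin of 8 and 9: 2 M / 3l = 8 M / 12 l, and 9/12 = 3/4.
    bound : 8 Nat.* M Nat.≤ 9 Nat.* (l Nat.* μ) → ε ⊛ ⅓ ⊛ ι M ⊕ ε ⊛ ⅓ ⊛ ι M ≼ ¾ ⊛ ι μ
    bound gap = begin
      ε ⊛ ⅓ ⊛ ι M ⊕ ε ⊛ ⅓ ⊛ ι M
        ≡⟨ solve 2 (λ ε m → ε :* con ⅓ :* m :+ ε :* con ⅓ :* m := con 1/12 :* (ε :* (con (ι 8) :* m))) refl ε (ι M) ⟩
      1/12 ⊛ (ε ⊛ (ι 8 ⊛ ι M))          ≤⟨ *-monoˡ (nonNegative⁻¹ 1/12) (*-monoˡ 0≤ε (subst₂ _≼_ (ι-* 8 M) 9lμ (ι-mono-≤ gap))) ⟩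
      1/12 ⊛ (ε ⊛ (ι 9 ⊛ (ι l ⊛ ι μ)))
        ≡⟨ solve 3 (λ ε l m → con 1/12 :* (ε :* (con (ι 9) :* (l :* m))) := con ¾ :* ((ε :* l) :* m)) refl ε (ι l) (ι μ) ⟩
      ¾ ⊛ (ε ⊛ ι l ⊛ ι μ)               ≡⟨ cong (λ z → ¾ ⊛ (z ⊛ ι μ)) εl≡1 ⟩
      ¾ ⊛ (1ℚ ⊛ ι μ)                    ≡⟨ cong (¾ ⊛_) (*-identityˡ (ι μ)) ⟩
      ¾ ⊛ ι μ                           ∎
      where
      open ≤-Reasoning
      9lμ : ι (9 Nat.* (l Nat.* μ)) ≡ ι 9 ⊛ (ι l ⊛ ι μ)
      9lμ = trans (ι-* 9 (l Nat.* μ)) (cong (ι 9 ⊛_) (ι-* l μ))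

    module Pair {c c′ : Fin K} (P P′ : List (Column K)) (P≡n : length P ≡ n) (P′≡n : length P′ ≡ n) where

      L L′ : List (Column K)
      L  = P ++ Λ c
      L′ = P′ ++ Λ c′

      module W  = Window L T {Λ c} (shift P c P≡n)
      module W′ = Window L′ T {Λ c′} (shift P′ c′ P′≡n)

      G : Fin K → ℚ
      G d = ⟨ x c , x d ⟩ ⊛ ⟨ y c , y d ⟩

      Δ : ℚ
      Δ = form (x c) (y c) (λ j k → sum λ t → W.X j t ⊛ W.Y k t) ⊝
          form (x c) (y c) (λ j k → sum λ t → W′.X j t ⊛ W′.Y k t)

      large : NonZero b → c ≢ c′ → ¾ ⊛ ι μ ≺ Δ
      large b≢0 c≢c′ = begin-strict
        ¾ ⊛ ι μ               ≡⟨ *-comm ¾ (ι μ) ⟩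
        ι μ ⊛ (1ℚ ⊝ ¼)
          <⟨ *-monoʳ-<-pos (ι μ) {{Rat.positive (0<ι μ {{ℕₚ.m*n≢0 b (64 Nat.^ e) {{b≢0}} {{ℕₚ.m^n≢0 64 e}}}})}} (+-monoʳ-< 1ℚ (neg-antimono-< (separated c≢c′))) ⟩
        ι μ ⊛ (1ℚ ⊝ G c′)     ≡⟨ cong (λ z → ι μ ⊛ (z ⊝ G c′)) (sym (cong₂ _⊛_ (x-unit c) (y-unit c))) ⟩
        ι μ ⊛ (G c ⊝ G c′)    ≡⟨ sym (Difference.sum-first G bs w c₀ size≤N) ⟩
        _                     ≡⟨ sym (cong₂ _⊝_ (W.form-window (x c) (y c)) (W′.form-window (x c) (y c))) ⟩
        Δ                     ∎
        where open ≤-Reasoning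

      small : All Low L → All Low L′ → memory (toStream L) (n Nat.+ s) ≡ memory (toStream L′) (n Nat.+ s) →
        Δ ≼ ε ⊛ ⅓ ⊛ ι M ⊕ ε ⊛ ⅓ ⊛ ι M
      small low low′ same =
        common-approximation {X = W.X} {W′.X} {W.Y} {W′.Y} {ι M}
          (trans (W.‖scaled‖² x x-unit) mass) (trans (W.‖scaled‖² y y-unit) mass)
          (trans (W′.‖scaled‖² x x-unit) mass′) (trans (W′.‖scaled‖² y y-unit) mass′)
          ε 0≤ε (0≤ι M) (output (memory (toStream L) T))
          (approximates-window (toStream L) (toStream-admissible L low) T N≤T)
          (subst (λ m → Approximates ε (X-window (toStream L′) N T) (Y-window (toStream L′) N T) (output m))
            (sym (same-later P P′ c c′ P≡n P′≡n same))
            (approximates-window (toStream L′) (toStream-admissible L′ low′) T N≤T))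
          (x c) (y c) (x-unit c) (y-unit c)
        where
        N≤T = ℕₚ.m≤n+m N n
        mass  = sum-energy ((b , e) ∷ bs) (c ∷ w) c₀ size≤N
        mass′ = sum-energy ((b , e) ∷ bs) (c′ ∷ w) c₀ size≤N

      equal : NonZero b → 8 Nat.* M Nat.≤ 9 Nat.* (l Nat.* μ) → All Low L → All Low L′ →
        memory (toStream L) (n Nat.+ s) ≡ memory (toStream L′) (n Nat.+ s) → c ≡ c′
      equal b≢0 gap low low′ same = decidable-stable (c Finₚ.≟ c′) λ c≢c′ →
        <-irrefl refl (<-≤-trans (large b≢0 c≢c′) (≤-trans (small low low′ same) (bound gap)))

  layout-low : ∀ {bs} (w : Vec (Fin K) (length bs)) → Feasible N l ρ bs → All Low (layout bs w)
  layout-low []      []                  = []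
  layout-low (c ∷ w) (add {b} _ e≤ρ _ f) = Allₚ.++⁺ (Allₚ.replicate⁺ b e≤ρ) (layout-low w f)

  -- The codewords are recovered from the newest block backwards. For the later ones the first block
  -- is moved into the prefix, and two prefixes may differ because older codewords have not yet been
  -- compared; only then is the first block itself decided.
  memory-injective : ∀ {n bs} → Feasible N l ρ bs → size bs Nat.≤ N →
    ∀ (P P′ : List (Column K)) (w w′ : Vec (Fin K) (length bs)) →
    length P ≡ n → length P′ ≡ n → All Low P → All Low P′ →
    memory (toStream (P ++ layout bs w)) (n Nat.+ size bs) ≡ memory (toStream (P′ ++ layout bs w′)) (n Nat.+ size bs) →
    w ≡ w′
  memory-injective [] _ P P′ [] [] _ _ _ _ _ = refl
  memory-injective {n} {(b , e) ∷ bs} f₀@(add b≢0 e≤ρ gap f) size≤N P P′ (c ∷ w) (c′ ∷ w′) P≡n P′≡n low low′ same =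
    step (memory-injective f (ℕₚ.m+n≤o⇒n≤o b size≤N) (P ++ replicate b (e , c)) (P′ ++ replicate b (e , c′)) w w′
      (longer P c P≡n) (longer P′ c′ P′≡n) (Allₚ.++⁺ low (Allₚ.replicate⁺ b e≤ρ)) (Allₚ.++⁺ low′ (Allₚ.replicate⁺ b e≤ρ))
      (longer-same (++-assoc P (replicate b (e , c)) (layout bs w)) (++-assoc P′ (replicate b (e , c′)) (layout bs w′)) (ℕₚ.+-assoc n b (size bs)) same))
    where
    longer : ∀ P c → length P ≡ n → length (P ++ replicate b (e , c)) ≡ n Nat.+ b
    longer P c P≡n = trans (length-++ P) (cong₂ Nat._+_ P≡n (length-replicate b))
    longer-same : ∀ {L₁ L₂ L₁′ L₂′ t₁ t₂} → L₁ ≡ L₂ → L₁′ ≡ L₂′ → t₁ ≡ t₂ →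
      memory (toStream L₂) t₂ ≡ memory (toStream L₂′) t₂ → memory (toStream L₁) t₁ ≡ memory (toStream L₁′) t₁
    longer-same refl refl refl eq = eq
    step : w ≡ w′ → c ∷ w ≡ c′ ∷ w′
    step refl = cong (_∷ w) (FirstBlock.Pair.equal n b e bs w size≤N P P′ P≡n P′≡n b≢0 gap
      (Allₚ.++⁺ low (layout-low (c ∷ w) f₀)) (Allₚ.++⁺ low′ (layout-low (c′ ∷ w) f₀)) same)

-- Logarithms and powers of two

module Logarithms where

  open Rat using () renaming (_+_ to _⊕_; _*_ to _⊛_; -_ to ⊖_; _-_ to _⊝_; _≤_ to _≼_; _<_ to _≺_)
  open ℚₚ
  open ℚSolver.+-*-Solver using (solve; _:=_; _:+_; _:*_; _:-_; :-_; con)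
  open Rational

  2^-cancel-≤ : ∀ {m n} → 2 Nat.^ m Nat.< 2 Nat.^ suc n → m Nat.≤ n
  2^-cancel-≤ lt = ℕₚ.≮⇒≥ λ n<m → ℕₚ.<⇒≱ lt (ℕₚ.^-monoʳ-≤ 2 n<m)

  [2^a*b]^K : ∀ a b K → (2 Nat.^ a Nat.* b) Nat.^ K ≡ 2 Nat.^ (a Nat.* K) Nat.* b Nat.^ K
  [2^a*b]^K a b K = trans (Natural.^-distrib-* (2 Nat.^ a) b K) (cong (Nat._* b Nat.^ K) (ℕₚ.^-*-assoc 2 a K))

  -- The factor 2^a, raised to the power K, shifts the floor by exactly a K, so nothing is lost to
  -- rounding. Used with n / b a rational in lowest terms.
  ⌊log₂⌋-≤ : ∀ n b a K → .{{_ : NonZero n}} → n Nat.≤ 2 Nat.^ a Nat.* b →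
    ⌊log₂ n Nat.^ K ⌋ Nat.≤ a Nat.* K Nat.+ ⌊log₂ b Nat.^ K ⌋
  ⌊log₂⌋-≤ n b a K n≤ = 2^-cancel-≤ (begin-strict
    2 Nat.^ ⌊log₂ n Nat.^ K ⌋                                      ≤⟨ Natural.2^⌊log₂n⌋≤n (n Nat.^ K) {{ℕₚ.m^n≢0 n K}} ⟩
    n Nat.^ K                                                      ≤⟨ ℕₚ.^-monoˡ-≤ K n≤ ⟩
    (2 Nat.^ a Nat.* b) Nat.^ K                                    ≡⟨ [2^a*b]^K a b K ⟩
    2 Nat.^ (a Nat.* K) Nat.* b Nat.^ K
      <⟨ ℕₚ.*-monoʳ-< (2 Nat.^ (a Nat.* K)) {{ℕₚ.m^n≢0 2 (a Nat.* K)}} (Natural.n<2^[1+⌊log₂n⌋] (b Nat.^ K)) ⟩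
    2 Nat.^ (a Nat.* K) Nat.* 2 Nat.^ suc ⌊log₂ b Nat.^ K ⌋
      ≡⟨ sym (ℕₚ.^-distribˡ-+-* 2 (a Nat.* K) (suc ⌊log₂ b Nat.^ K ⌋)) ⟩
    2 Nat.^ (a Nat.* K Nat.+ suc ⌊log₂ b Nat.^ K ⌋)                ≡⟨ cong (2 Nat.^_) (ℕₚ.+-suc (a Nat.* K) ⌊log₂ b Nat.^ K ⌋) ⟩
    2 Nat.^ suc (a Nat.* K Nat.+ ⌊log₂ b Nat.^ K ⌋)                ∎)
    where open ℕₚ.≤-Reasoning

  ⌊log₂⌋-≥ : ∀ n b a K → .{{_ : NonZero b}} → 2 Nat.^ a Nat.* b Nat.≤ n →
    a Nat.* K Nat.+ ⌊log₂ b Nat.^ K ⌋ Nat.≤ ⌊log₂ n Nat.^ K ⌋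
  ⌊log₂⌋-≥ n b a K ≤n = 2^-cancel-≤ (begin-strict
    2 Nat.^ (a Nat.* K Nat.+ ⌊log₂ b Nat.^ K ⌋)               ≡⟨ ℕₚ.^-distribˡ-+-* 2 (a Nat.* K) ⌊log₂ b Nat.^ K ⌋ ⟩
    2 Nat.^ (a Nat.* K) Nat.* 2 Nat.^ ⌊log₂ b Nat.^ K ⌋
      ≤⟨ ℕₚ.*-monoʳ-≤ (2 Nat.^ (a Nat.* K)) (Natural.2^⌊log₂n⌋≤n (b Nat.^ K) {{ℕₚ.m^n≢0 b K}}) ⟩
    2 Nat.^ (a Nat.* K) Nat.* b Nat.^ K                       ≡⟨ sym ([2^a*b]^K a b K) ⟩
    (2 Nat.^ a Nat.* b) Nat.^ K                               ≤⟨ ℕₚ.^-monoˡ-≤ K ≤n ⟩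
    n Nat.^ K                                                 <⟨ Natural.n<2^[1+⌊log₂n⌋] (n Nat.^ K) ⟩
    2 Nat.^ suc ⌊log₂ n Nat.^ K ⌋                             ∎)
    where open ℕₚ.≤-Reasoning

  module _ (k : ℕ) (q : ℚ) (0<q : 0ℚ ≺ q) (a : ℕ) where

    open ≤-Reasoning

    private
      K = suc k
      A = ⌊log₂ num q Nat.^ K ⌋
      B = ⌊log₂ ↧ₙ q Nat.^ K ⌋

      log*K : log₂-approx k q ⊛ ι K ≡ ι A ⊝ ι B
      log*K = begin-equality
        log₂-approx k q ⊛ ι K     ≡⟨ cong (_⊛ ι K) (log₂-approx-def k q) ⟩
        (α ⊝ β) ⊛ ι K             ≡⟨ solve 3 (λ α β K → (α :- β) :* K := α :* K :- β :* K) refl α β (ι K) ⟩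
        α ⊛ ι K ⊝ β ⊛ ι K         ≡⟨ cong₂ _⊝_ (/-*-ι A k) (/-*-ι B k) ⟩
        ι A ⊝ ι B                 ∎
        where
        α = Int.+ A Rat./ K
        β = Int.+ B Rat./ K

      a*K : ι (a Nat.* K Nat.+ B) ⊝ ι B ≡ ι a ⊛ ι K
      a*K = trans (cong (_⊝ ι B) (trans (ι-+ (a Nat.* K) B) (cong (_⊕ ι B) (ι-* a K))))
        (solve 2 (λ x b → x :+ b :- b := x) refl (ι a ⊛ ι K) (ι B))

      scaled-num : ι (2 Nat.^ a Nat.* ↧ₙ q) ≡ ι (2 Nat.^ a) ⊛ ι (↧ₙ q)
      scaled-num = ι-* (2 Nat.^ a) (↧ₙ q)

    log₂-approx≤ : q ≼ ι (2 Nat.^ a) → log₂-approx k q ≼ ι a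
    log₂-approx≤ q≤2^a = *-cancelʳ (0<ι K) (begin
      log₂-approx k q ⊛ ι K                 ≡⟨ log*K ⟩
      ι A ⊝ ι B                             ≤⟨ +-monoˡ-≤ (⊖ ι B) (ι-mono-≤ (⌊log₂⌋-≤ (num q) (↧ₙ q) a K {{num≢0 q 0<q}} num≤)) ⟩
      ι (a Nat.* K Nat.+ B) ⊝ ι B           ≡⟨ a*K ⟩
      ι a ⊛ ι K                             ∎)
      where
      num≤ : num q Nat.≤ 2 Nat.^ a Nat.* ↧ₙ q
      num≤ = ι-cancel-≤ (subst₂ _≼_ (num/den q (<⇒≤ 0<q)) (sym scaled-num) (*-monoʳ (0≤ι (↧ₙ q)) q≤2^a))

    log₂-approx≥ : ι (2 Nat.^ a) ≼ q → ι a ≼ log₂-approx k q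
    log₂-approx≥ 2^a≤q = *-cancelʳ (0<ι K) (begin
      ι a ⊛ ι K                             ≡⟨ sym a*K ⟩
      ι (a Nat.* K Nat.+ B) ⊝ ι B           ≤⟨ +-monoˡ-≤ (⊖ ι B) (ι-mono-≤ (⌊log₂⌋-≥ (num q) (↧ₙ q) a K ≤num)) ⟩
      ι A ⊝ ι B                             ≡⟨ sym log*K ⟩
      log₂-approx k q ⊛ ι K                 ∎)
      where
      ≤num : 2 Nat.^ a Nat.* ↧ₙ q Nat.≤ num q
      ≤num = ι-cancel-≤ (subst₂ _≼_ (sym scaled-num) (num/den q (<⇒≤ 0<q)) (*-monoʳ (0≤ι (↧ₙ q)) 2^a≤q))

  -- Downward search from the exponent `suc (num q)`, which is large enough as q ≤ `num q` and n ≤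
  -- g^n.
  bracket : ∀ g → 2 Nat.≤ g → ∀ q → 0ℚ ≺ q →
    q ≼ ι (g Nat.^ 1) ⊎ (∃[ r ] ι (g Nat.^ suc r) ≼ q × q ≼ ι (g Nat.^ suc (suc r)))
  bracket g@(suc _) 2≤g q 0<q = search (num q) (begin
    q                          ≡⟨ sym (*-identityʳ q) ⟩
    q ⊛ 1ℚ                     ≤⟨ *-monoˡ (<⇒≤ 0<q) (ι-mono-≤ {1} {↧ₙ q} (s≤s z≤n)) ⟩
    q ⊛ ι (↧ₙ q)               ≡⟨ num/den q (<⇒≤ 0<q) ⟩
    ι (num q)                  ≤⟨ ι-mono-≤ (ℕₚ.≤-trans (n≤g^n (num q)) (ℕₚ.^-monoʳ-≤ g (ℕₚ.n≤1+n (num q)))) ⟩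
    ι (g Nat.^ suc (num q))    ∎)
    where
    open ≤-Reasoning
    n≤g^n : ∀ n → n Nat.≤ g Nat.^ n
    n≤g^n zero    = z≤n
    n≤g^n (suc n) = ℕₚ.≤-trans (ℕₚ.+-mono-≤ (ℕₚ.m^n>0 g n) (n≤g^n n))
      (ℕₚ.≤-trans (ℕₚ.+-monoʳ-≤ (g Nat.^ n) (ℕₚ.m≤m+n (g Nat.^ n) 0)) (ℕₚ.*-monoˡ-≤ (g Nat.^ n) 2≤g))
    search : ∀ n → q ≼ ι (g Nat.^ suc n) → q ≼ ι (g Nat.^ 1) ⊎ (∃[ r ] ι (g Nat.^ suc r) ≼ q × q ≼ ι (g Nat.^ suc (suc r)))
    search zero    q≤ = inj₁ q≤
    search (suc n) q≤ with ≤-total q (ι (g Nat.^ suc n))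
    ... | inj₁ q≤′ = search n q≤′
    ... | inj₂ ≤q  = inj₂ (n , ≤q , q≤)

module Constant where

  open ℚₚ
  open Rational

  opaque

    -- 288 from the rate of the code, 3 from l ≤ 3 p and 13 from R ≤ 2^(13 ρ).
    C : ℕ
    C = 39 Nat.* 288

    c : ℚ
    c = Int.+ 1 Rat./ 11232

    C-factors : ∀ S → 39 Nat.* (288 Nat.* S) ≡ C Nat.* S
    C-factors S = sym (ℕₚ.*-assoc 39 288 S)

    0<c : 0ℚ Rat.< c
    0<c = positive⁻¹ c

    c*C≡1 : c Rat.* ι C ≡ 1ℚ
    c*C≡1 = refl

-- The space bound: choice of the design according to R and N

module LowerBound {dx dy l N S : ℕ} {{_ : NonZero l}} (R : ℝ) (R>0 : Positive R)
  (alg : Algorithm S dx dy) (solves : SolvesSlidingWindowAMM N R (Int.1ℤ Rat./ l) alg)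
  (large : fromℚ ½ * fromℕ l * log₂ (R * fromℕ l) (*-positive R>0 (fromℕ-positive l)) ≤ fromℕ N) where

  open Rat using () renaming (_+_ to _⊕_; _*_ to _⊛_; -_ to ⊖_; _-_ to _⊝_; _≤_ to _≼_; _<_ to _≺_)
  open ℚₚ
  open ℚSolver.+-*-Solver using (solve; _:=_; _:+_; _:*_; _:-_; :-_; con)
  open Rational
  open RealLemmas using (≤ˡ; ≤ʳ)
  open Logarithms
  open Columns using (size)
  open Constant
  open Designs using (multiplicity)

  open Positive R>0 using (bound; 0<bound; from; bound≤)

  0<R : ∀ i → from Nat.≤ i → 0ℚ ≺ seq R i
  0<R i i≥ = <-≤-trans 0<bound (bound≤ i i≥)

  p : ℕ
  p = multiplicity l

  module _ (k : ℕ) {ρ : ℕ} {bs : Columns.Blocks} (F : Families.Family (2 Nat.^ k) (suc dx) (suc dy))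
    (bound : fromℕ (64 Nat.^ ρ) ≤ R + fromℕ 1) (feasible : Feasible N l ρ bs) (size≤N : size bs Nat.≤ N) where

    private module F = Fooling {S} {dx} {dy} {2 Nat.^ k} {N} {ρ} {R} {l} F (fromℕ< (ℕₚ.m^n>0 2 k)) bound alg solves

    remember : Vec (Fin (2 Nat.^ k)) (length bs) → Vec Bool S
    remember w = Algorithm.memory alg (F.toStream (Columns.layout bs w)) (size bs)

    remember-injective : Injective _≡_ _≡_ remember
    remember-injective {w} {w′} = F.memory-injective feasible size≤N [] [] w w′ refl refl [] []

    k*blocks≤S : k Nat.* length bs Nat.≤ S
    k*blocks≤S = Counting.injection⇒≤ {k} {length bs} {S} remember remember-injective

  space : ∀ {ρ bs} → fromℕ (64 Nat.^ ρ) ≤ R + fromℕ 1 → Feasible N l ρ bs → size bs Nat.≤ N →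
    (dx Nat.+ dy) Nat.* length bs Nat.≤ 288 Nat.* S
  space {ρ} {bs} bound feasible size≤N with dx Nat.+ dy ℕₚ.≟ 0
  ... | yes d≡0 = subst (λ d → d Nat.* length bs Nat.≤ 288 Nat.* S) (sym d≡0) z≤n
  ... | no  d≢0 =
    let k , F , d≤ = Families.family dx dy (ℕₚ.n≢0⇒n>0 d≢0)
    in scale-≤ 288 k d≤ (k*blocks≤S k F bound feasible size≤N)
    where
    open ℕₚ.≤-Reasoning
    scale-≤ : ∀ a k {d m S} → d Nat.≤ a Nat.* k → k Nat.* m Nat.≤ S → d Nat.* m Nat.≤ a Nat.* S
    scale-≤ a k {d} {m} {S} d≤ km≤S = begin
      d Nat.* m              ≤⟨ ℕₚ.*-monoˡ-≤ m d≤ ⟩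
      a Nat.* k Nat.* m      ≡⟨ ℕₚ.*-assoc a k m ⟩
      a Nat.* (k Nat.* m)    ≤⟨ ℕₚ.*-monoʳ-≤ a km≤S ⟩
      a Nat.* S              ∎

  conclude : ∀ t → log₂ R R>0 ≤ fromℕ t → (dx Nat.+ dy) Nat.* l Nat.* t Nat.≤ C Nat.* S →
    fromℚ c * ((fromℕ dx + fromℕ dy) * fromℕ l * log₂ R R>0) ≤ fromℕ S
  conclude t log≤t d*l*t≤ ε 0<ε =
    -- The factor w can be 0, hence the division by w + 1.
    let η , 0<η , η[w+1]≡ε = divide (+-mono-≤-< 0≤w (0<ι 1)) 0<ε
        n , h = log≤t η 0<η
    in n , λ i p → begin
      c ⊛ (D ⊛ ι l ⊛ λ′ i)     ≡⟨ solve 4 (λ c d l x → c :* (d :* l :* x) := c :* (d :* l) :* x) refl c D (ι l) (λ′ i) ⟩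
      w ⊛ λ′ i                 ≤⟨ *-monoˡ 0≤w (h i p) ⟩
      w ⊛ (ι t ⊕ η)            ≡⟨ solve 4 (λ c w t η → w :* (t :+ η) := w :* t :+ η :* w) refl c w (ι t) η ⟩
      w ⊛ ι t ⊕ η ⊛ w          ≤⟨ +-mono-≤ w*t≤S (*-monoˡ (<⇒≤ 0<η) w≤w+1) ⟩
      ι S ⊕ η ⊛ (w ⊕ 1ℚ)       ≡⟨ cong (ι S ⊕_) η[w+1]≡ε ⟩
      ι S ⊕ ε                  ∎
    where
    open ≤-Reasoning
    λ′ : ℕ → ℚ
    λ′ i = log₂-approx i (seq R i)
    D w : ℚ
    D = ι dx ⊕ ι dy
    w = c ⊛ (D ⊛ ι l)
    0≤c : 0ℚ ≼ c
    0≤c = <⇒≤ 0<c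
    0≤w : 0ℚ ≼ w
    0≤w = *-nonNeg 0≤c (*-nonNeg (+-nonNeg (0≤ι dx) (0≤ι dy)) (0≤ι l))
    w≤w+1 : w ≼ w ⊕ 1ℚ
    w≤w+1 = subst (_≼ w ⊕ 1ℚ) (+-identityʳ w) (+-monoʳ-≤ w (0≤ι 1))
    w*t≤S : w ⊛ ι t ≼ ι S
    w*t≤S = begin
      c ⊛ (D ⊛ ι l) ⊛ ι t                        ≡⟨ *-assoc c (D ⊛ ι l) (ι t) ⟩
      c ⊛ (D ⊛ ι l ⊛ ι t)                        ≡⟨ cong (λ d → c ⊛ (d ⊛ ι l ⊛ ι t)) (sym (ι-+ dx dy)) ⟩
      c ⊛ (ι (dx Nat.+ dy) ⊛ ι l ⊛ ι t)
        ≡⟨ cong (c ⊛_) (sym (trans (ι-* ((dx Nat.+ dy) Nat.* l) t) (cong (_⊛ ι t) (ι-* (dx Nat.+ dy) l)))) ⟩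
      c ⊛ ι ((dx Nat.+ dy) Nat.* l Nat.* t)      ≤⟨ *-monoˡ 0≤c (ι-mono-≤ d*l*t≤) ⟩
      c ⊛ ι (C Nat.* S)                          ≡⟨ cong (c ⊛_) (ι-* C S) ⟩
      c ⊛ (ι C ⊛ ι S)                            ≡⟨ solve 3 (λ c m s → c :* (m :* s) := c :* m :* s) refl c (ι C) (ι S) ⟩
      c ⊛ ι C ⊛ ι S                              ≡⟨ cong (_⊛ ι S) c*C≡1 ⟩
      1ℚ ⊛ ι S                                   ≡⟨ *-identityˡ (ι S) ⟩
      ι S                                        ∎

  conclude-levels : ∀ r {m} → (dx Nat.+ dy) Nat.* m Nat.≤ 288 Nat.* S → m ≡ p Nat.* r →
    log₂ R R>0 ≤ fromℕ (13 Nat.* r) → fromℚ c * ((fromℕ dx + fromℕ dy) * fromℕ l * log₂ R R>0) ≤ fromℕ S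
  conclude-levels r h refl log≤ = conclude (13 Nat.* r) log≤ (begin
    d Nat.* l Nat.* (13 Nat.* r)                  ≤⟨ ℕₚ.*-monoˡ-≤ (13 Nat.* r) (ℕₚ.*-monoʳ-≤ d (Designs.≤3*multiplicity l)) ⟩
    d Nat.* (3 Nat.* p) Nat.* (13 Nat.* r)
      ≡⟨ solveℕ 3 (λ d p r → d :⊗ (conℕ 3 :⊗ p) :⊗ (conℕ 13 :⊗ r) ⊜ conℕ 39 :⊗ (d :⊗ (p :⊗ r))) refl d p r ⟩
    39 Nat.* (d Nat.* (p Nat.* r))                ≤⟨ ℕₚ.*-monoʳ-≤ 39 h ⟩
    39 Nat.* (288 Nat.* S)                        ≡⟨ C-factors S ⟩
    C Nat.* S                                     ∎)
    where
    open ℕₚ.≤-Reasoning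
    open ℕSolver.+-*-Solver using () renaming (solve to solveℕ; _:=_ to _⊜_; _:*_ to _:⊗_; con to conℕ)
    d = dx Nat.+ dy

  log₂R≤ : ∀ t → (∃[ n ] (∀ i → n Nat.≤ i → seq R i ≼ ι (2 Nat.^ t))) → log₂ R R>0 ≤ fromℕ t
  log₂R≤ t (n , R≤) ε 0<ε = n Nat.⊔ from , λ i i≥ → begin
    log₂-approx i (seq R i)   ≤⟨ log₂-approx≤ i (seq R i) (0<R i (≤ʳ n i≥)) t (R≤ i (≤ˡ n i≥)) ⟩
    ι t                       ≡⟨ sym (+-identityʳ (ι t)) ⟩
    ι t ⊕ 0ℚ                  ≤⟨ +-monoʳ-≤ (ι t) (<⇒≤ 0<ε) ⟩
    ι t ⊕ ε                   ∎
    where open ≤-Reasoning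

  ¼ : ℚ
  ¼ = Int.+ 1 Rat./ 4

  0<¼ : 0ℚ ≺ ¼
  0<¼ = positive⁻¹ ¼

  -- The hypothesis on N in integral form. If l a were at least 2 N + 1, then l a / 2 would exceed N
  -- by 1/2, more than the slack 1/4 at which the real inequality is read.
  capacity : ∃[ n ] (∀ i → n Nat.≤ i → ∀ a → ι (2 Nat.^ a) ≼ seq R i ⊛ ι l → l Nat.* a Nat.≤ 2 Nat.* N)
  capacity = let n , h = large ¼ 0<¼ in n Nat.⊔ from , λ i i≥ a 2^a≤Rl →
    ℕₚ.≮⇒≥ λ 2N<la → <-irrefl refl (<-≤-trans (half-integer a 2N<la) (begin
      ½ ⊛ ι l ⊛ ι a                               ≤⟨ *-monoˡ (*-nonNeg (nonNegative⁻¹ ½) (0≤ι l))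
                                                      (log₂-approx≥ i (seq R i ⊛ ι l) (*-pos (0<R i (≤ʳ n i≥)) (0<ι l)) a 2^a≤Rl) ⟩
      ½ ⊛ ι l ⊛ log₂-approx i (seq R i ⊛ ι l)     ≤⟨ h i (≤ˡ n i≥) ⟩
      ι N ⊕ ¼                                     ∎))
    where
    open ≤-Reasoning
    half-integer : ∀ a → 2 Nat.* N Nat.< l Nat.* a → ι N ⊕ ¼ ≺ ½ ⊛ ι l ⊛ ι a
    half-integer a 2N<la = begin-strict
      ι N ⊕ ¼                       <⟨ +-monoʳ-< (ι N) {¼} {½} (from-yes (¼ <? ½)) ⟩
      ι N ⊕ ½                       ≡⟨ solve 1 (λ n → n :+ con ½ := con ½ :* (con (ι 1) :+ con (ι 2) :* n)) refl (ι N) ⟩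
      ½ ⊛ (ι 1 ⊕ ι 2 ⊛ ι N)         ≡⟨ cong (½ ⊛_) (sym (trans (ι-+ 1 (2 Nat.* N)) (cong (ι 1 ⊕_) (ι-* 2 N)))) ⟩
      ½ ⊛ ι (suc (2 Nat.* N))       ≤⟨ *-monoˡ (nonNegative⁻¹ ½) (ι-mono-≤ 2N<la) ⟩
      ½ ⊛ ι (l Nat.* a)             ≡⟨ cong (½ ⊛_) (ι-* l a) ⟩
      ½ ⊛ (ι l ⊛ ι a)               ≡⟨ sym (*-assoc ½ (ι l) (ι a)) ⟩
      ½ ⊛ ι l ⊛ ι a                 ∎

  -- A level of blocks does not fit only if N < l/2 (or N = 0, l = 1), and then the hypothesis on N forces R ≤ 1.
  shortWindow : N Nat.< p → log₂ R R>0 ≤ fromℕ 0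
  shortWindow N<p with 2 ℕₚ.≤? l
  ... | yes 2≤l = let n , h = capacity in log₂R≤ 0 (n Nat.⊔ from , λ i i≥ →
    ≮⇒≥ λ 1<R → ℕₚ.<⇒≱ (2N<l 2≤l) (subst (Nat._≤ 2 Nat.* N) (ℕₚ.*-identityʳ l) (h i (≤ˡ n i≥) 1 (begin
      ι 2              ≡⟨ sym (*-identityˡ (ι 2)) ⟩
      1ℚ ⊛ ι 2         ≤⟨ *-mono (0≤ι 1) (0≤ι l) (<⇒≤ 1<R) (ι-mono-≤ 2≤l) ⟩
      seq R i ⊛ ι l    ∎))))
    where
    open ≤-Reasoning
    2N<l : 2 Nat.≤ l → 2 Nat.* N Nat.< l
    2N<l 2≤l = ℕₚ.<-≤-trans (ℕₚ.*-monoʳ-< 2 N<p)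
      (subst (Nat._≤ l) (cong (p Nat.+_) (sym (ℕₚ.+-identityʳ p))) (Designs.2*multiplicity≤ l 2≤l))
  ... | no  2≰l = λ ε 0<ε →
    let d , 0<d , d+d≡ε = half 0<ε
        n , h = large d 0<d
    in n , λ i i≥ → begin
      X i                                          ≡⟨ solve 1 (λ x → x := con (ι 2) :* (con ½ :* con 1ℚ :* x)) refl (X i) ⟩
      ι 2 ⊛ (½ ⊛ 1ℚ ⊛ X i)
        ≡⟨ cong (λ r → ι 2 ⊛ (½ ⊛ 1ℚ ⊛ log₂-approx i r)) (sym (*-identityʳ (seq R i))) ⟩
      ι 2 ⊛ (½ ⊛ 1ℚ ⊛ log₂-approx i (seq R i ⊛ 1ℚ))
        ≡⟨ cong (λ z → ι 2 ⊛ (½ ⊛ z ⊛ log₂-approx i (seq R i ⊛ z))) (sym (cong ι l≡1)) ⟩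
      ι 2 ⊛ (½ ⊛ ι l ⊛ log₂-approx i (seq R i ⊛ ι l)) ≤⟨ *-monoˡ (0≤ι 2) (h i i≥) ⟩
      ι 2 ⊛ (ι N ⊕ d)                              ≡⟨ cong (λ n → ι 2 ⊛ (ι n ⊕ d)) N≡0 ⟩
      ι 2 ⊛ (0ℚ ⊕ d)                               ≡⟨ solve 1 (λ d → con (ι 2) :* (con 0ℚ :+ d) := con 0ℚ :+ (d :+ d)) refl d ⟩
      0ℚ ⊕ (d ⊕ d)                                 ≡⟨ cong (0ℚ ⊕_) d+d≡ε ⟩
      0ℚ ⊕ ε                                       ∎
    where
    open ≤-Reasoning
    X : ℕ → ℚ
    X i = log₂-approx i (seq R i)
    l≡1 : l ≡ 1
    l≡1 = ℕₚ.≤-antisym (ℕₚ.≤-pred (ℕₚ.≰⇒> 2≰l)) (Nat.>-nonZero⁻¹ l)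
    N≡0 : N ≡ 0
    N≡0 = ℕₚ.n≤0⇒n≡0 (ℕₚ.≤-pred (subst (N Nat.<_) (cong multiplicity l≡1) N<p))

  -- A positive rational to stand for R wherever a comparison must be decided.
  near : ∃[ n ] ∃[ q ] 0ℚ ≺ q × (∀ i → n Nat.≤ i → seq R i ≼ q ⊕ ¼ × q ≼ seq R i ⊕ ¼)
  near = let n , h = isCauchy R ¼ 0<¼
             j = n Nat.⊔ from
         in n , seq R j , 0<R j (ℕₚ.m≤n⊔m n from) ,
            λ i i≥ → h i j i≥ (ℕₚ.m≤m⊔n n from) , h j i (ℕₚ.m≤m⊔n n from) i≥

  +1-mono-≤ : ∀ {m n} → m Nat.< n → ι m ⊕ 1ℚ ≼ ι n
  +1-mono-≤ {m} {n} m<n = subst (_≼ ι n) (trans (ι-+ 1 m) (+-comm 1ℚ (ι m))) (ι-mono-≤ m<n)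

  ¼≤1 : ¼ ≼ 1ℚ
  ¼≤1 = from-yes (¼ ≤? 1ℚ)

  low-level : fromℕ (64 Nat.^ 0) ≤ R + fromℕ 1
  low-level ε 0<ε = from , λ i i≥ → begin
    1ℚ                      ≡⟨ sym (+-identityʳ 1ℚ) ⟩
    1ℚ ⊕ 0ℚ                 ≤⟨ +-monoʳ-≤ 1ℚ (<⇒≤ 0<ε) ⟩
    1ℚ ⊕ ε                  ≡⟨ cong (_⊕ ε) (sym (+-identityˡ 1ℚ)) ⟩
    0ℚ ⊕ 1ℚ ⊕ ε             ≤⟨ +-monoˡ-≤ ε (+-monoˡ-≤ 1ℚ (<⇒≤ (0<R i i≥))) ⟩
    seq R i ⊕ 1ℚ ⊕ ε        ∎
    where open ≤-Reasoning

  module LargeR (r n : ℕ) (q : ℚ) (≤q : ι (64 Nat.^ suc r) ≼ q) (q≤ : q ≼ ι (64 Nat.^ suc (suc r)))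
    (close : ∀ i → n Nat.≤ i → seq R i ≼ q ⊕ ¼ × q ≼ seq R i ⊕ ¼) where

    open ≤-Reasoning

    ρ : ℕ
    ρ = suc r

    64^≡ : ∀ n → 64 Nat.^ n ≡ 2 Nat.^ (6 Nat.* n)
    64^≡ = ℕₚ.^-*-assoc 2 6

    2^m<2^n : ∀ {m n} → m Nat.< n → 2 Nat.^ m Nat.< 2 Nat.^ n
    2^m<2^n = ℕₚ.^-monoʳ-< 2 (s≤s (s≤s z≤n))

    level : fromℕ (64 Nat.^ ρ) ≤ R + fromℕ 1
    level ε 0<ε = n , λ i i≥ → begin
      ι (64 Nat.^ ρ)          ≤⟨ ≤q ⟩
      q                       ≤⟨ proj₂ (close i i≥) ⟩
      seq R i ⊕ ¼             ≤⟨ +-monoʳ-≤ (seq R i) ¼≤1 ⟩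
      seq R i ⊕ 1ℚ            ≡⟨ sym (+-identityʳ _) ⟩
      seq R i ⊕ 1ℚ ⊕ 0ℚ       ≤⟨ +-monoʳ-≤ (seq R i ⊕ 1ℚ) (<⇒≤ 0<ε) ⟩
      seq R i ⊕ 1ℚ ⊕ ε        ∎

    -- As R ≤ 64^(ρ+1) + 1/4, an integer factor t with 6 (ρ + 1) < t ρ for all ρ ≥ 1 is wanted; 13
    -- is the least, by the case ρ = 1. Strictness pays for the 1/4.
    log≤ : log₂ R R>0 ≤ fromℕ (13 Nat.* ρ)
    log≤ = log₂R≤ (13 Nat.* ρ) (n , λ i i≥ → begin
      seq R i                             ≤⟨ proj₁ (close i i≥) ⟩
      q ⊕ ¼                               ≤⟨ +-mono-≤ q≤ ¼≤1 ⟩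
      ι (64 Nat.^ suc ρ) ⊕ 1ℚ             ≡⟨ cong (λ x → ι x ⊕ 1ℚ) (64^≡ (suc ρ)) ⟩
      ι (2 Nat.^ (6 Nat.* suc ρ)) ⊕ 1ℚ    ≤⟨ +1-mono-≤ (2^m<2^n exponent) ⟩
      ι (2 Nat.^ (13 Nat.* ρ))            ∎)
      where
      open ℕSolver.+-*-Solver using () renaming (solve to solveℕ; _:=_ to _⊜_; _:+_ to _:⊕_; _:*_ to _:⊗_; con to conℕ)
      exponent : 6 Nat.* suc ρ Nat.< 13 Nat.* ρ
      exponent = subst (6 Nat.* suc ρ Nat.<_)
        (solveℕ 1 (λ r → conℕ 1 :⊕ conℕ 6 :⊗ (conℕ 2 :⊕ r) :⊕ conℕ 7 :⊗ r ⊜ conℕ 13 :⊗ (conℕ 1 :⊕ r)) refl r)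
        (ℕₚ.m≤m+n (suc (6 Nat.* suc ρ)) (7 Nat.* r))

    -- One bit, from 6 ρ = 6 + 6 r down to 5 + 6 r, pays for the distance between q and R.
    R≥ : ∀ i → n Nat.≤ i → ι (2 Nat.^ (5 Nat.+ 6 Nat.* r)) ≼ seq R i
    R≥ i i≥ = begin
      ι (2 Nat.^ (5 Nat.+ 6 Nat.* r))              ≡⟨ solve 1 (λ x → x := x :+ con 1ℚ :- con 1ℚ) refl _ ⟩
      ι (2 Nat.^ (5 Nat.+ 6 Nat.* r)) ⊕ 1ℚ ⊝ 1ℚ    ≤⟨ +-monoˡ-≤ (⊖ 1ℚ) (+1-mono-≤ (2^m<2^n exponent)) ⟩
      ι (2 Nat.^ (6 Nat.* ρ)) ⊝ 1ℚ                 ≡⟨ cong (λ x → ι x ⊝ 1ℚ) (sym (64^≡ ρ)) ⟩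
      ι (64 Nat.^ ρ) ⊝ 1ℚ                          ≤⟨ +-monoˡ-≤ (⊖ 1ℚ) (≤-trans ≤q (proj₂ (close i i≥))) ⟩
      seq R i ⊕ ¼ ⊝ 1ℚ                             ≤⟨ +-monoˡ-≤ (⊖ 1ℚ) (+-monoʳ-≤ (seq R i) ¼≤1) ⟩
      seq R i ⊕ 1ℚ ⊝ 1ℚ                            ≡⟨ solve 1 (λ x → x :+ con 1ℚ :- con 1ℚ := x) refl (seq R i) ⟩
      seq R i                                      ∎
      where
      exponent : 5 Nat.+ 6 Nat.* r Nat.< 6 Nat.* ρ
      exponent = ℕₚ.≤-reflexive (sym (ℕₚ.*-suc 6 r))

    -- `capacity` is used at exponent 5 + 6 r with R ≤ R l, and p ≤ l reduces the claim to 3 (1 + r)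
    -- ≤ 5 + 6 r.
    room : 3 Nat.* (p Nat.* ρ) Nat.≤ 2 Nat.* N
    room = let m , h = capacity
               i = m Nat.⊔ (n Nat.⊔ from)
               n⊔from≤i = ℕₚ.m≤n⊔m m (n Nat.⊔ from)
           in ℕₚ.≤-trans 3pρ≤ (h i (ℕₚ.m≤m⊔n m _) (5 Nat.+ 6 Nat.* r) (begin
             ι (2 Nat.^ (5 Nat.+ 6 Nat.* r))    ≤⟨ R≥ i (≤ˡ n n⊔from≤i) ⟩
             seq R i                            ≡⟨ sym (*-identityʳ (seq R i)) ⟩
             seq R i ⊛ 1ℚ                       ≤⟨ *-monoˡ (<⇒≤ (0<R i (≤ʳ n n⊔from≤i))) (ι-mono-≤ (Nat.>-nonZero⁻¹ l)) ⟩
             seq R i ⊛ ι l                      ∎))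
      where
      open ℕSolver.+-*-Solver using () renaming (solve to solveℕ; _:=_ to _⊜_; _:+_ to _:⊕_; _:*_ to _:⊗_; con to conℕ)
      3pρ≤ : 3 Nat.* (p Nat.* ρ) Nat.≤ l Nat.* (5 Nat.+ 6 Nat.* r)
      3pρ≤ = ℕₚ.≤-trans (ℕₚ.*-monoʳ-≤ 3 (ℕₚ.*-monoˡ-≤ ρ (Designs.multiplicity≤ l)))
        (subst (Nat._≤ l Nat.* (5 Nat.+ 6 Nat.* r)) (solveℕ 2 (λ l r → l :⊗ (conℕ 3 :⊕ conℕ 3 :⊗ r) ⊜ conℕ 3 :⊗ (l :⊗ (conℕ 1 :⊕ r))) refl l r)
          (ℕₚ.*-monoʳ-≤ l (ℕₚ.+-mono-≤ (ℕₚ.m≤m+n 3 2) (ℕₚ.*-monoˡ-≤ r (ℕₚ.m≤m+n 3 3)))))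

  Conclusion : Set
  Conclusion = fromℚ c * ((fromℕ dx + fromℕ dy) * fromℕ l * log₂ R R>0) ≤ fromℕ S

  largeR : ∀ n q → (∀ i → n Nat.≤ i → seq R i ≼ q ⊕ ¼ × q ≼ seq R i ⊕ ¼) →
    ∀ r → ι (64 Nat.^ suc r) ≼ q → q ≼ ι (64 Nat.^ suc (suc r)) → Conclusion
  largeR n q close r ≤q q≤ = conclude-levels (suc r)
    (space level (Designs.levels-feasible N l (suc r)) (Designs.size-levels≤N N l (suc r) room))
    (Designs.length-levels N l (suc r)) log≤
    where open LargeR r n q ≤q q≤ close

  smallR : ∀ n q → (∀ i → n Nat.≤ i → seq R i ≼ q ⊕ ¼ × q ≼ seq R i ⊕ ¼) → q ≼ ι 64 → Conclusion
  smallR n q close q≤64 with p ℕₚ.≤? N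
  ... | yes p≤N = conclude-levels 1
    (space low-level (Designs.flat-feasible N l p≤N) (Designs.size-flat N l))
    (trans (length-replicate p) (sym (ℕₚ.*-identityʳ p)))
    -- Here R ≤ 64 + 1/4; the generous bound 2^13 matches the factor 13 per level of the case of
    -- large R.
    (log₂R≤ 13 (n , λ i i≥ → ≤-trans (proj₁ (close i i≥)) (≤-trans (+-mono-≤ q≤64 ¼≤1) (+1-mono-≤ (ℕₚ.<ᵇ⇒< 64 (2 Nat.^ 13) _)))))
  -- With log₂ R ≤ 0 the claimed bound is trivial.
  ... | no p≰N = conclude 0 (shortWindow (ℕₚ.≰⇒> p≰N))
    (subst (Nat._≤ C Nat.* S) (sym (ℕₚ.*-zeroʳ ((dx Nat.+ dy) Nat.* l))) z≤n)

  lower-bound : Conclusion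
  lower-bound =
    let n , q , 0<q , close = near
    in [_,_]′ (smallR n q close) (λ (r , ≤q , q≤) → largeR n q close r ≤q q≤) (bracket 64 (s≤s (s≤s z≤n)) q 0<q)

open import Data.Rational.Base using (_/_)

theorem4 : Σ[ c ∈ ℚ ] 0ℚ Rat.< c ×
    (∀ (dx dy l N S : ℕ) {{_ : NonZero l}} (R : ℝ) (R>0 : Positive R) →
    let ε   = 1ℤ / l
        1/ε = fromℕ l
    in
    fromℚ ½ * 1/ε * log₂ (R * 1/ε) (*-positive R>0 (fromℕ-positive l)) ≤ fromℕ N →
    (alg : Algorithm S dx dy) →
    SolvesSlidingWindowAMM N R ε alg →
    fromℚ c * ((fromℕ dx + fromℕ dy) * 1/ε * log₂ R R>0) ≤ fromℕ S)
theorem4 = Constant.c , Constant.0<c , λ dx dy l N S R R>0 large alg solves →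
  LowerBound.lower-bound {dx} {dy} {l} {N} {S} R R>0 alg solves large
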